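{- Let $L \subset \mathbb{R}^n$ be a strongly perfect lattice. Then $L$ is extreme, i.e. $L$ is a local maximum of the density function $\delta$ on the space of similarity classes of $n$-dimensional lattices.
   Context: A lattice $L$ of dimension $n$ is the set of all integral linear combinations of the vectors of a basis $(b_1,\dots,b_n)$ of the Euclidean space $(\mathbb{R}^n,(\cdot,\cdot))$. Its minimum is $\min(L) = \min\{(x,x) \mid 0 \neq x \in L\}$, its set of minimal vectors is $\mathrm{Min}(L) = \{x \in L \mid (x,x) = \min(L)\}$, and its determinant is $\det(L) = \det((b_i,b_j))_{i,j=1}^n$. The density of $L$ is $$\delta(L) = \frac{V_n}{2^n}\sqrt{\frac{\min(L)^n}{\det(L)}},$$ where $V_n$ is the volume of the $n$-dimensional unit ball; $\delta$ is invariant under similarities and so is a function on the space of similarity classes of $n$-dimensional lattices. A lattice is called extreme if it is a local maximum of $\delta$ on this space. A nonempty finite subset $X$ of the sphere $S^{n-1} = \{x \in \mathbb{R}^n \mid (x,x) = 1\}$ is called a spherical $t$-design if $$\frac{1}{|X|}\sum_{x \in X} f(x) = \int_{S^{n-1}} f(x)\, d\mu(x)$$ for all homogeneous polynomials $f \in \mathbb{R}[x_1,\dots,x_n]$ of degree $k \le t$, where $\mu$ is the $O_n(\mathbb{R})$-invariant measure on $S^{n-1}$ of total mass $1$. A lattice $L$ is called strongly perfect if $\mathrm{Min}(L)$, rescaled by the factor $1/\sqrt{\min(L)}$ so as to lie on $S^{n-1}$, is a spherical $4$-design. -}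

module Defs where

open import Algebra.Bundles using (CommutativeRing; Semiring)
import Algebra.Definitions.RawSemiring as RawSemiringDefinitions
open import Data.Fin.Base using (Fin; zero; suc; toℕ; punchIn)
open import Data.Integer.Base using (ℤ; +_; -[1+_])
open import Data.List.Base using (List; []; _∷_)
open import Data.Nat.Base as ℕ using (ℕ; zero; suc; NonZero)
open import Data.Product.Base using (Σ; ∃; ∃-syntax; _×_; _,_)
open import Data.Vec.Functional using (Vector; foldr)
import Data.Vec.Functional.Relation.Binary.Equality.Setoid as VectorEquality
open import Function.Bundles using (_⇔_)
open import Function.Definitions using (Injective)
open import Level using (0ℓ)
open import Relation.Binary.Core using (Rel)
open import Relation.Binary.PropositionalEquality.Core using (_≡_)
open import Relation.Binary.Structures using (IsTotalOrder)
open import Relation.Nullary.Negation.Core using (¬_)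

-- The field of real numbers, given axiomatically as a (Dedekind-)complete
-- ordered field; classically this determines it up to unique isomorphism.
-- The inverse and the supremum are total functions with unspecified values
-- outside their proper domains (x ≈ 0#, respectively S empty or unbounded).
record RealField : Set₁ where
  infix 4 _≤_ _<_
  infix 9 _⁻¹
  field
    commutativeRing : CommutativeRing 0ℓ 0ℓ

  open CommutativeRing commutativeRing public hiding (zero)

  field
    0≉1          : ¬ (0# ≈ 1#)
    _⁻¹          : Carrier → Carrier
    *-inverseʳ   : ∀ x → ¬ (x ≈ 0#) → x * x ⁻¹ ≈ 1#
    _≤_          : Rel Carrier 0ℓ
    isTotalOrder : IsTotalOrder _≈_ _≤_
    +-monoˡ-≤    : ∀ z {x y} → x ≤ y → x + z ≤ y + z
    *-nonNeg     : ∀ {x y} → 0# ≤ x → 0# ≤ y → 0# ≤ x * y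

  UpperBound : (Carrier → Set) → Carrier → Set
  UpperBound S b = ∀ x → S x → x ≤ b

  field
    sup       : (Carrier → Set) → Carrier
    sup-upper : ∀ S → ∃ S → ∃ (UpperBound S) → UpperBound S (sup S)
    sup-least : ∀ S → ∃ S → ∀ b → UpperBound S b → sup S ≤ b

  _<_ : Rel Carrier 0ℓ
  x < y = x ≤ y × ¬ (x ≈ y)

module Lattices (𝓡 : RealField) where

  open RealField 𝓡 public renaming (Carrier to ℝ)
  open RawSemiringDefinitions (Semiring.rawSemiring semiring) public
    using (sum; product; _^_) renaming (_×_ to _·ℕ_)
  open VectorEquality setoid public using (_≋_)

  fromℕ : ℕ → ℝ
  fromℕ k = k ·ℕ 1#

  fromℤ : ℤ → ℝ
  fromℤ (+ k)    = fromℕ k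
  fromℤ -[1+ k ] = - fromℕ (suc k)

  inf : (ℝ → Set) → ℝ
  inf S = - sup (λ y → S (- y))

  -- Meaningful for x ≥ 0 only.
  sqrt : ℝ → ℝ
  sqrt x = sup (λ y → y * y ≤ x)

  -- ∣ x - y ∣ < ε
  Close : ℝ → ℝ → ℝ → Set
  Close ε x y = x < y + ε × y < x + ε

  ℝ^_ : ℕ → Set
  ℝ^ n = Vector ℝ n

  Matrix : ℕ → Set
  Matrix n = Fin n → ℝ^ n

  𝟎 : ∀ {n} → ℝ^ n
  𝟎 _ = 0#

  infixr 7 _•_
  _•_ : ∀ {n} → ℝ → ℝ^ n → ℝ^ n
  (c • x) i = c * x i

  ⟨_,_⟩ : ∀ {n} → ℝ^ n → ℝ^ n → ℝ
  ⟨ x , y ⟩ = sum λ i → x i * y i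

  infixr 7 _·_
  _·_ : ∀ {n} → Matrix n → ℝ^ n → ℝ^ n
  (A · x) i = ⟨ A i , x ⟩

  combination : ∀ {m n} → Vector ℝ m → (Fin m → ℝ^ n) → ℝ^ n
  combination c b j = sum λ i → c i * b i j

  det : ∀ {n} → Matrix n → ℝ
  det {zero}  A = 1#
  det {suc n} A = sum λ j →
    (- 1#) ^ toℕ j * (A zero j * det (λ i k → A (suc i) (punchIn j k)))

  record IsBasis {n} (b : Fin n → ℝ^ n) : Set where
    field
      independent : ∀ c → combination c b ≋ 𝟎 → c ≋ 𝟎
      spanning    : ∀ x → ∃[ c ] x ≋ combination c b

  -- A lattice is presented by a basis; as a set of vectors it is the
  -- predicate _∈ L below.
  record Lattice (n : ℕ) : Set where
    field
      basis   : Fin n → ℝ^ n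
      isBasis : IsBasis basis

  open Lattice public

  infix 4 _∈_
  _∈_ : ∀ {n} → ℝ^ n → Lattice n → Set
  _∈_ {n} x L = Σ (Vector ℤ n) λ z → x ≋ combination (λ i → fromℤ (z i)) (basis L)

  -- L is discrete, so for n ≥ 1 this infimum is attained.
  min : ∀ {n} → Lattice n → ℝ
  min L = inf λ r → ∃[ x ] x ∈ L × ¬ (x ≋ 𝟎) × r ≈ ⟨ x , x ⟩

  Min : ∀ {n} → Lattice n → ℝ^ n → Set
  Min L x = x ∈ L × ⟨ x , x ⟩ ≈ min L

  detL : ∀ {n} → Lattice n → ℝ
  detL L = det λ i j → ⟨ basis L i , basis L j ⟩

  record Box (n : ℕ) : Set where
    field
      lower upper : ℝ^ n
      ordered     : ∀ i → lower i ≤ upper i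

  open Box public

  infix 4 _∈Box_
  _∈Box_ : ∀ {n} → ℝ^ n → Box n → Set
  x ∈Box B = ∀ i → lower B i ≤ x i × x i ≤ upper B i

  boxVolume : ∀ {n} → Box n → ℝ
  boxVolume B = product λ i → upper B i - lower B i

  -- The volume of the unit ball as the infimum of the total volumes of its
  -- finite coverings by boxes.  This is the Lebesgue measure since the ball
  -- is compact.
  unitBallVolume : ℕ → ℝ
  unitBallVolume n = inf λ r →
    ∃[ m ] Σ (Vector (Box n) m) λ B →
      (∀ x → ⟨ x , x ⟩ ≤ 1# → ∃[ k ] x ∈Box B k) ×
      r ≈ sum (λ k → boxVolume (B k))

  δ : ∀ {n} → Lattice n → ℝ
  δ {n} L = unitBallVolume n * (fromℕ 2 ^ n) ⁻¹ * sqrt (min L ^ n * detL L ⁻¹)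

  -- L′ is the image of L under a linear similarity x ↦ A · x of ratio √c.
  Similar : ∀ {n} → Lattice n → Lattice n → Set
  Similar {n} L L′ = Σ (Matrix n) λ A → ∃[ c ] 0# < c ×
    (∀ x y → ⟨ A · x , A · y ⟩ ≈ c * ⟨ x , y ⟩) ×
    (∀ y → y ∈ L′ ⇔ (∃[ x ] x ∈ L × y ≋ A · x))

  -- Open subsets of the space of similarity classes, as predicates on
  -- bases: the topology is the quotient topology, so that these are the
  -- similarity-invariant predicates which are open in the set of all bases
  -- with the topology of entrywise convergence.
  record IsOpen {n} (U : Lattice n → Set) : Set where
    field
      invariant : ∀ L L′ → Similar L L′ → U L → U L′
      isOpen    : ∀ L → U L → ∃[ ε ] 0# < ε ×
                  (∀ L′ → (∀ i j → Close ε (basis L i j) (basis L′ i j)) → U L′)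

  Extreme : ∀ {n} → Lattice n → Set₁
  Extreme {n} L = Σ (Lattice n → Set) λ U →
    IsOpen U × U L × (∀ L′ → U L′ → δ L′ ≤ δ L)

  record Sphere (n : ℕ) : Set where
    field
      point  : ℝ^ n
      isUnit : ⟨ point , point ⟩ ≈ 1#

  open Sphere public

  -- Elements of C(Sⁿ⁻¹).  Continuity forces f to respect _≋_ on points.
  record ContinuousFunction (n : ℕ) : Set where
    field
      fun        : Sphere n → ℝ
      continuous : ∀ x ε → 0# < ε → ∃[ η ] 0# < η ×
                   (∀ y → (∀ i → Close η (point x i) (point y i)) →
                          Close ε (fun x) (fun y))

  open ContinuousFunction public

  Orthogonal : ∀ {n} → Matrix n → Set
  Orthogonal T = ∀ x y → ⟨ T · x , T · y ⟩ ≈ ⟨ x , y ⟩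

  -- The Oₙ(ℝ)-invariant measure μ of total mass 1, as a Radon measure: a
  -- positive linear functional on C(Sⁿ⁻¹).  It exists (for n ≥ 1) and is
  -- unique.  The functions f + g, c f and f ∘ T are described by their values.
  record InvariantMeasure (n : ℕ) : Set where
    field
      ∫         : ContinuousFunction n → ℝ
      additive  : ∀ f g h → (∀ x → fun h x ≈ fun f x + fun g x) → ∫ h ≈ ∫ f + ∫ g
      scalar    : ∀ c f g → (∀ x → fun g x ≈ c * fun f x) → ∫ g ≈ c * ∫ f
      positive  : ∀ f → (∀ x → 0# ≤ fun f x) → 0# ≤ ∫ f
      invariant : ∀ T → Orthogonal T → ∀ f g →
                  (∀ x y → point y ≋ T · point x → fun g x ≈ fun f y) → ∫ g ≈ ∫ f
      totalMass : ∀ f → (∀ x → fun f x ≈ 1#) → ∫ f ≈ 1#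

  open InvariantMeasure public

  -- A list of terms c · x₁^α₁ ⋯ xₙ^αₙ with α₁ + ⋯ + αₙ ≡ k.
  HomogeneousPolynomial : ℕ → ℕ → Set
  HomogeneousPolynomial n k =
    List (ℝ × Σ (Vector ℕ n) λ α → foldr ℕ._+_ 0 α ≡ k)

  eval : ∀ {n k} → HomogeneousPolynomial n k → ℝ^ n → ℝ
  eval []                x = 0#
  eval ((c , α , _) ∷ p) x = c * product (λ i → x i ^ α i) + eval p x

  record FiniteSubset (n : ℕ) : Set where
    field
      size      : ℕ
      element   : Vector (Sphere n) size
      injective : Injective _≡_ _≋_ (λ i → point (element i))

  open FiniteSubset public

  -- F is the restriction of the polynomial f to the sphere, as an element
  -- of C(Sⁿ⁻¹).
  record IsSphericalDesign {n} (μ : InvariantMeasure n) (t : ℕ)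
                           (X : FiniteSubset n) : Set where
    field
      nonempty : NonZero (size X)
      average  : ∀ k → k ℕ.≤ t → (f : HomogeneousPolynomial n k) →
                 (F : ContinuousFunction n) →
                 (∀ x → fun F x ≈ eval f (point x)) →
                 fromℕ (size X) ⁻¹ * sum (λ i → eval f (point (element X i)))
                   ≈ ∫ μ F

  -- X is, as a set of vectors, Min(L) rescaled by 1/√min(L).
  IsRescaledMin : ∀ {n} → Lattice n → FiniteSubset n → Set
  IsRescaledMin L X = ∀ y →
    (∃[ i ] y ≋ point (element X i)) ⇔
    (∃[ x ] Min L x × y ≋ sqrt (min L) ⁻¹ • x)

  StronglyPerfect : ∀ {n} → InvariantMeasure n → Lattice n → Set
  StronglyPerfect {n} μ L =
    Σ (FiniteSubset n) λ X → IsRescaledMin L X × IsSphericalDesign μ 4 X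

{-# OPTIONS --safe #-}
-- Let X be the rescaled set of minimal vectors of L.  A lattice L′ near L is the
-- image of L under a linear map near the identity; let Q be the Gram matrix of
-- the image of the standard basis and write Q = λ (I + H) with tr H = 0 and H
-- small.  With q(y) = yᵀHy, every y in X gives min L′ / min L ≤ λ (1 + q(y)),
-- whereas det L′ / det L = λⁿ det (I + H) ≥ λⁿ (1 - c ε²), where ε is the largest
-- absolute value of an entry of H.  By the design property, q has mean 0 over X
-- and q² has mean 2β ∑ Hᵢⱼ² ≥ 2βε², where β = 1 / n(n+2).  If q ≥ -m and q ≤ κ on
-- X, then the mean of (q + m)(κ - q) is nonnegative, that is, mκ ≥ 2βε².  Hence
-- min q ≤ - 2βε² / κ ≤ - c ε² as soon as κ ≤ 2β / c, which holds for L′ close to L,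
-- and then (min L′ / min L)ⁿ ≤ λⁿ (1 + min q) ≤ det L′ / det L.
module Submission where

open import Defs
open import Axiom.ExcludedMiddle using (ExcludedMiddle)
open import Data.Nat.Base using (ℕ)
open import Level using (0ℓ)
import Algebra.Properties.CommutativeMonoid.Sum
import Algebra.Properties.CommutativeSemigroup
import Algebra.Properties.Ring
import Algebra.Properties.Semiring.Exp
import Algebra.Properties.Semiring.Mult
import Algebra.Properties.Semiring.Sum
import Algebra.Solver.Ring as RingSolver
open import Algebra.Solver.Ring.AlmostCommutativeRing using (fromCommutativeRing; _-Raw-AlmostCommutative⟶_)
open import Data.Empty using (⊥-elim)
open import Data.Fin.Base using (Fin; zero; suc; toℕ; punchIn)
open import Data.Fin.Properties using (_≟_)
open import Data.Integer.Base as ℤ using (ℤ; +_; -[1+_])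
import Data.Integer.Properties as ℤₚ
open import Data.List.Base using (List; []; length) renaming (_∷_ to _∷ˡ_)
open import Data.Maybe.Base using (Maybe; just; nothing)
open import Data.Nat.Base as ℕ using (zero; suc; NonZero)
import Data.Nat.Properties as ℕₚ
open import Data.Product.Base using (Σ; ∃-syntax; _×_; _,_; proj₁; proj₂)
import Data.Sign.Base as Sign
open import Data.Sum.Base using (_⊎_; inj₁; inj₂)
open import Data.Unit.Base using (⊤; tt)
open import Data.Vec.Functional using (Vector; _∷_; foldr)
open import Function.Bundles using (_⇔_; mk⇔; Equivalence)
open import Relation.Binary.PropositionalEquality.Core as ≡ using (_≡_)
import Relation.Binary.Reasoning.Setoid
open import Relation.Binary.Structures using (IsTotalOrder)
open import Relation.Nullary using (¬_; Dec; yes; no)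

open Algebra.Properties.CommutativeSemigroup ℕₚ.+-commutativeSemigroup using () renaming (interchange to +-interchange)

-- No integral over the sphere is evaluated. Means over X of polynomials of degree at most 4 are
-- integrals, hence invariant under orthogonal maps, even when X is not. Sign changes of coordinates
-- kill the moments with an index of odd multiplicity, and one reflection mixing two coordinates
-- with entries 3/5 and 4/5 up to sign (rational, unlike a turn by 45 degrees) ties the others
-- together. The moments are thus known up to scalars, and of β the estimate uses only that it is
-- positive, which follows because the fourth power of the norm has mean 1. Openness is asked in the
-- space of similarity classes, whereas the estimate concerns bases entrywise close to that of L.
-- The neighbourhood therefore consists of all lattices similar to one in a ball of bases. It is
-- open because a similarity and the integer change of basis belonging to it are linear with bounded
-- entries, and the bound on δ passes from the ball to the similar lattices because that change of
-- basis has determinant 1 or -1.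

module StronglyPerfectLattices (em : ExcludedMiddle 0ℓ) (𝓡 : RealField) where

  open Lattices 𝓡
  open Algebra.Properties.Ring ring
    using (-‿distribˡ-*; -‿distribʳ-*; -0#≈0#; -‿involutive; -‿+-comm)
  open Algebra.Properties.Semiring.Exp semiring using (^-homo-*)
  open Algebra.Properties.Semiring.Mult semiring using (×-homo-+; ×1-homo-*)
  open Algebra.Properties.Semiring.Sum semiring
    using (sum-cong-≋; sum-replicate-zero; ∑-distrib-+; ∑-comm; sum-remove;
           *-distribˡ-sum; *-distribʳ-sum)
  module Product = Algebra.Properties.CommutativeMonoid.Sum *-commutativeMonoid
  open Relation.Binary.Reasoning.Setoid setoid

  -- Integers as real numbers, and the ring solver

  fromℤ-⊖ : ∀ m n → fromℤ (m ℤ.⊖ n) ≈ fromℕ m - fromℕ n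
  fromℤ-⊖ zero    zero    = sym (-‿inverseʳ 0#)
  fromℤ-⊖ zero    (suc n) = sym (+-identityˡ _)
  fromℤ-⊖ (suc m) zero    = sym (trans (+-congˡ -0#≈0#) (+-identityʳ _))
  fromℤ-⊖ (suc m) (suc n) = begin
    fromℤ (suc m ℤ.⊖ suc n)           ≡⟨ ≡.cong fromℤ (ℤₚ.[1+m]⊖[1+n]≡m⊖n m n) ⟩
    fromℤ (m ℤ.⊖ n)                   ≈⟨ fromℤ-⊖ m n ⟩
    fromℕ m - fromℕ n                 ≈⟨ +-congʳ (+-identityʳ _) ⟨
    fromℕ m + 0# - fromℕ n            ≈⟨ +-congʳ (+-congˡ (-‿inverseʳ 1#)) ⟨
    fromℕ m + (1# - 1#) - fromℕ n     ≈⟨ +-congʳ (+-assoc _ _ _) ⟨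
    fromℕ m + 1# - 1# - fromℕ n       ≈⟨ +-assoc _ _ _ ⟩
    fromℕ m + 1# + (- 1# - fromℕ n)   ≈⟨ +-cong (+-comm _ _) (-‿+-comm _ _) ⟩
    1# + fromℕ m - (1# + fromℕ n)     ∎

  fromℤ-+ : ∀ i j → fromℤ (i ℤ.+ j) ≈ fromℤ i + fromℤ j
  fromℤ-+ (+ m)    (+ n)    = ×-homo-+ 1# m n
  fromℤ-+ (+ m)    -[1+ n ] = fromℤ-⊖ m (suc n)
  fromℤ-+ -[1+ m ] (+ n)    = trans (fromℤ-⊖ n (suc m)) (+-comm _ _)
  fromℤ-+ -[1+ m ] -[1+ n ] = begin
    - (1# + (1# + fromℕ (m ℕ.+ n)))   ≈⟨ -‿cong (+-congˡ (+-congˡ (×-homo-+ 1# m n))) ⟩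
    - (1# + (1# + (fromℕ m + fromℕ n))) ≈⟨ -‿cong (+-congˡ (trans (sym (+-assoc _ _ _)) (trans (+-congʳ (+-comm _ _)) (+-assoc _ _ _)))) ⟩
    - (1# + (fromℕ m + (1# + fromℕ n))) ≈⟨ -‿cong (+-assoc _ _ _) ⟨
    - (1# + fromℕ m + (1# + fromℕ n)) ≈⟨ -‿+-comm _ _ ⟨
    - (1# + fromℕ m) - (1# + fromℕ n) ∎

  fromℤ-neg : ∀ i → fromℤ (ℤ.- i) ≈ - fromℤ i
  fromℤ-neg (+ zero)  = sym -0#≈0#
  fromℤ-neg (+ suc n) = refl
  fromℤ-neg -[1+ n ]  = sym (-‿involutive _)

  fromℤ-* : ∀ i j → fromℤ (i ℤ.* j) ≈ fromℤ i * fromℤ j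
  fromℤ-* (+ m)    (+ n)    = begin
    fromℤ (Sign.+ ℤ.◃ m ℕ.* n) ≡⟨ ≡.cong fromℤ (ℤₚ.+◃n≡+n (m ℕ.* n)) ⟩
    fromℕ (m ℕ.* n)            ≈⟨ ×1-homo-* m n ⟩
    fromℕ m * fromℕ n          ∎
  fromℤ-* (+ m)    -[1+ n ] = begin
    fromℤ (Sign.- ℤ.◃ m ℕ.* suc n) ≡⟨ ≡.cong fromℤ (ℤₚ.-◃n≡-n (m ℕ.* suc n)) ⟩
    fromℤ (ℤ.- (+ (m ℕ.* suc n)))  ≈⟨ fromℤ-neg (+ (m ℕ.* suc n)) ⟩
    - fromℕ (m ℕ.* suc n)      ≈⟨ -‿cong (×1-homo-* m (suc n)) ⟩
    - (fromℕ m * fromℕ (suc n)) ≈⟨ -‿distribʳ-* _ _ ⟩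
    fromℕ m * - fromℕ (suc n)  ∎
  fromℤ-* -[1+ m ] (+ n)    = begin
    fromℤ (Sign.- ℤ.◃ suc m ℕ.* n) ≡⟨ ≡.cong fromℤ (ℤₚ.-◃n≡-n (suc m ℕ.* n)) ⟩
    fromℤ (ℤ.- (+ (suc m ℕ.* n)))  ≈⟨ fromℤ-neg (+ (suc m ℕ.* n)) ⟩
    - fromℕ (suc m ℕ.* n)      ≈⟨ -‿cong (×1-homo-* (suc m) n) ⟩
    - (fromℕ (suc m) * fromℕ n) ≈⟨ -‿distribˡ-* _ _ ⟩
    - fromℕ (suc m) * fromℕ n  ∎
  fromℤ-* -[1+ m ] -[1+ n ] = begin
    fromℕ (suc m ℕ.* suc n)    ≈⟨ ×1-homo-* (suc m) (suc n) ⟩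
    fromℕ (suc m) * fromℕ (suc n) ≈⟨ -‿involutive _ ⟨
    - - (fromℕ (suc m) * fromℕ (suc n)) ≈⟨ -‿cong (-‿distribˡ-* _ _) ⟩
    - (- fromℕ (suc m) * fromℕ (suc n)) ≈⟨ -‿distribʳ-* _ _ ⟩
    - fromℕ (suc m) * - fromℕ (suc n) ∎

  -- fromℤ, except that it sends 1 to 1# rather than to 1# + 0#: this is what
  -- lets the ring solver read con (+ 1) as 1#.
  coefficient : ℤ → ℝ
  coefficient (+ zero)        = 0#
  coefficient (+ suc zero)    = 1#
  coefficient (+ suc (suc n)) = 1# + coefficient (+ suc n)
  coefficient -[1+ zero ]     = - 1#
  coefficient -[1+ suc n ]    = - fromℕ (suc (suc n))

  coefficient≈fromℤ : ∀ i → coefficient i ≈ fromℤ i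
  coefficient≈fromℤ (+ zero)        = refl
  coefficient≈fromℤ (+ suc zero)    = sym (+-identityʳ 1#)
  coefficient≈fromℤ (+ suc (suc n)) = +-congˡ (coefficient≈fromℤ (+ suc n))
  coefficient≈fromℤ -[1+ zero ]     = -‿cong (sym (+-identityʳ 1#))
  coefficient≈fromℤ -[1+ suc n ]    = refl

  private
    coefficients : ℤ.+-*-rawRing -Raw-AlmostCommutative⟶ fromCommutativeRing commutativeRing
    coefficients = record
      { ⟦_⟧    = coefficient
      ; +-homo = λ i j → homo₂ _+_ ℤ._+_ +-cong fromℤ-+ i j
      ; *-homo = λ i j → homo₂ _*_ ℤ._*_ *-cong fromℤ-* i j
      ; -‿homo = λ i → trans (coefficient≈fromℤ (ℤ.- i)) (trans (fromℤ-neg i) (-‿cong (sym (coefficient≈fromℤ i))))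
      ; 0-homo = refl
      ; 1-homo = refl
      }
      where
      homo₂ : ∀ (_∙_ : ℝ → ℝ → ℝ) (_∘_ : ℤ → ℤ → ℤ) →
              (∀ {x x′ y y′} → x ≈ x′ → y ≈ y′ → (x ∙ y) ≈ (x′ ∙ y′)) →
              (∀ i j → fromℤ (i ∘ j) ≈ (fromℤ i ∙ fromℤ j)) →
              ∀ i j → coefficient (i ∘ j) ≈ (coefficient i ∙ coefficient j)
      homo₂ _ _∘_ cong homo i j = trans (coefficient≈fromℤ (i ∘ j))
        (trans (homo i j) (cong (sym (coefficient≈fromℤ i)) (sym (coefficient≈fromℤ j))))

    equal? : ∀ i j → Maybe (coefficient i ≈ coefficient j)
    equal? i j with i ℤₚ.≟ j
    ... | yes ≡.refl = just refl
    ... | no  _      = nothing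

  open RingSolver ℤ.+-*-rawRing (fromCommutativeRing commutativeRing) coefficients equal?
    using (solve; _:=_; con; _:+_; _:*_; _:-_; :-_)

  -- The order

  module O = IsTotalOrder isTotalOrder

  2# : ℝ
  2# = 1# + 1#

  -- Turns an inequality into a ring identity: the nonnegative difference e is supplied explicitly,
  -- and the remaining equation is left to the solver.
  ≤-by : ∀ {x y} e → 0# ≤ e → y ≈ x + e → x ≤ y
  ≤-by {x} e 0≤e y≈ = O.trans (O.reflexive (sym (+-identityˡ x)))
    (O.trans (+-monoˡ-≤ x 0≤e) (O.reflexive (trans (+-comm e x) (sym y≈))))

  0≤-resp : ∀ {x y} → 0# ≤ x → y ≈ x → 0# ≤ y
  0≤-resp 0≤x y≈x = O.trans 0≤x (O.reflexive (sym y≈x))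

  0≤y-x : ∀ {x y} → x ≤ y → 0# ≤ y - x
  0≤y-x {x} x≤y = O.trans (O.reflexive (sym (-‿inverseʳ x))) (+-monoˡ-≤ (- x) x≤y)

  0≤+ : ∀ {x y} → 0# ≤ x → 0# ≤ y → 0# ≤ x + y
  0≤+ {x} {y} 0≤x 0≤y = O.trans 0≤y
    (≤-by x 0≤x (+-comm x y))

  neg-mono-≤ : ∀ {x y} → x ≤ y → - y ≤ - x
  neg-mono-≤ {x} {y} x≤y = ≤-by (y - x) (0≤y-x x≤y)
    (solve 2 (λ x y → :- x := (:- y) :+ (y :- x)) refl x y)

  *-monoˡ-≤ : ∀ {x y} z → 0# ≤ z → x ≤ y → z * x ≤ z * y
  *-monoˡ-≤ {x} {y} z 0≤z x≤y = ≤-by (z * (y - x)) (*-nonNeg 0≤z (0≤y-x x≤y))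
    (solve 3 (λ x y z → z :* y := (z :* x) :+ (z :* (y :- x))) refl x y z)

  *-mono-≤ : ∀ {x y u v} → 0# ≤ x → 0# ≤ v → x ≤ y → u ≤ v → x * u ≤ y * v
  *-mono-≤ {x} {y} {u} {v} 0≤x 0≤v x≤y u≤v =
    ≤-by (x * (v - u) + (y - x) * v) (0≤+ (*-nonNeg 0≤x (0≤y-x u≤v)) (*-nonNeg (0≤y-x x≤y) 0≤v))
    (solve 4 (λ x y u v → y :* v := (x :* u) :+ ((x :* (v :- u)) :+ ((y :- x) :* v))) refl x y u v)

  0≤² : ∀ x → 0# ≤ x * x
  0≤² x with O.total 0# x
  ... | inj₁ 0≤x = *-nonNeg 0≤x 0≤x
  ... | inj₂ x≤0 = 0≤-resp (*-nonNeg 0≤-x 0≤-x) (solve 1 (λ x → x :* x := (:- x) :* (:- x)) refl x)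
    where
    0≤-x : 0# ≤ - x
    0≤-x = 0≤-resp (0≤y-x x≤0) (sym (+-identityˡ _))

  0≤1 : 0# ≤ 1#
  0≤1 = 0≤-resp (0≤² 1#) (sym (*-identityˡ 1#))

  0<1 : 0# < 1#
  0<1 = 0≤1 , 0≉1

  0≤2 : 0# ≤ 2#
  0≤2 = 0≤+ 0≤1 0≤1

  halve : ∀ {x} → 0# ≤ x + x → 0# ≤ x
  halve {x} 0≤2x with O.total 0# x
  ... | inj₁ 0≤x = 0≤x
  ... | inj₂ x≤0 = O.trans 0≤2x (≤-by (0# - x) (0≤y-x x≤0)
    (solve 1 (λ x → x := (x :+ x) :+ (con (+ 0) :- x)) refl x))

  <-≤-trans : ∀ {x y z} → x < y → y ≤ z → x < z
  <-≤-trans (x≤y , x≉y) y≤z = O.trans x≤y y≤z ,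
    λ x≈z → x≉y (O.antisym x≤y (O.trans y≤z (O.reflexive (sym x≈z))))

  ≤-<-trans : ∀ {x y z} → x ≤ y → y < z → x < z
  ≤-<-trans x≤y (y≤z , y≉z) = O.trans x≤y y≤z ,
    λ x≈z → y≉z (O.antisym y≤z (O.trans (O.reflexive (sym x≈z)) x≤y))

  0<⇒≉0 : ∀ {x} → 0# < x → ¬ (x ≈ 0#)
  0<⇒≉0 (_ , 0≉x) x≈0 = 0≉x (sym x≈0)

  0<+1 : ∀ {x} → 0# ≤ x → 0# < x + 1#
  0<+1 {x} 0≤x = <-≤-trans 0<1 (≤-by x 0≤x (+-comm x 1#))

  *-inverseˡ : ∀ x → ¬ (x ≈ 0#) → x ⁻¹ * x ≈ 1#
  *-inverseˡ x x≉0 = trans (*-comm _ _) (*-inverseʳ x x≉0)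

  *-cancelˡ-≈ : ∀ {x y} z → ¬ (z ≈ 0#) → z * x ≈ z * y → x ≈ y
  *-cancelˡ-≈ {x} {y} z z≉0 zx≈zy = begin
    x              ≈⟨ *-identityˡ x ⟨
    1# * x         ≈⟨ *-congʳ (*-inverseˡ z z≉0) ⟨
    z ⁻¹ * z * x   ≈⟨ *-assoc _ _ _ ⟩
    z ⁻¹ * (z * x) ≈⟨ *-congˡ zx≈zy ⟩
    z ⁻¹ * (z * y) ≈⟨ *-assoc _ _ _ ⟨
    z ⁻¹ * z * y   ≈⟨ *-congʳ (*-inverseˡ z z≉0) ⟩
    1# * y         ≈⟨ *-identityˡ y ⟩
    y              ∎

  0≤⁻¹ : ∀ {x} → 0# < x → 0# ≤ x ⁻¹
  0≤⁻¹ {x} (0≤x , 0≉x) with O.total 0# (x ⁻¹)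
  ... | inj₁ 0≤x⁻¹ = 0≤x⁻¹
  ... | inj₂ x⁻¹≤0 = ⊥-elim (0≉1 (O.antisym 0≤1
    (O.trans (O.reflexive (sym (*-inverseʳ x (λ x≈0 → 0≉x (sym x≈0)))))
    (O.trans (*-monoˡ-≤ x 0≤x x⁻¹≤0) (O.reflexive (zeroʳ x))))))

  0<⁻¹ : ∀ {x} → 0# < x → 0# < x ⁻¹
  0<⁻¹ {x} 0<x = 0≤⁻¹ 0<x , λ 0≈x⁻¹ → 0≉1 (trans (sym (zeroʳ x))
    (trans (*-congˡ 0≈x⁻¹) (*-inverseʳ x (0<⇒≉0 0<x))))

  0<* : ∀ {x y} → 0# < x → 0# < y → 0# < x * y
  0<* {x} {y} 0<x 0<y = *-nonNeg (proj₁ 0<x) (proj₁ 0<y) ,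
    λ 0≈xy → proj₂ 0<y (*-cancelˡ-≈ x (0<⇒≉0 0<x) (trans (zeroʳ x) 0≈xy))

  *-cancelˡ-≤ : ∀ {x y} z → 0# < z → z * x ≤ z * y → x ≤ y
  *-cancelˡ-≤ {x} {y} z 0<z zx≤zy with O.total x y
  ... | inj₁ x≤y = x≤y
  ... | inj₂ y≤x = O.reflexive (*-cancelˡ-≈ z (0<⇒≉0 0<z)
    (O.antisym zx≤zy (*-monoˡ-≤ z (proj₁ 0<z) y≤x)))

  scaleBelow : ∀ {K t} → 0# ≤ K → 0# < t → ∃[ η ] 0# < η × K * η ≤ t
  scaleBelow {K} {t} 0≤K 0<t = η , 0<η , ≤-by η (proj₁ 0<η) (sym eq)
    where
    -- Dividing by K + 1 instead of K covers K ≈ 0 without a case split; t exceeds K η by exactly η.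
    η = (K + 1#) ⁻¹ * t
    0<η : 0# < η
    0<η = 0<* (0<⁻¹ (0<+1 0≤K)) 0<t
    eq : K * η + η ≈ t
    eq = begin
      K * η + η                     ≈⟨ solve 2 (λ K η → K :* η :+ η := (K :+ con (+ 1)) :* η) refl K η ⟩
      (K + 1#) * ((K + 1#) ⁻¹ * t)  ≈⟨ *-assoc _ _ _ ⟨
      (K + 1#) * (K + 1#) ⁻¹ * t    ≈⟨ *-congʳ (*-inverseʳ _ (0<⇒≉0 (0<+1 0≤K))) ⟩
      1# * t                        ≈⟨ *-identityˡ t ⟩
      t                             ∎

  -- x ≼ c says that ∣ x ∣ ≤ c.
  infix 4 _≼_
  _≼_ : ℝ → ℝ → Set
  x ≼ c = 0# ≤ c - x × 0# ≤ c + x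

  ≼⇒0≤ : ∀ {x c} → x ≼ c → 0# ≤ c
  ≼⇒0≤ {x} {c} (p , q) = halve (0≤-resp (0≤+ p q)
    (solve 2 (λ x c → c :+ c := (c :- x) :+ (c :+ x)) refl x c))

  ≼⇒≤ : ∀ {x c} → x ≼ c → x ≤ c
  ≼⇒≤ {x} {c} (p , _) = ≤-by (c - x) p (solve 2 (λ x c → c := x :+ (c :- x)) refl x c)

  ≼⇒≥ : ∀ {x c} → x ≼ c → - c ≤ x
  ≼⇒≥ {x} {c} (_ , q) = ≤-by (c + x) q (solve 2 (λ x c → x := (:- c) :+ (c :+ x)) refl x c)

  ≼-refl : ∀ {x} → 0# ≤ x → x ≼ x
  ≼-refl {x} 0≤x = O.reflexive (sym (-‿inverseʳ x)) , 0≤+ 0≤x 0≤x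

  ≼-resp : ∀ {x y c d} → x ≼ c → y ≈ x → d ≈ c → y ≼ d
  ≼-resp (p , q) y≈x d≈c = 0≤-resp p (+-cong d≈c (-‿cong y≈x)) , 0≤-resp q (+-cong d≈c y≈x)

  ≼-weaken : ∀ {x c d} → x ≼ c → c ≤ d → x ≼ d
  ≼-weaken {x} {c} {d} (p , q) c≤d =
    0≤-resp (0≤+ (0≤y-x c≤d) p) (solve 3 (λ x c d → d :- x := (d :- c) :+ (c :- x)) refl x c d) ,
    0≤-resp (0≤+ (0≤y-x c≤d) q) (solve 3 (λ x c d → d :+ x := (d :- c) :+ (c :+ x)) refl x c d)

  ≼-neg : ∀ {x c} → x ≼ c → - x ≼ c
  ≼-neg {x} {c} (p , q) = 0≤-resp q (+-congˡ (-‿involutive x)) , p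

  ≼-+ : ∀ {x y a b} → x ≼ a → y ≼ b → x + y ≼ a + b
  ≼-+ {x} {y} {a} {b} (p , q) (r , s) =
    0≤-resp (0≤+ p r) (solve 4 (λ x y a b → (a :+ b) :- (x :+ y) := (a :- x) :+ (b :- y)) refl x y a b) ,
    0≤-resp (0≤+ q s) (solve 4 (λ x y a b → (a :+ b) :+ (x :+ y) := (a :+ x) :+ (b :+ y)) refl x y a b)

  -- Twice a b - x y and twice a b + x y are sums of two products of the nonnegative numbers a - x,
  -- a + x, b - y, b + y, so no case split on signs is made.
  ≼-* : ∀ {x y a b} → x ≼ a → y ≼ b → x * y ≼ a * b
  ≼-* {x} {y} {a} {b} (p , q) (r , s) =
    halve (0≤-resp (0≤+ (*-nonNeg p s) (*-nonNeg q r))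
      (solve 4 (λ x y a b → (a :* b :- x :* y) :+ (a :* b :- x :* y)
                         := (a :- x) :* (b :+ y) :+ (a :+ x) :* (b :- y)) refl x y a b)) ,
    halve (0≤-resp (0≤+ (*-nonNeg p r) (*-nonNeg q s))
      (solve 4 (λ x y a b → (a :* b :+ x :* y) :+ (a :* b :+ x :* y)
                         := (a :- x) :* (b :- y) :+ (a :+ x) :* (b :+ y)) refl x y a b))

  ≼-sum : ∀ {n} {x a : Vector ℝ n} → (∀ i → x i ≼ a i) → sum x ≼ sum a
  ≼-sum {zero}  x≼a = ≼-refl O.refl
  ≼-sum {suc n} x≼a = ≼-+ (x≼a zero) (≼-sum (λ i → x≼a (suc i)))

  -- Totality compares only weakly; excluded middle decides `y ≈ x` and thereby makes the second
  -- alternative strict.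
  ≤-or-> : ∀ x y → x ≤ y ⊎ y < x
  ≤-or-> x y with O.total x y | em {y ≈ x}
  ... | inj₁ x≤y | _       = inj₁ x≤y
  ... | inj₂ _   | yes y≈x = inj₁ (O.reflexive (sym y≈x))
  ... | inj₂ y≤x | no y≉x  = inj₂ (y≤x , y≉x)

  <⇒≱ : ∀ {x y} → x < y → ¬ (y ≤ x)
  <⇒≱ (x≤y , x≉y) y≤x = x≉y (O.antisym x≤y y≤x)

  ²-cancel-≤ : ∀ {x c} → 0# ≤ c → x * x ≤ c * c → x ≤ c
  ²-cancel-≤ {x} {c} 0≤c xx≤cc with ≤-or-> x c
  ... | inj₁ x≤c = x≤c
  ... | inj₂ c<x = ⊥-elim (<⇒≱ cc<xx xx≤cc)
    where
    0<x : 0# < x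
    0<x = ≤-<-trans 0≤c c<x
    cc<xx : c * c < x * x
    cc<xx = ≤-<-trans (*-monoˡ-≤ c 0≤c (proj₁ c<x))
      (O.trans (O.reflexive (*-comm c x)) (*-monoˡ-≤ x (proj₁ 0<x) (proj₁ c<x)) ,
       λ cx≈xx → proj₂ c<x (*-cancelˡ-≈ x (0<⇒≉0 0<x) (trans (*-comm x c) cx≈xx)))

  ≼-² : ∀ {x c} → 0# ≤ c → x * x ≤ c * c → x ≼ c
  ≼-² {x} {c} 0≤c xx≤cc =
    0≤y-x (²-cancel-≤ 0≤c xx≤cc) ,
    0≤-resp (0≤y-x (²-cancel-≤ 0≤c -x-x≤cc)) (+-congˡ (sym (-‿involutive x)))
    where
    -x-x≤cc : - x * - x ≤ c * c
    -x-x≤cc = O.trans (O.reflexive (solve 1 (λ x → (:- x) :* (:- x) := x :* x) refl x)) xx≤cc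

  ≼-∣_∣ : ∀ x → ∃[ a ] x ≼ a × a * a ≈ x * x
  ≼-∣ x ∣ with O.total 0# x
  ... | inj₁ 0≤x = x , ≼-refl 0≤x , refl
  ... | inj₂ x≤0 = - x , ≼-resp (≼-neg (≼-refl 0≤-x)) (sym (-‿involutive x)) refl ,
    solve 1 (λ x → (:- x) :* (:- x) := x :* x) refl x
    where
    0≤-x : 0# ≤ - x
    0≤-x = 0≤-resp (0≤y-x x≤0) (sym (+-identityˡ _))

  -- Finite sums of real numbers

  sum-0 : ∀ {n} {x : Vector ℝ n} → (∀ i → x i ≈ 0#) → sum x ≈ 0#
  sum-0 {n} x≈0 = trans (sum-cong-≋ x≈0) (sum-replicate-zero n)

  sum-nonNeg : ∀ {n} {x : Vector ℝ n} → (∀ i → 0# ≤ x i) → 0# ≤ sum x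
  sum-nonNeg {zero}  0≤x = O.refl
  sum-nonNeg {suc n} 0≤x = 0≤+ (0≤x zero) (sum-nonNeg (λ i → 0≤x (suc i)))

  term≤sum : ∀ {n} {x : Vector ℝ n} → (∀ i → 0# ≤ x i) → ∀ i → x i ≤ sum x
  term≤sum 0≤x zero    = ≤-by _ (sum-nonNeg (λ i → 0≤x (suc i))) refl
  term≤sum 0≤x (suc i) = O.trans (term≤sum (λ i → 0≤x (suc i)) i) (≤-by _ (0≤x zero) (+-comm _ _))

  sum-const : ∀ n x → sum {n} (λ _ → x) ≈ fromℕ n * x
  sum-const zero    x = sym (zeroˡ x)
  sum-const (suc n) x = begin
    x + sum {n} (λ _ → x) ≈⟨ +-congˡ (sum-const n x) ⟩
    x + fromℕ n * x       ≈⟨ +-congʳ (*-identityˡ x) ⟨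
    1# * x + fromℕ n * x  ≈⟨ distribʳ x 1# (fromℕ n) ⟨
    (1# + fromℕ n) * x    ∎

  0≤fromℕ : ∀ n → 0# ≤ fromℕ n
  0≤fromℕ zero    = O.refl
  0≤fromℕ (suc n) = 0≤+ 0≤1 (0≤fromℕ n)

  0<fromℕ : ∀ n → 0# < fromℕ (suc n)
  0<fromℕ n = <-≤-trans 0<1 (≤-by _ (0≤fromℕ n) refl)

  -- Matrices

  I : ∀ {n} → Matrix n
  I zero    zero    = 1#
  I zero    (suc j) = 0#
  I (suc i) zero    = 0#
  I (suc i) (suc j) = I i j

  infixl 7 _⊡_
  -- The matrix product in the row convention: a basis is a matrix of rows, and a change of basis
  -- multiplies it from the left.
  _⊡_ : ∀ {n} → Matrix n → Matrix n → Matrix n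
  (A ⊡ B) i = combination (A i) B

  _ᵀ : ∀ {n} → Matrix n → Matrix n
  (A ᵀ) i j = A j i

  sum-Iˡ : ∀ {n} (i : Fin n) (x : ℝ^ n) → sum (λ j → I i j * x j) ≈ x i
  sum-Iˡ {suc n} zero    x = trans (+-cong (*-identityˡ _) (sum-0 {n} (λ j → zeroˡ _))) (+-identityʳ _)
  sum-Iˡ (suc i) x = trans (+-cong (zeroˡ _) (sum-Iˡ i (λ j → x (suc j)))) (+-identityˡ _)

  I-sym : ∀ {n} (i j : Fin n) → I i j ≡ I j i
  I-sym zero    zero    = ≡.refl
  I-sym zero    (suc j) = ≡.refl
  I-sym (suc i) zero    = ≡.refl
  I-sym (suc i) (suc j) = I-sym i j

  sum-Iʳ : ∀ {n} (i : Fin n) (x : ℝ^ n) → sum (λ j → x j * I j i) ≈ x i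
  sum-Iʳ {n} i x = trans (sum-cong-≋ {n} (λ j → trans (*-comm _ _) (*-congʳ (reflexive (I-sym j i))))) (sum-Iˡ i x)

  ⟨⟩-cong : ∀ {n} {x x′ y y′ : ℝ^ n} → x ≋ x′ → y ≋ y′ → ⟨ x , y ⟩ ≈ ⟨ x′ , y′ ⟩
  ⟨⟩-cong {n} x≋x′ y≋y′ = sum-cong-≋ {n} (λ i → *-cong (x≋x′ i) (y≋y′ i))

  ⟨⟩-comm : ∀ {n} (x y : ℝ^ n) → ⟨ x , y ⟩ ≈ ⟨ y , x ⟩
  ⟨⟩-comm {n} x y = sum-cong-≋ {n} (λ i → *-comm _ _)

  ⟨combination,⟩ : ∀ {m n} (c : Vector ℝ m) (b : Fin m → ℝ^ n) x →
                   ⟨ combination c b , x ⟩ ≈ sum (λ i → c i * ⟨ b i , x ⟩)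
  ⟨combination,⟩ {m} {n} c b x = begin
    sum (λ j → sum (λ i → c i * b i j) * x j)     ≈⟨ sum-cong-≋ {n} (λ j → *-distribʳ-sum {m} (x j) _) ⟩
    sum (λ j → sum (λ i → c i * b i j * x j))     ≈⟨ ∑-comm (λ j i → c i * b i j * x j) ⟩
    sum (λ i → sum (λ j → c i * b i j * x j))     ≈⟨ sum-cong-≋ {m} (λ i → sum-cong-≋ {n} (λ j → *-assoc _ _ _)) ⟩
    sum (λ i → sum (λ j → c i * (b i j * x j)))   ≈⟨ sum-cong-≋ {m} (λ i → *-distribˡ-sum {n} (c i) _) ⟨
    sum (λ i → c i * ⟨ b i , x ⟩)                 ∎

  ⟨,combination⟩ : ∀ {m n} (c : Vector ℝ m) (b : Fin m → ℝ^ n) x →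
                   ⟨ x , combination c b ⟩ ≈ sum (λ i → c i * ⟨ x , b i ⟩)
  ⟨,combination⟩ {m} c b x = trans (⟨⟩-comm x _)
    (trans (⟨combination,⟩ c b x) (sum-cong-≋ {m} (λ i → *-congˡ (⟨⟩-comm (b i) x))))

  -- Associativity of the matrix product, for a single row c.
  combination-combination : ∀ {l m n} (c : Vector ℝ l) (d : Fin l → Vector ℝ m) (b : Fin m → ℝ^ n) →
    combination c (λ i → combination (d i) b) ≋ combination (combination c d) b
  combination-combination c d b j = sym (⟨combination,⟩ c d (λ i → b i j))

  -- Determinants

  det-cong : ∀ {n} {A B : Matrix n} → (∀ i → A i ≋ B i) → det A ≈ det B
  det-cong {zero}  A≋B = refl
  det-cong {suc n} A≋B = sum-cong-≋ {suc n} (λ j → *-congˡ {x = (- 1#) ^ toℕ j} (*-cong (A≋B zero j)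
    (det-cong (λ i k → A≋B (suc i) (punchIn j k)))))

  det-I : ∀ n → det (I {n}) ≈ 1#
  det-I zero    = refl
  det-I (suc n) = begin
    1# * (1# * det (I {n})) + sum {n} (λ j → _) ≈⟨ +-cong
      (trans (*-identityˡ _) (trans (*-identityˡ _) (det-I n)))
      (sum-0 {n} (λ j → trans (*-congˡ (zeroˡ _)) (zeroʳ _))) ⟩
    1# + 0#                                     ≈⟨ +-identityʳ 1# ⟩
    1#                                          ∎

  det-scale : ∀ {n} c (A : Matrix n) → det (λ i → c • A i) ≈ c ^ n * det A
  det-scale {zero}  c A = sym (*-identityˡ 1#)
  det-scale {suc n} c A = begin
    sum (λ j → s j * (c * a j * det (λ i → c • M j i)))
      ≈⟨ sum-cong-≋ {suc n} (λ j → *-congˡ {x = s j} (*-congˡ {x = c * a j} (det-scale c (M j)))) ⟩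
    sum (λ j → s j * (c * a j * (c ^ n * det (M j))))
      ≈⟨ sum-cong-≋ {suc n} (λ j → solve 5 (λ s c a p d → s :* (c :* a :* (p :* d)) := c :* p :* (s :* (a :* d)))
           refl (s j) c (a j) (c ^ n) (det (M j))) ⟩
    sum (λ j → c * c ^ n * (s j * (a j * det (M j))))
      ≈⟨ *-distribˡ-sum {suc n} (c * c ^ n) (λ j → s j * (a j * det (M j))) ⟨
    c * c ^ n * det A ∎
    where
    s : Fin (suc n) → ℝ
    s j = (- 1#) ^ toℕ j
    a : Fin (suc n) → ℝ
    a = A zero
    M : Fin (suc n) → Matrix n
    M j i k = A (suc i) (punchIn j k)

  -- Alternating forms and multiplicativity of the determinant

  module Forms (m : ℕ) where

    Form : ℕ → Set
    Form n = (Fin n → ℝ^ m) → ℝ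

    -- Compatibility with all finite combinations contains additivity, homogeneity and the value at
    -- zero, and is the shape in which an argument gets expanded.
    Linear : (ℝ^ m → ℝ) → Set
    Linear f = ∀ {k} (c : Vector ℝ k) (v : Fin k → ℝ^ m) → f (combination c v) ≈ sum (λ i → c i * f (v i))

    -- Families of vectors are functions, and pointwise equality does not identify them, so forms
    -- have to carry this compatibility.
    Congruent : ∀ {n} → Form n → Set
    Congruent F = ∀ {v w} → (∀ i → v i ≋ w i) → F v ≈ F w

    Antisymmetric : ∀ n → Form (suc n) → Set
    Antisymmetric zero    F = ⊤
    Antisymmetric (suc n) F = ∀ v w r → F (v ∷ (w ∷ r)) ≈ - F (w ∷ (v ∷ r))

    -- Only the exchange of the first two arguments is listed; the recursion on the remaining
    -- arguments supplies every adjacent exchange, and likewise linearity in every slot.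
    Alternating : ∀ n → Form n → Set
    Alternating zero    F = ⊤
    Alternating (suc n) F =
      (∀ r → Linear (λ v → F (v ∷ r))) ×
      (∀ v → Alternating n (λ r → F (v ∷ r))) ×
      Antisymmetric n F

    congruent-∷ : ∀ {n} {F : Form (suc n)} → Congruent F → ∀ v → Congruent (λ r → F (v ∷ r))
    congruent-∷ cong v v≋w = cong λ where
      zero    j → refl
      (suc i) j → v≋w i j

    η-∷ : ∀ {n} {F : Form (suc n)} → Congruent F → ∀ v → F v ≈ F (v zero ∷ λ i → v (suc i))
    η-∷ cong v = cong λ where
      zero    j → refl
      (suc i) j → refl

    linear-resp : ∀ {f g : ℝ^ m → ℝ} → (∀ v → g v ≈ f v) → Linear f → Linear g
    linear-resp g≈f f-linear {k} c v = trans (g≈f _)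
      (trans (f-linear c v) (sum-cong-≋ {k} (λ i → *-congˡ (sym (g≈f (v i))))))

    linear-scale : ∀ (f : ℝ^ m → ℝ) a → Linear f → Linear (λ v → a * f v)
    linear-scale f a f-linear {k} c v = begin
      a * f (combination c v)            ≈⟨ *-congˡ (f-linear c v) ⟩
      a * sum (λ i → c i * f (v i))      ≈⟨ *-distribˡ-sum {k} a _ ⟩
      sum (λ i → a * (c i * f (v i)))    ≈⟨ sum-cong-≋ {k} (λ i → solve 3 (λ a c f → a :* (c :* f) := c :* (a :* f)) refl a (c i) (f (v i))) ⟩
      sum (λ i → c i * (a * f (v i)))    ∎

    linear-+ : ∀ (f g : ℝ^ m → ℝ) → Linear f → Linear g → Linear (λ v → f v + g v)
    linear-+ f g f-linear g-linear {k} c v = begin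
      f (combination c v) + g (combination c v)                ≈⟨ +-cong (f-linear c v) (g-linear c v) ⟩
      sum (λ i → c i * f (v i)) + sum (λ i → c i * g (v i))    ≈⟨ ∑-distrib-+ (λ i → c i * f (v i)) (λ i → c i * g (v i)) ⟨
      sum (λ i → c i * f (v i) + c i * g (v i))                ≈⟨ sum-cong-≋ {k} (λ i → distribˡ (c i) _ _) ⟨
      sum (λ i → c i * (f (v i) + g (v i)))                    ∎

    linear-combine : ∀ a b (f g : ℝ^ m → ℝ) → Linear f → Linear g → Linear (λ v → a * f v + b * g v)
    linear-combine a b f g f-linear g-linear = linear-+ (λ v → a * f v) (λ v → b * g v)
      (linear-scale f a f-linear) (linear-scale g b g-linear)

    linear-0 : Linear (λ _ → 0#)
    linear-0 {k} c v = sym (sum-0 {k} (λ i → zeroʳ (c i)))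

    linear-sum : ∀ {k} (f : Fin k → ℝ^ m → ℝ) → (∀ i → Linear (f i)) → Linear (λ v → sum (λ i → f i v))
    linear-sum {zero}  f _        = linear-0
    linear-sum {suc k} f f-linear = linear-+ (f zero) (λ v → sum (λ i → f (suc i) v))
      (f-linear zero) (linear-sum (λ i → f (suc i)) (λ i → f-linear (suc i)))

    alternating-resp : ∀ {n} {F G : Form n} → (∀ v → G v ≈ F v) → Alternating n F → Alternating n G
    alternating-resp {zero}        G≈F _ = tt
    alternating-resp {suc zero}    G≈F (l , a , _) =
      (λ r → linear-resp (λ v → G≈F (v ∷ r)) (l r)) , (λ v → tt) , tt
    alternating-resp {suc (suc n)} G≈F (l , a , s) =
      (λ r → linear-resp (λ v → G≈F (v ∷ r)) (l r)) ,
      (λ v → alternating-resp (λ r → G≈F (v ∷ r)) (a v)) ,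
      (λ v w r → trans (G≈F _) (trans (s v w r) (-‿cong (sym (G≈F _)))))

    alternating-linear : ∀ {n} {F G : Form n} a b → Alternating n F → Alternating n G →
                         Alternating n (λ v → a * F v + b * G v)
    alternating-linear {zero} a b _ _ = tt
    alternating-linear {suc zero} {F} {G} a b (l , _) (l′ , _) =
      (λ r → linear-combine a b (λ v → F (v ∷ r)) (λ v → G (v ∷ r)) (l r) (l′ r)) , (λ v → tt) , tt
    alternating-linear {suc (suc n)} {F} {G} a b (l , c , s) (l′ , c′ , s′) =
      (λ r → linear-combine a b (λ v → F (v ∷ r)) (λ v → G (v ∷ r)) (l r) (l′ r)) ,
      (λ v → alternating-linear {F = λ r → F (v ∷ r)} {G = λ r → G (v ∷ r)} a b (c v) (c′ v)) ,
      (λ v w r → trans (+-cong (*-congˡ (s v w r)) (*-congˡ (s′ v w r)))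
        (solve 4 (λ a b x y → a :* (:- x) :+ b :* (:- y) := :- (a :* x :+ b :* y)) refl a b
          (F (w ∷ (v ∷ r))) (G (w ∷ (v ∷ r)))))

    -- The exterior product of a functional with a form. The cofactor expansion along the first row
    -- is literally of this shape, with φ the first row and G the determinant of the other rows.
    wedge : ∀ {n} → (ℝ^ m → ℝ) → Form n → Form (suc n)
    wedge φ G v = sum λ j → (- 1#) ^ toℕ j * (φ (v j) * G (λ k → v (punchIn j k)))

    -- The term j = 0 splits off; in the others v stays in front and the sign exponent is larger by
    -- one, whence the factor -1.
    wedge-∷ : ∀ {n} φ {G : Form (suc n)} → Congruent G → ∀ v r →
              wedge φ G (v ∷ r) ≈ φ v * G r + - 1# * wedge φ (λ s → G (v ∷ s)) r
    wedge-∷ {n} φ {G} cong v r = +-cong (*-identityˡ _) (begin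
      sum (λ j → - 1# * s j * (φ (r j) * G (λ k → (v ∷ r) (punchIn (suc j) k))))
        ≈⟨ sum-cong-≋ {suc n} (λ j → trans (*-assoc (- 1#) (s j) _)
             (*-congˡ {x = - 1#} (*-congˡ {x = s j} (*-congˡ {x = φ (r j)} (η-∷ {F = G} cong (λ k → (v ∷ r) (punchIn (suc j) k))))))) ⟩
      sum (λ j → - 1# * (s j * (φ (r j) * G (v ∷ λ k → r (punchIn j k)))))
        ≈⟨ *-distribˡ-sum (- 1#) (λ j → s j * (φ (r j) * G (v ∷ λ k → r (punchIn j k)))) ⟨
      - 1# * wedge φ (λ s → G (v ∷ s)) r ∎)
      where
      s : Fin (suc n) → ℝ
      s j = (- 1#) ^ toℕ j

    wedge-₁ : ∀ φ (G : Form 0) → Congruent G → ∀ v r s → wedge φ G (v ∷ r) ≈ φ v * G s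
    wedge-₁ φ G cong v r s = trans (+-identityʳ _) (trans (*-identityˡ _) (*-congˡ (cong λ ())))

    wedge-neg : ∀ {n} φ {F G : Form n} → (∀ v → F v ≈ - G v) → ∀ v → wedge φ F v ≈ - wedge φ G v
    wedge-neg {n} φ {F} {G} F≈-G v = begin
      sum (λ j → s j * (φ (v j) * F (v′ j)))       ≈⟨ sum-cong-≋ {suc n} (λ j → trans (*-congˡ {x = s j} (*-congˡ {x = φ (v j)} (F≈-G (v′ j))))
          (solve 3 (λ s f g → s :* (f :* (:- g)) := (:- con (+ 1)) :* (s :* (f :* g))) refl (s j) (φ (v j)) (G (v′ j)))) ⟩
      sum (λ j → - 1# * (s j * (φ (v j) * G (v′ j)))) ≈⟨ *-distribˡ-sum (- 1#) (λ j → s j * (φ (v j) * G (v′ j))) ⟨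
      - 1# * wedge φ G v                           ≈⟨ solve 1 (λ x → (:- con (+ 1)) :* x := :- x) refl (wedge φ G v) ⟩
      - wedge φ G v                                ∎
      where
      s : Fin (suc n) → ℝ
      s j = (- 1#) ^ toℕ j
      v′ : Fin (suc n) → Fin n → ℝ^ m
      v′ j k = v (punchIn j k)

    -- The recursive conditions follow from `wedge-∷` by induction. For the exchange of v and w the
    -- expansion is made twice: the terms with φ v and φ w trade places with opposite signs, and the
    -- remainder, where both stand inside G, changes sign because G does.
    wedge-alternating : ∀ {n} {φ} {G : Form n} → Linear φ → Congruent G → Alternating n G →
                        Alternating (suc n) (wedge φ G)
    wedge-alternating {zero} {φ} {G} φ-linear cong _ =
      (λ r → linear-resp (λ v → trans (wedge-₁ φ G cong v r r) (*-comm (φ v) (G r))) (linear-scale φ (G r) φ-linear)) ,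
      (λ _ → tt) , tt
    wedge-alternating {suc n} {φ} {G} φ-linear cong alt@(l , a , s) =
      (λ r → linear-resp (λ v → trans (wedge-∷ φ {G} cong v r) (+-congʳ (*-comm (φ v) (G r))))
        (linear-combine (G r) (- 1#) φ (λ v → wedge φ (λ s → G (v ∷ s)) r) φ-linear
          (linear-sum (λ j v → (- 1#) ^ toℕ j * (φ (r j) * G (v ∷ λ k → r (punchIn j k)))) (λ j →
            linear-scale (λ v → φ (r j) * G (v ∷ λ k → r (punchIn j k))) ((- 1#) ^ toℕ j)
              (linear-scale (λ v → G (v ∷ λ k → r (punchIn j k))) (φ (r j)) (l (λ k → r (punchIn j k)))))))) ,
      (λ v → alternating-resp (λ r → wedge-∷ φ {G} cong v r)
        (alternating-linear {F = G} {G = wedge φ (λ s → G (v ∷ s))} (φ v) (- 1#) alt (wedge-alternating {G = λ s → G (v ∷ s)} φ-linear (congruent-∷ {F = G} cong v) (a v)))) ,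
      antisymmetric n G cong s
      where
      antisymmetric : ∀ n (G : Form (suc n)) → Congruent G → Antisymmetric n G → Antisymmetric (suc n) (wedge φ G)
      antisymmetric zero G cong _ v w r = begin
        wedge φ G (v ∷ (w ∷ r))               ≈⟨ expand v w ⟩
        φ v * G (w ∷ r) + - 1# * (φ w * G (v ∷ r)) ≈⟨ solve 4 (λ a b c d → a :* b :+ (:- con (+ 1)) :* (c :* d) := :- (c :* d :+ (:- con (+ 1)) :* (a :* b))) refl (φ v) (G (w ∷ r)) (φ w) (G (v ∷ r)) ⟩
        - (φ w * G (v ∷ r) + - 1# * (φ v * G (w ∷ r))) ≈⟨ -‿cong (expand w v) ⟨
        - wedge φ G (w ∷ (v ∷ r))             ∎
        where
        expand : ∀ v w → wedge φ G (v ∷ (w ∷ r)) ≈ φ v * G (w ∷ r) + - 1# * (φ w * G (v ∷ r))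
        expand v w = trans (wedge-∷ φ {G} cong v (w ∷ r))
          (+-congˡ (*-congˡ (wedge-₁ φ (λ s → G (v ∷ s)) (congruent-∷ {F = G} cong v) w r r)))
      antisymmetric (suc n) G cong s v w r = begin
        wedge φ G (v ∷ (w ∷ r))               ≈⟨ expand v w ⟩
        φ v * G (w ∷ r) + - 1# * (φ w * G (v ∷ r) + - 1# * rest v w) ≈⟨ +-congˡ (*-congˡ (+-congˡ (*-congˡ (wedge-neg φ {λ s → G (v ∷ (w ∷ s))} {λ s → G (w ∷ (v ∷ s))} (s v w) r)))) ⟩
        φ v * G (w ∷ r) + - 1# * (φ w * G (v ∷ r) + - 1# * - rest w v) ≈⟨ solve 5 (λ a b c d e → a :* b :+ (:- con (+ 1)) :* (c :* d :+ (:- con (+ 1)) :* (:- e)) := :- (c :* d :+ (:- con (+ 1)) :* (a :* b :+ (:- con (+ 1)) :* e))) refl (φ v) (G (w ∷ r)) (φ w) (G (v ∷ r)) (rest w v) ⟩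
        - (φ w * G (v ∷ r) + - 1# * (φ v * G (w ∷ r) + - 1# * rest w v)) ≈⟨ -‿cong (expand w v) ⟨
        - wedge φ G (w ∷ (v ∷ r))             ∎
        where
        rest : ℝ^ m → ℝ^ m → ℝ
        rest v w = wedge φ (λ s → G (v ∷ (w ∷ s))) r
        expand : ∀ v w → wedge φ G (v ∷ (w ∷ r)) ≈ φ v * G (w ∷ r) + - 1# * (φ w * G (v ∷ r) + - 1# * rest v w)
        expand v w = trans (wedge-∷ φ {G} cong v (w ∷ r))
          (+-congˡ (*-congˡ (wedge-∷ φ {λ s → G (v ∷ s)} (congruent-∷ {F = G} cong v) w r)))

    det-alternating : ∀ n {φ : Fin n → ℝ^ m → ℝ} → (∀ i {v w} → v ≋ w → φ i v ≈ φ i w) →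
                      (∀ i → Linear (φ i)) → Alternating n (λ w → det (λ i k → φ i (w k)))
    det-alternating zero    _      _        = tt
    det-alternating (suc n) φ-cong φ-linear = wedge-alternating (φ-linear zero)
      (λ v≋w → det-cong (λ i k → φ-cong (suc i) (v≋w k)))
      (det-alternating n (λ i → φ-cong (suc i)) (λ i → φ-linear (suc i)))

    -- Vanishing as soon as u stands in any slot, arranged along the same recursion as
    -- `Alternating`.
    Kills : ∀ n → ℝ^ m → Form n → Set
    Kills zero    u G = ⊤
    Kills (suc n) u G = (∀ r → G (u ∷ r) ≈ 0#) × (∀ v → Kills n u (λ r → G (v ∷ r)))

    kills-neg : ∀ {n} {u} {F G : Form n} → (∀ v → F v ≈ - G v) → Kills n u G → Kills n u F
    kills-neg {zero}  _    _         = tt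
    kills-neg {suc n} F≈-G (k₀ , k₁) =
      (λ r → trans (F≈-G _) (trans (-‿cong (k₀ r)) -0#≈0#)) , (λ v → kills-neg (λ r → F≈-G _) (k₁ v))

    x≈-x⇒x≈0 : ∀ {x} → x ≈ - x → x ≈ 0#
    x≈-x⇒x≈0 {x} x≈-x = *-cancelˡ-≈ 2# (0<⇒≉0 (<-≤-trans 0<1 (≤-by 1# 0≤1 refl))) (begin
      2# * x ≈⟨ solve 1 (λ x → (con (+ 1) :+ con (+ 1)) :* x := x :+ x) refl x ⟩
      x + x  ≈⟨ +-congˡ x≈-x ⟩
      x - x  ≈⟨ -‿inverseʳ x ⟩
      0#     ≈⟨ zeroʳ 2# ⟨
      2# * 0# ∎)

    -- A value with u in both front slots equals its own negative, and 2 is invertible. Deeper slots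
    -- reduce to this by exchanging u with the vector behind it.
    alternating-kills : ∀ {n} {F : Form (suc n)} → Alternating (suc n) F → ∀ u → Kills n u (λ r → F (u ∷ r))
    alternating-kills {zero}      _           u = tt
    alternating-kills {suc n} {F} (l , a , s) u =
      (λ r → x≈-x⇒x≈0 (s u u r)) ,
      (λ v → kills-neg (λ r → s u v r) (alternating-kills {F = λ r → F (v ∷ r)} (a v) u))

    -- Expanding one slot at a time, the summand with `v j` vanishes, so the j-th column of the
    -- coefficients can be deleted. This is how minors arise in the cofactor expansion.
    kills-remove : ∀ {n k} {G : Form n} → Congruent G → Alternating n G →
      ∀ (v : Fin (suc k) → ℝ^ m) j → Kills n (v j) G → ∀ (C : Fin n → Vector ℝ (suc k)) →
      G (λ i → combination (C i) v) ≈ G (λ i → combination (λ l → C i (punchIn j l)) (λ l → v (punchIn j l)))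
    kills-remove {zero}        cong _           v j _         C = cong λ ()
    kills-remove {suc n} {k} {G} cong (l , a , s) v j (k₀ , k₁) C = begin
      G (λ i → combination (C i) v)          ≈⟨ η-∷ {F = G} cong _ ⟩
      G (combination (C zero) v ∷ r)         ≈⟨ l r (C zero) v ⟩
      sum (λ i → C zero i * G (v i ∷ r))     ≈⟨ sum-remove {i = j} (λ i → C zero i * G (v i ∷ r)) ⟩
      C zero j * G (v j ∷ r) + sum (λ i → C zero (punchIn j i) * G (v (punchIn j i) ∷ r))
                                             ≈⟨ +-congʳ (trans (*-congˡ (k₀ r)) (zeroʳ _)) ⟩
      0# + sum (λ i → C zero (punchIn j i) * G (v (punchIn j i) ∷ r)) ≈⟨ +-identityˡ _ ⟩
      sum (λ i → C zero (punchIn j i) * G (v (punchIn j i) ∷ r)) ≈⟨ l r (λ i → C zero (punchIn j i)) (λ i → v (punchIn j i)) ⟨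
      G (u ∷ r)                              ≈⟨ kills-remove {G = λ r → G (u ∷ r)} (congruent-∷ {F = G} cong u) (a u) v j (k₁ u) (λ i → C (suc i)) ⟩
      G (u ∷ r′)                             ≈⟨ η-∷ {F = G} cong _ ⟨
      G (λ i → combination (λ l → C i (punchIn j l)) (λ l → v (punchIn j l))) ∎
      where
      r r′ : Fin n → ℝ^ m
      r i  = combination (C (suc i)) v
      r′ i = combination (λ l → C (suc i) (punchIn j l)) (λ l → v (punchIn j l))
      u : ℝ^ m
      u = combination (λ l → C zero (punchIn j l)) (λ l → v (punchIn j l))

    -- The vector `v j` passes the j vectors before it, at the cost of one sign each.
    move-to-front : ∀ {n} {F : Form (suc n)} → Congruent F → Alternating (suc n) F → ∀ v j →
                    F (v j ∷ λ k → v (punchIn j k)) ≈ (- 1#) ^ toℕ j * F v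
    move-to-front {F = F} cong _ v zero = trans (sym (η-∷ {F = F} cong v)) (sym (*-identityˡ _))
    move-to-front {suc n} {F} cong (l , a , s) v (suc j) = begin
      F (v (suc j) ∷ λ k → v (punchIn (suc j) k))          ≈⟨ congruent-∷ {F = F} cong (v (suc j)) (λ { zero _ → refl ; (suc i) _ → refl }) ⟩
      F (v (suc j) ∷ (v zero ∷ λ k → v (suc (punchIn j k)))) ≈⟨ s _ _ _ ⟩
      - F (v zero ∷ (v (suc j) ∷ λ k → v (suc (punchIn j k)))) ≈⟨ -‿cong (move-to-front {F = λ r → F (v zero ∷ r)} (congruent-∷ {F = F} cong (v zero)) (a (v zero)) (λ k → v (suc k)) j) ⟩
      - ((- 1#) ^ toℕ j * F (v zero ∷ λ k → v (suc k)))    ≈⟨ -‿cong (*-congˡ (η-∷ {F = F} cong v)) ⟨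
      - ((- 1#) ^ toℕ j * F v)                             ≈⟨ solve 2 (λ p x → :- (p :* x) := (:- con (+ 1)) :* p :* x) refl ((- 1#) ^ toℕ j) (F v) ⟩
      - 1# * (- 1#) ^ toℕ j * F v                          ∎

    -- Uniqueness of the determinant as an alternating form. Expand the first argument; once `v j`
    -- stands in front, the other arguments may be reduced to the vectors different from it, where
    -- induction yields the minor, and returning `v j` to its place yields the cofactor sign.
    alternating-det : ∀ {n} {F : Form n} → Congruent F → Alternating n F → ∀ (C : Matrix n) v →
                      F (λ i → combination (C i) v) ≈ det C * F v
    alternating-det {zero}      cong _             C v = trans (cong λ ()) (sym (*-identityˡ _))
    alternating-det {suc n} {F} cong alt@(l , a , s) C v = begin
      F (λ i → combination (C i) v)                        ≈⟨ η-∷ {F = F} cong _ ⟩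
      F (combination (C zero) v ∷ r)                       ≈⟨ l r (C zero) v ⟩
      sum (λ j → C zero j * F (v j ∷ r))                   ≈⟨ sum-cong-≋ {suc n} (λ j → *-congˡ {x = C zero j} (step j)) ⟩
      sum (λ j → C zero j * (det (M j) * (sign j * F v)))  ≈⟨ sum-cong-≋ {suc n} (λ j → solve 4 (λ c d s f → c :* (d :* (s :* f)) := s :* (c :* d) :* f) refl (C zero j) (det (M j)) (sign j) (F v)) ⟩
      sum (λ j → sign j * (C zero j * det (M j)) * F v)    ≈⟨ *-distribʳ-sum (F v) (λ j → sign j * (C zero j * det (M j))) ⟨
      det C * F v                                          ∎
      where
      r : Fin n → ℝ^ m
      r i = combination (C (suc i)) v
      M : Fin (suc n) → Matrix n
      M j i k = C (suc i) (punchIn j k)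
      sign : Fin (suc n) → ℝ
      sign j = (- 1#) ^ toℕ j
      step : ∀ j → F (v j ∷ r) ≈ det (M j) * (sign j * F v)
      step j = begin
        F (v j ∷ r)                                     ≈⟨ kills-remove {G = λ r → F (v j ∷ r)} cong-j (a (v j)) v j (alternating-kills {F = F} alt (v j)) (λ i → C (suc i)) ⟩
        F (v j ∷ λ i → combination (M j i) (λ l → v (punchIn j l))) ≈⟨ alternating-det {F = λ r → F (v j ∷ r)} cong-j (a (v j)) (M j) (λ l → v (punchIn j l)) ⟩
        det (M j) * F (v j ∷ λ l → v (punchIn j l))     ≈⟨ *-congˡ (move-to-front {F = F} cong alt v j) ⟩
        det (M j) * (sign j * F v)                      ∎
        where
        cong-j : Congruent (λ r → F (v j ∷ r))
        cong-j = congruent-∷ {F = F} cong (v j)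

  private
    -- Expansion along the first row shows the determinant to be alternating in the columns, hence
    -- the transposes. The case B = I gives invariance under transposition, which then removes them.
    det-⊡-ᵀ : ∀ {n} (A B : Matrix n) → det ((A ⊡ B) ᵀ) ≈ det A * det (B ᵀ)
    det-⊡-ᵀ {n} A B = alternating-det {F = λ w → det (λ i k → w k i)} (λ v≋w → det-cong (λ i k → v≋w k i))
      (det-alternating n {φ = λ i w → w i} (λ i v≋w → v≋w i) (λ i c v → refl)) A B
      where open Forms n

  det-ᵀ : ∀ {n} (A : Matrix n) → det (A ᵀ) ≈ det A
  det-ᵀ {n} A = begin
    det (A ᵀ)              ≈⟨ det-cong (λ i j → sum-Iʳ i (A j)) ⟨
    det ((A ⊡ I) ᵀ)        ≈⟨ det-⊡-ᵀ A I ⟩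
    det A * det (I {n} ᵀ)  ≈⟨ *-congˡ (det-cong {n} (λ i j → reflexive (I-sym j i))) ⟩
    det A * det (I {n})    ≈⟨ *-congˡ (det-I n) ⟩
    det A * 1#             ≈⟨ *-identityʳ _ ⟩
    det A                  ∎

  det-⊡ : ∀ {n} (A B : Matrix n) → det (A ⊡ B) ≈ det A * det B
  det-⊡ A B = trans (sym (det-ᵀ (A ⊡ B))) (trans (det-⊡-ᵀ A B) (*-congˡ (det-ᵀ B)))

  -- Determinants near the identity

  factorial : ℕ → ℝ
  factorial zero    = 1#
  factorial (suc n) = fromℕ (suc n) * factorial n

  sign≼1 : ∀ k → (- 1#) ^ k ≼ 1#
  sign≼1 zero    = ≼-refl 0≤1
  sign≼1 (suc k) = ≼-resp (≼-* (≼-neg (≼-refl 0≤1)) (sign≼1 k)) refl (sym (*-identityˡ 1#))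

  -- The full expansion has n! products with one factor from each row. The bound may vary with the
  -- row, because later one line is of order ε while the others are merely bounded.
  det-≼ : ∀ {n} {A : Matrix n} (β : ℝ^ n) → (∀ i j → A i j ≼ β i) → det A ≼ factorial n * product β
  det-≼ {zero}      β A≼β = ≼-resp (≼-refl 0≤1) refl (*-identityˡ 1#)
  det-≼ {suc n} {A} β A≼β = ≼-resp
    (≼-sum {suc n} (λ j → ≼-* (sign≼1 (toℕ j)) (≼-* (A≼β zero j) (det-≼ β′ (λ i k → A≼β (suc i) (punchIn j k))))))
    refl (begin
      fromℕ (suc n) * factorial n * (β zero * product β′)
        ≈⟨ solve 4 (λ m f b p → m :* f :* (b :* p) := m :* (con (+ 1) :* (b :* (f :* p)))) refl (fromℕ (suc n)) (factorial n) (β zero) (product β′) ⟩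
      fromℕ (suc n) * (1# * (β zero * (factorial n * product β′)))
        ≈⟨ sum-const (suc n) _ ⟨
      sum {suc n} (λ j → 1# * (β zero * (factorial n * product β′))) ∎)
    where
    β′ : ℝ^ n
    β′ i = β (suc i)

  I≼1 : ∀ {n} (i j : Fin n) → I i j ≼ 1#
  I≼1 zero    zero    = ≼-refl 0≤1
  I≼1 zero    (suc j) = ≼-weaken (≼-refl O.refl) 0≤1
  I≼1 (suc i) zero    = ≼-weaken (≼-refl O.refl) 0≤1
  I≼1 (suc i) (suc j) = I≼1 i j

  infixl 6 I+_
  I+_ : ∀ {n} → Matrix n → Matrix n
  (I+ H) i j = I i j + H i j

  tr : ∀ {n} → Matrix n → ℝ
  tr H = sum λ i → H i i

  minorConstant : ℕ → ℝ
  minorConstant zero    = 0#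
  minorConstant (suc n) = factorial (suc n) * product {n} (λ _ → 2#)

  -- The summands account, in order, for the error of the lower right block, that error times the
  -- corner entry h, h times the trace of the block, and the n off-diagonal terms of the expansion.
  detConstant : ℕ → ℝ
  detConstant zero    = 0#
  detConstant (suc n) = detConstant n + detConstant n + fromℕ n + fromℕ n * minorConstant n

  -- Without row 0 but with column 0, the minor has a column consisting of off-diagonal entries
  -- only, of size ε; all its other entries are at most 1 + ε. The transpose turns this column into
  -- a row for `det-≼`.
  minor-≼ : ∀ {n ε} {H : Matrix (suc n)} → ε ≤ 1# → (∀ i j → H i j ≼ ε) → ∀ j →
            det (λ i k → (I+ H) (suc i) (punchIn (suc j) k)) ≼ minorConstant n * ε
  minor-≼ {suc n} {ε} {H} ε≤1 H≼ε j = ≼-resp (det-≼ {A = M ᵀ} β Mᵀ≼β) (sym (det-ᵀ M))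
    (solve 3 (λ f p e → f :* p :* e := f :* (e :* p)) refl (factorial (suc n)) (product {n} (λ _ → 2#)) ε)
    where
    M : Matrix (suc n)
    M i k = (I+ H) (suc i) (punchIn (suc j) k)
    β : ℝ^ (suc n)
    β = ε ∷ λ _ → 2#
    Mᵀ≼β : ∀ k i → M i k ≼ β k
    Mᵀ≼β zero    i = ≼-resp (H≼ε (suc i) zero) (+-identityˡ _) refl
    Mᵀ≼β (suc k) i = ≼-+ (I≼1 (suc i) (punchIn (suc j) (suc k))) (≼-weaken (H≼ε _ _) ε≤1)

  -- In the expansion along the first row an off-diagonal term is an entry of size ε times a minor
  -- of size ε, so at first order only the diagonal contributes.
  det-I+ : ∀ {n ε} {H : Matrix n} → ε ≤ 1# → (∀ i j → H i j ≼ ε) →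
           det (I+ H) - (1# + tr H) ≼ detConstant n * (ε * ε)
  det-I+ {zero} {ε} _ _ = ≼-resp (≼-refl O.refl)
    (solve 0 (con (+ 1) :- (con (+ 1) :+ con (+ 0)) := con (+ 0)) refl) (zeroˡ _)
  det-I+ {suc n} {ε} {H} ε≤1 H≼ε = ≼-resp
    (≼-+ (≼-+ (≼-+ D≼ (≼-* (≼-weaken (H≼ε zero zero) ε≤1) D≼)) (≼-* (H≼ε zero zero) t≼)) off≼)
    (begin
      1# * ((1# + h) * D) + off - (1# + (h + t))
        ≈⟨ solve 4 (λ h D o t → con (+ 1) :* ((con (+ 1) :+ h) :* D) :+ o :- (con (+ 1) :+ (h :+ t))
             := (D :- (con (+ 1) :+ t)) :+ h :* (D :- (con (+ 1) :+ t)) :+ h :* t :+ o) refl h D off t ⟩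
      (D - (1# + t)) + h * (D - (1# + t)) + h * t + off ∎)
    (begin
      (c + c + fromℕ n + fromℕ n * m) * (ε * ε)
        ≈⟨ solve 4 (λ c n m e → (c :+ c :+ n :+ n :* m) :* (e :* e)
             := c :* (e :* e) :+ con (+ 1) :* (c :* (e :* e)) :+ e :* (n :* e) :+ n :* (con (+ 1) :* (e :* (m :* e)))) refl c (fromℕ n) m ε ⟩
      c * (ε * ε) + 1# * (c * (ε * ε)) + ε * (fromℕ n * ε) + fromℕ n * (1# * (ε * (m * ε)))
        ≈⟨ +-cong (+-congˡ (*-congˡ (sum-const n ε))) (sum-const n _) ⟨
      c * (ε * ε) + 1# * (c * (ε * ε)) + ε * sum {n} (λ _ → ε) + sum {n} (λ _ → 1# * (ε * (m * ε))) ∎)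
    where
    H′ : Matrix n
    H′ i j = H (suc i) (suc j)
    h = H zero zero
    t = tr H′
    c = detConstant n
    m = minorConstant n
    D = det (I+ H′)
    M : Fin n → Matrix n
    M j i k = (I+ H) (suc i) (punchIn (suc j) k)
    off = sum {n} λ j → (- 1#) ^ suc (toℕ j) * ((0# + H zero (suc j)) * det (M j))
    D≼ : D - (1# + t) ≼ c * (ε * ε)
    D≼ = det-I+ {H = H′} ε≤1 (λ i j → H≼ε (suc i) (suc j))
    t≼ : t ≼ sum {n} (λ _ → ε)
    t≼ = ≼-sum {n} (λ i → H≼ε (suc i) (suc i))
    off≼ : off ≼ sum {n} (λ _ → 1# * (ε * (m * ε)))
    off≼ = ≼-sum {n} (λ j → ≼-* (sign≼1 (suc (toℕ j)))
      (≼-* (≼-resp (H≼ε zero (suc j)) (+-identityˡ _) refl) (minor-≼ {H = H} ε≤1 H≼ε j)))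

  -- Infima, square roots and the volume of the unit ball

  -- An infimum is a supremum over negatives, so membership of x has to be transported to `- - x`,
  -- which is only `_≈_`-equal to it.
  Respects≈ : (ℝ → Set) → Set
  Respects≈ S = ∀ {x y} → x ≈ y → S x → S y

  neg-flip-≤ : ∀ {x y} → - x ≤ y → - y ≤ x
  neg-flip-≤ -x≤y = O.trans (neg-mono-≤ -x≤y) (O.reflexive (-‿involutive _))

  ≤-neg-flip : ∀ {x y} → x ≤ - y → y ≤ - x
  ≤-neg-flip x≤-y = O.trans (O.reflexive (sym (-‿involutive _))) (neg-mono-≤ x≤-y)

  inf-lower : ∀ S {b x} → Respects≈ S → (∀ y → S y → b ≤ y) → S x → inf S ≤ x
  inf-lower S {b} {x} resp b≤S Sx = neg-flip-≤ (sup-upper (λ y → S (- y))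
    (- x , S--x) (- b , λ y S-y → ≤-neg-flip (b≤S (- y) S-y)) (- x) S--x)
    where
    S--x : S (- - x)
    S--x = resp (sym (-‿involutive x)) Sx

  inf-greatest : ∀ S {b x} → Respects≈ S → (∀ y → S y → b ≤ y) → S x → b ≤ inf S
  inf-greatest S {b} {x} resp b≤S Sx = ≤-neg-flip (sup-least (λ y → S (- y))
    (- x , resp (sym (-‿involutive x)) Sx) (- b) (λ y S-y → ≤-neg-flip (b≤S (- y) S-y)))

  sqrt-mono : ∀ {x y} → 0# ≤ x → x ≤ y → sqrt x ≤ sqrt y
  sqrt-mono {x} {y} 0≤x x≤y = sup-least (λ z → z * z ≤ x) (0# , 0²≤ 0≤x) (sqrt y)
    (λ z zz≤x → sup-upper (λ z → z * z ≤ y) (0# , 0²≤ 0≤y)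
      -- The supremum is specified only for a bounded set; y + 1 is a bound because y is at most its
      -- square.
      (y + 1# , λ z zz≤y → ²-cancel-≤ (proj₁ (0<+1 0≤y)) (O.trans zz≤y y≤[y+1]²)) z (O.trans zz≤x x≤y))
    where
    0≤y : 0# ≤ y
    0≤y = O.trans 0≤x x≤y
    0²≤ : ∀ {x} → 0# ≤ x → 0# * 0# ≤ x
    0²≤ 0≤x = O.trans (O.reflexive (zeroˡ 0#)) 0≤x
    y≤[y+1]² : y ≤ (y + 1#) * (y + 1#)
    y≤[y+1]² = ≤-by (y * y + y + 1#) (0≤+ (0≤+ (0≤² y) 0≤y) 0≤1)
      (solve 1 (λ y → (y :+ con (+ 1)) :* (y :+ con (+ 1)) := y :+ (y :* y :+ y :+ con (+ 1))) refl y)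

  product-nonNeg : ∀ {n} {x : Vector ℝ n} → (∀ i → 0# ≤ x i) → 0# ≤ product x
  product-nonNeg {zero}  0≤x = 0≤1
  product-nonNeg {suc n} 0≤x = *-nonNeg (0≤x zero) (product-nonNeg (λ i → 0≤x (suc i)))

  ^-nonNeg : ∀ {x} n → 0# ≤ x → 0# ≤ x ^ n
  ^-nonNeg zero    0≤x = 0≤1
  ^-nonNeg (suc n) 0≤x = *-nonNeg 0≤x (^-nonNeg n 0≤x)

  ^-pos : ∀ {x} n → 0# < x → 0# < x ^ n
  ^-pos zero    0<x = 0<1
  ^-pos (suc n) 0<x = 0<* 0<x (^-pos n 0<x)

  ^-distrib-* : ∀ x y n → (x * y) ^ n ≈ x ^ n * y ^ n
  ^-distrib-* x y zero    = sym (*-identityˡ 1#)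
  ^-distrib-* x y (suc n) = trans (*-congˡ (^-distrib-* x y n))
    (solve 4 (λ x y p q → x :* y :* (p :* q) := x :* p :* (y :* q)) refl x y (x ^ n) (y ^ n))

  ^-cong : ∀ {x y} n → x ≈ y → x ^ n ≈ y ^ n
  ^-cong zero    x≈y = refl
  ^-cong (suc n) x≈y = *-cong x≈y (^-cong n x≈y)

  x²≤0⇒x≈0 : ∀ {x} → x * x ≤ 0# → x ≈ 0#
  x²≤0⇒x≈0 {x} xx≤0 = O.antisym (≼⇒≤ x≼0) (O.trans (O.reflexive (sym -0#≈0#)) (≼⇒≥ x≼0))
    where
    x≼0 : x ≼ 0#
    x≼0 = ≼-² O.refl (O.trans xx≤0 (O.reflexive (sym (zeroˡ 0#))))

  0≤⟨x,x⟩ : ∀ {n} (x : ℝ^ n) → 0# ≤ ⟨ x , x ⟩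
  0≤⟨x,x⟩ x = sum-nonNeg (λ i → 0≤² (x i))

  xᵢ²≤⟨x,x⟩ : ∀ {n} (x : ℝ^ n) i → x i * x i ≤ ⟨ x , x ⟩
  xᵢ²≤⟨x,x⟩ x = term≤sum (λ i → 0≤² (x i))

  ⟨x,x⟩≈0⇒x≋𝟎 : ∀ {n} {x : ℝ^ n} → ⟨ x , x ⟩ ≈ 0# → x ≋ 𝟎
  ⟨x,x⟩≈0⇒x≋𝟎 {x = x} eq i = x²≤0⇒x≈0 (O.trans (xᵢ²≤⟨x,x⟩ x i) (O.reflexive eq))

  ⟨𝟎,𝟎⟩ : ∀ {n} {x : ℝ^ n} → x ≋ 𝟎 → ⟨ x , x ⟩ ≈ 0#
  ⟨𝟎,𝟎⟩ {n} {x} x≋𝟎 = sum-0 {n} (λ i → trans (*-congʳ (x≋𝟎 i)) (zeroˡ (x i)))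

  unit-≼1 : ∀ {n} {x : ℝ^ n} → ⟨ x , x ⟩ ≤ 1# → ∀ i → x i ≼ 1#
  unit-≼1 {x = x} ⟨x,x⟩≤1 i = ≼-² 0≤1 (O.trans (xᵢ²≤⟨x,x⟩ x i) (O.trans ⟨x,x⟩≤1 (O.reflexive (sym (*-identityˡ 1#)))))

  0≤unitBallVolume : ∀ n → 0# ≤ unitBallVolume n
  0≤unitBallVolume n = inf-greatest CoveringVolume
    (λ { x≈y (m , B , covers , x≈) → m , B , covers , trans (sym x≈y) x≈ })
    (λ { _ (m , B , _ , y≈) → 0≤-resp (sum-nonNeg {m} (λ k → product-nonNeg {n} (λ i → 0≤y-x (ordered (B k) i)))) y≈ })
    -- A single cube of side 2 covers the ball, so the set of covering volumes is inhabited and its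
    -- infimum is specified.
    (1 , (λ _ → cube) , (λ x ⟨x,x⟩≤1 → zero , λ i → ≼⇒≥ (unit-≼1 {x = x} ⟨x,x⟩≤1 i) , ≼⇒≤ (unit-≼1 {x = x} ⟨x,x⟩≤1 i)) , refl)
    where
    CoveringVolume : ℝ → Set
    CoveringVolume r = ∃[ m ] Σ (Vector (Box n) m) λ B →
      (∀ x → ⟨ x , x ⟩ ≤ 1# → ∃[ k ] x ∈Box B k) × r ≈ sum (λ k → boxVolume (B k))
    cube : Box n
    cube = record { lower = λ _ → - 1# ; upper = λ _ → 1# ; ordered = λ _ → ≤-by 2# 0≤2 (solve 0 (con (+ 1) := (:- con (+ 1)) :+ (con (+ 1) :+ con (+ 1))) refl) }

  bounded : ∀ {n} (x : Vector ℝ n) → ∃[ w ] 0# ≤ w × (∀ i → x i ≼ w)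
  bounded {n} x = sum a , sum-nonNeg (λ i → 0≤a i) , λ i → ≼-weaken (proj₁ (proj₂ ≼-∣ x i ∣)) (term≤sum 0≤a i)
    where
    a : Vector ℝ n
    a i = proj₁ ≼-∣ x i ∣
    0≤a : ∀ i → 0# ≤ a i
    0≤a i = ≼⇒0≤ (proj₁ (proj₂ ≼-∣ x i ∣))

  bounded-matrix : ∀ {m n} (A : Fin m → ℝ^ n) → ∃[ w ] 0# ≤ w × (∀ i j → A i j ≼ w)
  bounded-matrix {m} A = proj₁ b , proj₁ (proj₂ b) ,
    λ i j → ≼-weaken (proj₂ (proj₂ (bounded (A i))) j) (≼⇒≤ (proj₂ (proj₂ b) i))
    where
    b : ∃[ w ] 0# ≤ w × (∀ i → proj₁ (bounded (A i)) ≼ w)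
    b = bounded {m} (λ i → proj₁ (bounded (A i)))

  close⇒≼ : ∀ {ε x y} → Close ε x y → y - x ≼ ε
  close⇒≼ {ε} {x} {y} ((x≤y+ε , _) , (y≤x+ε , _)) =
    0≤-resp (0≤y-x y≤x+ε) (solve 3 (λ x y e → e :- (y :- x) := x :+ e :- y) refl x y ε) ,
    0≤-resp (0≤y-x x≤y+ε) (solve 3 (λ x y e → e :+ (y :- x) := y :+ e :- x) refl x y ε)

  -- Lattices

  ≋-refl : ∀ {n} {x : ℝ^ n} → x ≋ x
  ≋-refl i = refl

  ≋-sym : ∀ {n} {x y : ℝ^ n} → x ≋ y → y ≋ x
  ≋-sym x≋y i = sym (x≋y i)

  ≋-trans : ∀ {n} {x y z : ℝ^ n} → x ≋ y → y ≋ z → x ≋ z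
  ≋-trans x≋y y≋z i = trans (x≋y i) (y≋z i)

  IntegerMatrix : ℕ → Set
  IntegerMatrix n = Fin n → Vector ℤ n

  ⌜_⌝ : ∀ {m n} → (Fin m → Vector ℤ n) → Fin m → ℝ^ n
  ⌜ Z ⌝ i j = fromℤ (Z i j)

  Iℤ : ∀ {n} → IntegerMatrix n
  Iℤ zero    zero    = + 1
  Iℤ zero    (suc j) = + 0
  Iℤ (suc i) zero    = + 0
  Iℤ (suc i) (suc j) = Iℤ i j

  ⌜Iℤ⌝ : ∀ {n} (i : Fin n) → ⌜ Iℤ ⌝ i ≋ I i
  ⌜Iℤ⌝ zero    zero    = +-identityʳ 1#
  ⌜Iℤ⌝ zero    (suc j) = refl
  ⌜Iℤ⌝ (suc i) zero    = refl
  ⌜Iℤ⌝ (suc i) (suc j) = ⌜Iℤ⌝ i j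

  combination-I : ∀ {m n} (i : Fin m) (b : Fin m → ℝ^ n) → combination (I i) b ≋ b i
  combination-I i b j = sum-Iˡ i (λ k → b k j)

  combination-congˡ : ∀ {m n} {c c′ : Vector ℝ m} (b : Fin m → ℝ^ n) →
                      c ≋ c′ → combination c b ≋ combination c′ b
  combination-congˡ {m} b c≋c′ j = sum-cong-≋ {m} (λ i → *-congʳ (c≋c′ i))

  combination-congʳ : ∀ {m n} (c : Vector ℝ m) {b b′ : Fin m → ℝ^ n} →
                      (∀ i → b i ≋ b′ i) → combination c b ≋ combination c b′
  combination-congʳ {m} c b≋b′ j = sum-cong-≋ {m} (λ i → *-congˡ (b≋b′ i j))

  ⟨,-⟩ : ∀ {n} (x y z : ℝ^ n) → ⟨ x , (λ i → y i - z i) ⟩ ≈ ⟨ x , y ⟩ - ⟨ x , z ⟩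
  ⟨,-⟩ {n} x y z = begin
    sum (λ i → x i * (y i - z i))            ≈⟨ sum-cong-≋ {n} (λ i → solve 3 (λ x y z → x :* (y :- z) := x :* y :+ (:- con (+ 1)) :* (x :* z)) refl (x i) (y i) (z i)) ⟩
    sum (λ i → x i * y i + - 1# * (x i * z i)) ≈⟨ ∑-distrib-+ {n} (λ i → x i * y i) (λ i → - 1# * (x i * z i)) ⟩
    ⟨ x , y ⟩ + sum (λ i → - 1# * (x i * z i)) ≈⟨ +-congˡ (sym (*-distribˡ-sum {n} (- 1#) (λ i → x i * z i))) ⟩
    ⟨ x , y ⟩ + - 1# * ⟨ x , z ⟩             ≈⟨ solve 2 (λ p q → p :+ (:- con (+ 1)) :* q := p :- q) refl ⟨ x , y ⟩ ⟨ x , z ⟩ ⟩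
    ⟨ x , y ⟩ - ⟨ x , z ⟩                    ∎

  combination-− : ∀ {m n} (c d : Vector ℝ m) (b : Fin m → ℝ^ n) →
                  combination (λ i → c i - d i) b ≋ (λ j → combination c b j - combination d b j)
  combination-− {m} c d b j = begin
    sum (λ i → (c i - d i) * b i j)  ≈⟨ sum-cong-≋ {m} (λ i → *-comm _ (b i j)) ⟩
    ⟨ (λ i → b i j) , (λ i → c i - d i) ⟩ ≈⟨ ⟨,-⟩ (λ i → b i j) c d ⟩
    ⟨ (λ i → b i j) , c ⟩ - ⟨ (λ i → b i j) , d ⟩ ≈⟨ +-cong (⟨⟩-comm (λ i → b i j) c) (-‿cong (⟨⟩-comm (λ i → b i j) d)) ⟩
    combination c b j - combination d b j ∎

  x-y≈0⇒x≈y : ∀ {x y} → x - y ≈ 0# → x ≈ y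
  x-y≈0⇒x≈y {x} {y} eq = begin
    x           ≈⟨ solve 2 (λ x y → x := x :- y :+ y) refl x y ⟩
    x - y + y   ≈⟨ +-congʳ eq ⟩
    0# + y      ≈⟨ +-identityˡ y ⟩
    y           ∎

  x≈y⇒x-y≈0 : ∀ {x y} → x ≈ y → x - y ≈ 0#
  x≈y⇒x-y≈0 {x} {y} eq = trans (+-congʳ eq) (-‿inverseʳ y)

  combination-injective : ∀ {n} {b : Fin n → ℝ^ n} → IsBasis b → ∀ c d →
                          combination c b ≋ combination d b → c ≋ d
  combination-injective {b = b} isBasis c d eq i = x-y≈0⇒x≈y (IsBasis.independent isBasis (λ i → c i - d i)
    (λ j → trans (combination-− c d b j) (x≈y⇒x-y≈0 (eq j))) i)

  ∈-resp : ∀ {n} (L : Lattice n) {x y} → x ≋ y → x ∈ L → y ∈ L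
  ∈-resp L x≋y (z , x≋) = z , ≋-trans (≋-sym x≋y) x≋

  basis∈ : ∀ {n} (L : Lattice n) i → basis L i ∈ L
  basis∈ L i = Iℤ i , ≋-sym (≋-trans (combination-congˡ (basis L) (⌜Iℤ⌝ i)) (combination-I i (basis L)))

  ∈-combination : ∀ {n} (L : Lattice n) {m} (z : Vector ℤ m) (b : Fin m → ℝ^ n) →
                  (∀ i → b i ∈ L) → combination (λ i → fromℤ (z i)) b ∈ L
  ∈-combination {n} L {zero}  z b b∈L = (λ _ → + 0) , λ j → sym (sum-0 {n} (λ i → zeroˡ _))
  ∈-combination {n} L {suc m} z b b∈L with b∈L zero | ∈-combination L (λ i → z (suc i)) (λ i → b (suc i)) (λ i → b∈L (suc i))
  ... | w , b≋ | v , rest≋ = (λ j → z zero ℤ.* w j ℤ.+ v j) , λ j → begin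
    fromℤ (z zero) * b zero j + combination (λ i → fromℤ (z (suc i))) (λ i → b (suc i)) j
      ≈⟨ +-cong (*-congˡ (b≋ j)) (rest≋ j) ⟩
    fromℤ (z zero) * combination (λ i → fromℤ (w i)) (basis L) j + combination (λ i → fromℤ (v i)) (basis L) j
      ≈⟨ +-congʳ (*-distribˡ-sum {n} (fromℤ (z zero)) (λ i → fromℤ (w i) * basis L i j)) ⟩
    sum {n} (λ i → fromℤ (z zero) * (fromℤ (w i) * basis L i j)) + combination (λ i → fromℤ (v i)) (basis L) j
      ≈⟨ ∑-distrib-+ {n} (λ i → fromℤ (z zero) * (fromℤ (w i) * basis L i j)) (λ i → fromℤ (v i) * basis L i j) ⟨
    sum {n} (λ i → fromℤ (z zero) * (fromℤ (w i) * basis L i j) + fromℤ (v i) * basis L i j)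
      ≈⟨ sum-cong-≋ {n} (λ i → trans
           (solve 4 (λ a w b v → a :* (w :* b) :+ v :* b := (a :* w :+ v) :* b) refl (fromℤ (z zero)) (fromℤ (w i)) (basis L i j) (fromℤ (v i)))
           (*-congʳ (sym (trans (fromℤ-+ (z zero ℤ.* w i) (v i)) (+-congʳ (fromℤ-* (z zero) (w i))))))) ⟩
    combination (λ i → fromℤ (z zero ℤ.* w i ℤ.+ v i)) (basis L) j ∎

  basis≉𝟎 : ∀ {n} (L : Lattice n) i → ¬ (basis L i ≋ 𝟎)
  basis≉𝟎 {n} L i b≋𝟎 = 0≉1 (sym (trans (I-diagonal i)
    (IsBasis.independent (isBasis L) (I i) (≋-trans (combination-I i (basis L)) b≋𝟎) i)))
    where
    I-diagonal : ∀ {n} (i : Fin n) → 1# ≈ I i i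
    I-diagonal zero    = refl
    I-diagonal (suc i) = I-diagonal i

  Norm : ∀ {n} → Lattice n → ℝ → Set
  Norm L r = ∃[ x ] x ∈ L × ¬ (x ≋ 𝟎) × r ≈ ⟨ x , x ⟩

  norm-resp : ∀ {n} (L : Lattice n) → Respects≈ (Norm L)
  norm-resp L r≈s (x , x∈L , x≉𝟎 , r≈) = x , x∈L , x≉𝟎 , trans (sym r≈s) r≈

  min-lower : ∀ {n} (L : Lattice n) {x} → x ∈ L → ¬ (x ≋ 𝟎) → min L ≤ ⟨ x , x ⟩
  min-lower L {x} x∈L x≉𝟎 = inf-lower (Norm L) (norm-resp L)
    (λ { r (x , _ , _ , r≈) → 0≤-resp (0≤⟨x,x⟩ x) r≈ }) (x , x∈L , x≉𝟎 , refl)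

  -- Positive dimension provides a basis vector, hence a nonzero lattice vector, so that the infimum
  -- is taken over an inhabited set.
  min-greatest : ∀ {n} (L : Lattice (suc n)) {c} → (∀ x → x ∈ L → ¬ (x ≋ 𝟎) → c ≤ ⟨ x , x ⟩) → c ≤ min L
  min-greatest L c≤ = inf-greatest (Norm L) (norm-resp L)
    (λ { r (x , x∈L , x≉𝟎 , r≈) → O.trans (c≤ x x∈L x≉𝟎) (O.reflexive (sym r≈)) })
    (basis L zero , basis∈ L zero , basis≉𝟎 L zero , refl)

  0≤min : ∀ {n} (L : Lattice (suc n)) → 0# ≤ min L
  0≤min L = min-greatest L (λ x _ _ → 0≤⟨x,x⟩ x)

  -- Unimodular matrices and the determinant of a lattice

  Integral : ℝ → Set
  Integral x = ∃[ d ] x ≈ fromℤ d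

  integral-* : ∀ {x y} → Integral x → Integral y → Integral (x * y)
  integral-* (d , x≈) (e , y≈) = d ℤ.* e , trans (*-cong x≈ y≈) (sym (fromℤ-* d e))

  integral-sum : ∀ {n} {x : Vector ℝ n} → (∀ i → Integral (x i)) → Integral (sum x)
  integral-sum {zero}  _ = + 0 , refl
  integral-sum {suc n} p with p zero | integral-sum (λ i → p (suc i))
  ... | d , x≈ | e , y≈ = d ℤ.+ e , trans (+-cong x≈ y≈) (sym (fromℤ-+ d e))

  integral-sign : ∀ k → Integral ((- 1#) ^ k)
  integral-sign zero    = + 1 , sym (+-identityʳ 1#)
  integral-sign (suc k) = integral-* (ℤ.-[1+ 0 ] , -‿cong (sym (+-identityʳ 1#))) (integral-sign k)

  integral-det : ∀ {n} (Z : IntegerMatrix n) → Integral (det ⌜ Z ⌝)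
  integral-det {zero}  Z = + 1 , sym (+-identityʳ 1#)
  integral-det {suc n} Z = integral-sum {suc n} (λ j → integral-* (integral-sign (toℕ j))
    (integral-* (Z zero j , refl) (integral-det (λ i k → Z (suc i) (punchIn j k)))))

  -- Discreteness of the integers, put in terms of squares to be independent of the sign.
  integral-² : ∀ {x} → Integral x → x ≈ 0# ⊎ 1# ≤ x * x
  integral-² (+ zero , x≈)        = inj₁ x≈
  integral-² {x} (+ suc k , x≈)   = inj₂ (O.trans (O.reflexive (sym (*-identityˡ 1#)))
    (*-mono-≤ 0≤1 (O.trans 0≤1 1≤x) 1≤x 1≤x))
    where
    1≤x : 1# ≤ x
    1≤x = ≤-by (fromℕ k) (0≤fromℕ k) x≈
  integral-² {x} (-[1+ k ] , x≈) = inj₂ (O.trans (O.reflexive (sym (*-identityˡ 1#)))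
    (O.trans (*-mono-≤ 0≤1 (O.trans 0≤1 1≤-x) 1≤-x 1≤-x)
    (O.reflexive (solve 1 (λ x → (:- x) :* (:- x) := x :* x) refl x))))
    where
    1≤-x : 1# ≤ - x
    1≤-x = ≤-by (fromℕ k) (0≤fromℕ k) (trans (-‿cong x≈) (-‿involutive _))

  -- Neither factor vanishes, so both squares are at least 1, while their product is 1.
  integral-unit : ∀ {x y} → Integral x → Integral y → x * y ≈ 1# → x * x ≈ 1#
  integral-unit {x} {y} ix iy xy≈1 with integral-² ix | integral-² iy
  ... | inj₁ x≈0 | _        = ⊥-elim (0≉1 (trans (sym (zeroˡ y)) (trans (*-congʳ (sym x≈0)) xy≈1)))
  ... | inj₂ _   | inj₁ y≈0 = ⊥-elim (0≉1 (trans (sym (zeroʳ x)) (trans (*-congˡ (sym y≈0)) xy≈1)))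
  ... | inj₂ 1≤x² | inj₂ 1≤y² = O.antisym
    (O.trans (O.reflexive (sym (*-identityʳ _)))
    (O.trans (*-monoˡ-≤ (x * x) (0≤² x) 1≤y²) (O.reflexive (begin
      x * x * (y * y)   ≈⟨ solve 2 (λ x y → x :* x :* (y :* y) := x :* y :* (x :* y)) refl x y ⟩
      x * y * (x * y)   ≈⟨ *-cong xy≈1 xy≈1 ⟩
      1# * 1#           ≈⟨ *-identityˡ 1# ⟩
      1#                ∎)))) 1≤x²

  gram : ∀ {n} → (Fin n → ℝ^ n) → Matrix n
  gram b i j = ⟨ b i , b j ⟩

  det-gram : ∀ {n} (b : Fin n → ℝ^ n) → det (gram b) ≈ det b * det b
  det-gram b = trans (det-⊡ b (b ᵀ)) (*-congˡ (det-ᵀ b))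

  unimodular : ∀ {n} (Z W : IntegerMatrix n) → (∀ i → (⌜ W ⌝ ⊡ ⌜ Z ⌝) i ≋ I i) → det ⌜ Z ⌝ * det ⌜ Z ⌝ ≈ 1#
  unimodular {n} Z W WZ≋I = integral-unit (integral-det Z) (integral-det W) (begin
    det ⌜ Z ⌝ * det ⌜ W ⌝   ≈⟨ *-comm _ _ ⟩
    det ⌜ W ⌝ * det ⌜ Z ⌝   ≈⟨ det-⊡ ⌜ W ⌝ ⌜ Z ⌝ ⟨
    det (⌜ W ⌝ ⊡ ⌜ Z ⌝)     ≈⟨ det-cong WZ≋I ⟩
    det (I {n})             ≈⟨ det-I n ⟩
    1#                      ∎)

  -- The inverse of the basis matrix, read off from expansions of the standard basis vectors.
  coordinates : ∀ {n} {b : Fin n → ℝ^ n} → IsBasis b → Matrix n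
  coordinates isBasis k = proj₁ (IsBasis.spanning isBasis (I k))

  coordinates-⊡ : ∀ {n} {b : Fin n → ℝ^ n} (isBasis : IsBasis b) k → (coordinates isBasis ⊡ b) k ≋ I k
  coordinates-⊡ isBasis k = ≋-sym (proj₂ (IsBasis.spanning isBasis (I k)))

  det-coordinates : ∀ {n} {b : Fin n → ℝ^ n} (isBasis : IsBasis b) → det (coordinates isBasis) * det b ≈ 1#
  det-coordinates {n} {b} isBasis = trans (sym (det-⊡ (coordinates isBasis) b))
    (trans (det-cong (coordinates-⊡ isBasis)) (det-I n))

  0<detL : ∀ {n} (L : Lattice n) → 0# < detL L
  0<detL L = 0≤-resp (0≤² d) (det-gram (basis L)) , λ 0≈ → 0≉1 (begin
    0#                ≈⟨ zeroʳ _ ⟨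
    (C * C) * 0#      ≈⟨ *-congˡ (trans 0≈ (det-gram (basis L))) ⟩
    (C * C) * (d * d) ≈⟨ solve 2 (λ c d → c :* c :* (d :* d) := c :* d :* (c :* d)) refl C d ⟩
    C * d * (C * d)   ≈⟨ *-cong (det-coordinates (isBasis L)) (det-coordinates (isBasis L)) ⟩
    1# * 1#           ≈⟨ *-identityˡ 1# ⟩
    1#                ∎)
    where
    d = det (basis L)
    C = det (coordinates (isBasis L))

  -- Dividing by the positive product of the determinants compares the radicands; the square root is
  -- monotone, and the factor common to both densities is nonnegative.
  δ-mono : ∀ {n} (L L′ : Lattice (suc n)) →
           min L′ ^ suc n * detL L ≤ min L ^ suc n * detL L′ → δ L′ ≤ δ L
  δ-mono {n} L L′ le = *-monoˡ-≤ _
    (*-nonNeg (0≤unitBallVolume (suc n)) (0≤⁻¹ (^-pos (suc n) (0<fromℕ 1))))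
    (sqrt-mono (*-nonNeg (^-nonNeg (suc n) (0≤min L′)) (0≤⁻¹ (0<detL L′)))
      (*-cancelˡ-≤ (D * D′) (0<* (0<detL L) (0<detL L′)) (O.trans (O.reflexive (begin
        D * D′ * (m′ * D′ ⁻¹)    ≈⟨ solve 4 (λ d d′ m i → d :* d′ :* (m :* i) := m :* d :* (d′ :* i)) refl D D′ m′ (D′ ⁻¹) ⟩
        m′ * D * (D′ * D′ ⁻¹)    ≈⟨ *-congˡ (*-inverseʳ D′ (0<⇒≉0 (0<detL L′))) ⟩
        m′ * D * 1#              ≈⟨ *-identityʳ _ ⟩
        m′ * D                   ∎))
      (O.trans le (O.reflexive (begin
        m * D′                   ≈⟨ *-identityʳ _ ⟨
        m * D′ * 1#              ≈⟨ *-congˡ (*-inverseʳ D (0<⇒≉0 (0<detL L))) ⟨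
        m * D′ * (D * D ⁻¹)      ≈⟨ solve 4 (λ d d′ m i → m :* d′ :* (d :* i) := d :* d′ :* (m :* i)) refl D D′ m (D ⁻¹) ⟩
        D * D′ * (m * D ⁻¹)      ∎))))))
    where
    D D′ m m′ : ℝ
    D  = detL L
    D′ = detL L′
    m  = min L ^ suc n
    m′ = min L′ ^ suc n

  -- Similar lattices and the invariance of the density

  ·-combination : ∀ {m n} (A : Matrix n) (c : Vector ℝ m) (b : Fin m → ℝ^ n) →
                  A · combination c b ≋ combination c (λ i → A · b i)
  ·-combination A c b i = ⟨,combination⟩ c b (A i)

  ·-cong : ∀ {n} (A : Matrix n) {x y : ℝ^ n} → x ≋ y → A · x ≋ A · y
  ·-cong {n} A x≋y i = sum-cong-≋ {n} (λ j → *-congˡ (x≋y j))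

  module Similarity {n} (L L′ : Lattice n) (L∼L′ : Similar L L′) where

    A : Matrix n
    A = proj₁ L∼L′

    c : ℝ
    c = proj₁ (proj₂ L∼L′)

    0<c : 0# < c
    0<c = proj₁ (proj₂ (proj₂ L∼L′))

    scales : ∀ x y → ⟨ A · x , A · y ⟩ ≈ c * ⟨ x , y ⟩
    scales = proj₁ (proj₂ (proj₂ (proj₂ L∼L′)))

    image : ∀ y → y ∈ L′ ⇔ (∃[ x ] x ∈ L × y ≋ A · x)
    image = proj₂ (proj₂ (proj₂ (proj₂ L∼L′)))

    A-kernel : ∀ x → A · x ≋ 𝟎 → x ≋ 𝟎
    A-kernel x Ax≋𝟎 = ⟨x,x⟩≈0⇒x≋𝟎 (*-cancelˡ-≈ c (0<⇒≉0 0<c)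
      (trans (sym (scales x x)) (trans (⟨𝟎,𝟎⟩ Ax≋𝟎) (sym (zeroʳ c)))))

    A-injective : ∀ x y → A · x ≋ A · y → x ≋ y
    A-injective x y Ax≋Ay i = x-y≈0⇒x≈y (A-kernel (λ i → x i - y i)
      (λ j → trans (⟨,-⟩ (A j) x y) (x≈y⇒x-y≈0 (Ax≋Ay j))) i)

    -- A similarity multiplies inner products by c, so its inverse is the transpose divided by c.
    A⁻¹ : Matrix n
    A⁻¹ i k = c ⁻¹ * A k i

    A⁻¹·A : ∀ x → A⁻¹ · (A · x) ≋ x
    A⁻¹·A x i = begin
      sum (λ k → c ⁻¹ * A k i * (A · x) k)     ≈⟨ sum-cong-≋ {n} (λ k → *-assoc _ _ _) ⟩
      sum (λ k → c ⁻¹ * (A k i * (A · x) k))   ≈⟨ *-distribˡ-sum {n} (c ⁻¹) (λ k → A k i * (A · x) k) ⟨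
      c ⁻¹ * sum (λ k → A k i * (A · x) k)     ≈⟨ *-congˡ (sum-cong-≋ {n} (λ k → *-congʳ (trans (sym (sum-Iˡ i (A k))) (⟨⟩-comm (I i) (A k))))) ⟩
      c ⁻¹ * ⟨ A · I i , A · x ⟩               ≈⟨ *-congˡ (scales (I i) x) ⟩
      c ⁻¹ * (c * ⟨ I i , x ⟩)                 ≈⟨ *-congˡ (*-congˡ (sum-Iˡ i x)) ⟩
      c ⁻¹ * (c * x i)                         ≈⟨ sym (*-assoc _ _ _) ⟩
      c ⁻¹ * c * x i                           ≈⟨ *-congʳ (*-inverseˡ c (0<⇒≉0 0<c)) ⟩
      1# * x i                                 ≈⟨ *-identityˡ _ ⟩
      x i                                      ∎

    preimage : ∀ i → ∃[ x ] x ∈ L × basis L′ i ≋ A · x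
    preimage i = Equivalence.to (image (basis L′ i)) (basis∈ L′ i)

    X : Fin n → ℝ^ n
    X i = proj₁ (preimage i)

    -- Z expresses the preimages of the basis of L′ in the basis of L, and W below expresses the
    -- images of the basis of L in the basis of L′. They turn out to be inverse to each other.
    Z : IntegerMatrix n
    Z i = proj₁ (proj₁ (proj₂ (preimage i)))

    X≋ : ∀ i → X i ≋ combination (⌜ Z ⌝ i) (basis L)
    X≋ i = proj₂ (proj₁ (proj₂ (preimage i)))

    basis′≋ : ∀ i → basis L′ i ≋ A · X i
    basis′≋ i = proj₂ (proj₂ (preimage i))

    A·basis∈ : ∀ j → A · basis L j ∈ L′
    A·basis∈ j = Equivalence.from (image (A · basis L j)) (basis L j , basis∈ L j , ≋-refl)

    W : IntegerMatrix n
    W j = proj₁ (A·basis∈ j)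

    A·basis≋ : ∀ j → A · basis L j ≋ combination (⌜ W ⌝ j) (basis L′)
    A·basis≋ j = proj₂ (A·basis∈ j)

    WZ≋I : ∀ j → (⌜ W ⌝ ⊡ ⌜ Z ⌝) j ≋ I j
    WZ≋I j = combination-injective (isBasis L) _ (I j) (≋-trans (≋-sym
      (≋-trans (combination-congʳ (⌜ W ⌝ j) X≋) (combination-combination (⌜ W ⌝ j) ⌜ Z ⌝ (basis L))))
      (≋-trans (A-injective _ (basis L j) (≋-trans (·-combination A (⌜ W ⌝ j) X) (≋-sym
        (≋-trans (A·basis≋ j) (combination-congʳ (⌜ W ⌝ j) basis′≋)))))
      (≋-sym (combination-I j (basis L)))))

    basis′-combination : ∀ i → basis L′ i ≋ combination (⌜ Z ⌝ i) (λ j → A · basis L j)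
    basis′-combination i = ≋-trans (basis′≋ i) (≋-trans (·-cong A (X≋ i)) (·-combination A (⌜ Z ⌝ i) (basis L)))

    ZW≋I : ∀ i → (⌜ Z ⌝ ⊡ ⌜ W ⌝) i ≋ I i
    ZW≋I i = combination-injective (isBasis L′) _ (I i) (≋-trans (≋-sym
      (≋-trans (combination-congʳ (⌜ Z ⌝ i) A·basis≋) (combination-combination (⌜ Z ⌝ i) ⌜ W ⌝ (basis L′))))
      (≋-trans (≋-sym (basis′-combination i)) (≋-sym (combination-I i (basis L′)))))

    -- The image of A contains a basis, namely that of L′; hence y is of the form A · u, and the
    -- left inverse already recovers u.
    A·A⁻¹ : ∀ y → A · (A⁻¹ · y) ≋ y
    A·A⁻¹ y = ≋-trans (·-cong A (≋-trans (·-cong A⁻¹ y≋Au) (A⁻¹·A u))) (≋-sym y≋Au)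
      where
      d : ℝ^ n
      d = proj₁ (IsBasis.spanning (isBasis L′) y)
      u : ℝ^ n
      u = combination d X
      y≋Au : y ≋ A · u
      y≋Au = ≋-trans (proj₂ (IsBasis.spanning (isBasis L′) y))
        (≋-trans (combination-congʳ d basis′≋) (≋-sym (·-combination A d X)))

    -- The scaling of inner products contributes cⁿ, and the change of basis contributes the square
    -- of the determinant of Z, which is 1.
    detL-similar : detL L′ ≈ c ^ n * detL L
    detL-similar = begin
      det (gram (basis L′))                       ≈⟨ det-cong (λ i k → trans (⟨⟩-cong (basis′≋ i) (basis′≋ k)) (scales (X i) (X k))) ⟩
      det (λ i → c • gram X i)                    ≈⟨ det-scale c (gram X) ⟩
      c ^ n * det (gram X)                        ≈⟨ *-congˡ (det-gram X) ⟩
      c ^ n * (det X * det X)                     ≈⟨ *-congˡ (*-cong det-X det-X) ⟩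
      c ^ n * (z * b * (z * b))                   ≈⟨ solve 3 (λ p z b → p :* (z :* b :* (z :* b)) := p :* (z :* z :* (b :* b))) refl (c ^ n) z b ⟩
      c ^ n * (z * z * (b * b))                   ≈⟨ *-congˡ (*-congʳ (unimodular Z W WZ≋I)) ⟩
      c ^ n * (1# * (b * b))                      ≈⟨ *-congˡ (trans (*-identityˡ _) (sym (det-gram (basis L)))) ⟩
      c ^ n * detL L                              ∎
      where
      z = det ⌜ Z ⌝
      b = det (basis L)
      det-X : det X ≈ z * b
      det-X = trans (det-cong X≋) (det-⊡ ⌜ Z ⌝ (basis L))

  min-similar : ∀ {n} (L L′ : Lattice (suc n)) (L∼L′ : Similar L L′) → min L′ ≤ proj₁ (proj₂ L∼L′) * min L
  min-similar L L′ L∼L′ = O.trans (O.reflexive (begin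
      min L′                ≈⟨ *-identityˡ _ ⟨
      1# * min L′           ≈⟨ *-congʳ (*-inverseʳ c (0<⇒≉0 0<c)) ⟨
      c * c ⁻¹ * min L′     ≈⟨ *-assoc _ _ _ ⟩
      c * (c ⁻¹ * min L′)   ∎))
    (*-monoˡ-≤ c (proj₁ 0<c) (min-greatest L (λ x x∈L x≉𝟎 → *-cancelˡ-≤ c 0<c (O.trans
      (O.reflexive (trans (sym (*-assoc _ _ _)) (trans (*-congʳ (*-inverseʳ c (0<⇒≉0 0<c))) (*-identityˡ _))))
      (O.trans (min-lower L′ (Equivalence.from (image (A · x)) (x , x∈L , ≋-refl)) (λ Ax≋𝟎 → x≉𝟎 (A-kernel x Ax≋𝟎)))
        (O.reflexive (scales x x)))))))
    where open Similarity L L′ L∼L′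

  ^-mono : ∀ {x y} n → 0# ≤ x → x ≤ y → x ^ n ≤ y ^ n
  ^-mono zero    0≤x x≤y = O.refl
  ^-mono (suc n) 0≤x x≤y = *-mono-≤ 0≤x (^-nonNeg n (O.trans 0≤x x≤y)) x≤y (^-mono n 0≤x x≤y)

  δ-similar : ∀ {n} (L L′ : Lattice (suc n)) → Similar L L′ → δ L′ ≤ δ L
  δ-similar {n} L L′ L∼L′ = δ-mono L L′ (O.trans
    (O.trans (O.reflexive (*-comm _ _)) (O.trans (*-monoˡ-≤ (detL L) (proj₁ (0<detL L)) (O.trans
      (^-mono (suc n) (0≤min L′) (min-similar L L′ L∼L′)) (O.reflexive (^-distrib-* c (min L) (suc n)))))
    (O.reflexive (solve 3 (λ d p m → d :* (p :* m) := m :* (p :* d)) refl (detL L) (c ^ suc n) (min L ^ suc n)))))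
    (O.reflexive (*-congˡ (sym detL-similar))))
    where open Similarity L L′ L∼L′

  similar-refl : ∀ {n} (L : Lattice n) → Similar L L
  similar-refl L = I , 1# , 0<1 ,
    (λ x y → trans (⟨⟩-cong (λ i → sum-Iˡ i x) (λ i → sum-Iˡ i y)) (sym (*-identityˡ _))) ,
    (λ y → mk⇔ (λ y∈L → y , y∈L , λ i → sym (sum-Iˡ i y))
               (λ { (x , x∈L , y≋) → ∈-resp L (≋-sym (≋-trans y≋ (λ i → sum-Iˡ i x))) x∈L }))

  similar-trans : ∀ {n} (L L′ L″ : Lattice n) → Similar L L′ → Similar L′ L″ → Similar L L″
  similar-trans {n} L L′ L″ (A , c , 0<c , A-scales , A-image) (B , d , 0<d , B-scales , B-image) =
    B ⊡ A , d * c , 0<* 0<d 0<c ,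
    (λ x y → trans (⟨⟩-cong (BA≋ x) (BA≋ y)) (trans (B-scales _ _)
      (trans (*-congˡ (A-scales x y)) (sym (*-assoc d c _))))) ,
    (λ y → mk⇔
      (λ y∈L″ → factor y (Equivalence.to (B-image y) y∈L″))
      (λ { (x , x∈L , y≋) → Equivalence.from (B-image y)
        (A · x , Equivalence.from (A-image (A · x)) (x , x∈L , ≋-refl) , ≋-trans y≋ (BA≋ x)) }))
    where
    BA≋ : ∀ x → (B ⊡ A) · x ≋ B · (A · x)
    BA≋ x i = ⟨combination,⟩ (B i) A x
    factor : ∀ y → (∃[ u ] u ∈ L′ × y ≋ B · u) → ∃[ x ] x ∈ L × y ≋ (B ⊡ A) · x
    factor y (u , u∈L′ , y≋) with Equivalence.to (A-image u) u∈L′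
    ... | x , x∈L , u≋ = x , x∈L , ≋-trans y≋ (≋-trans (·-cong B u≋) (≋-sym (BA≋ x)))

  -- A lattice L₂ close to the similar copy L′ of L₁ is itself a similar copy of
  -- a lattice close to L₁.
  module Transport {n} (L₁ L′ L₂ : Lattice n) (L₁∼L′ : Similar L₁ L′) where
    open Similarity L₁ L′ L₁∼L′

    -- Pulling back by A and recombining with W is the recipe that recovers the basis of L₁ from
    -- that of L′; here it is applied to the basis of L₂.
    m : Fin n → ℝ^ n
    m j = combination (⌜ W ⌝ j) (λ i → A⁻¹ · basis L₂ i)

    A·m≋ : ∀ j → A · m j ≋ combination (⌜ W ⌝ j) (basis L₂)
    A·m≋ j = ≋-trans (·-combination A (⌜ W ⌝ j) (λ i → A⁻¹ · basis L₂ i))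
      (combination-congʳ (⌜ W ⌝ j) (λ i → A·A⁻¹ (basis L₂ i)))

    A·combination-m : ∀ d → A · combination d m ≋ combination (combination d ⌜ W ⌝) (basis L₂)
    A·combination-m d = ≋-trans (·-combination A d m)
      (≋-trans (combination-congʳ d A·m≋) (combination-combination d ⌜ W ⌝ (basis L₂)))

    dWZ≋d : ∀ d → combination (combination d ⌜ W ⌝) ⌜ Z ⌝ ≋ d
    dWZ≋d d = ≋-trans (≋-sym (combination-combination d ⌜ W ⌝ ⌜ Z ⌝))
      (≋-trans (combination-congʳ d WZ≋I) (λ i → sum-Iʳ i d))

    dZW≋d : ∀ d → combination (combination d ⌜ Z ⌝) ⌜ W ⌝ ≋ d
    dZW≋d d = ≋-trans (≋-sym (combination-combination d ⌜ Z ⌝ ⌜ W ⌝))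
      (≋-trans (combination-congʳ d ZW≋I) (λ i → sum-Iʳ i d))

    A·combination-Z : ∀ d → A · combination (combination d ⌜ Z ⌝) m ≋ combination d (basis L₂)
    A·combination-Z d = ≋-trans (A·combination-m (combination d ⌜ Z ⌝)) (combination-congˡ (basis L₂) (dZW≋d d))

    M : Lattice n
    M = record { basis = m ; isBasis = record
      { independent = λ d dm≋𝟎 → ≋-trans (≋-sym (dWZ≋d d)) (λ i → sum-0 {n} (λ k → trans
          (*-congʳ (IsBasis.independent (isBasis L₂) (combination d ⌜ W ⌝)
            (≋-trans (≋-sym (A·combination-m d)) (≋-trans (·-cong A dm≋𝟎) (λ j → sum-0 {n} (λ l → zeroʳ (A j l))))) k))
          (zeroˡ _)))
      ; spanning = λ x → combination (proj₁ (IsBasis.spanning (isBasis L₂) (A · x))) ⌜ Z ⌝ ,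
          A-injective x _ (≋-trans (proj₂ (IsBasis.spanning (isBasis L₂) (A · x)))
            (≋-sym (A·combination-Z (proj₁ (IsBasis.spanning (isBasis L₂) (A · x))))))
      } }

    M∼L₂ : Similar M L₂
    M∼L₂ = A , c , 0<c , scales , λ y → mk⇔
      (λ { (z , y≋) → combination (λ i → fromℤ (z i)) (λ i → combination (⌜ Z ⌝ i) m) ,
        ∈-combination M z _ (λ i → Z i , ≋-refl) ,
        ≋-trans y≋ (≋-sym (≋-trans (·-cong A (combination-combination (λ i → fromℤ (z i)) ⌜ Z ⌝ m))
          (A·combination-Z (λ i → fromℤ (z i))))) })
      (λ { (x , (z , x≋) , y≋) → ∈-resp L₂ (≋-sym (≋-trans y≋ (≋-trans (·-cong A x≋)
          (≋-trans (·-combination A (λ i → fromℤ (z i)) m) (combination-congʳ (λ i → fromℤ (z i)) A·m≋)))))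
        (∈-combination L₂ z _ (λ j → W j , ≋-refl)) })

    -- The recipe for m is linear and sends the basis of L′ to that of L₁, so the distance is
    -- controlled by that between the bases of L₂ and L′.
    m-difference : ∀ j l → m j l - basis L₁ j l ≈
      sum (λ i → ⌜ W ⌝ j i * sum (λ k → A⁻¹ l k * (basis L₂ i k - basis L′ i k)))
    m-difference j l = begin
      m j l - basis L₁ j l     ≈⟨ +-congˡ (-‿cong basis≋) ⟩
      m j l - combination (⌜ W ⌝ j) (λ i → A⁻¹ · basis L′ i) l
        ≈⟨ sym (⟨,-⟩ (⌜ W ⌝ j) (λ i → (A⁻¹ · basis L₂ i) l) (λ i → (A⁻¹ · basis L′ i) l)) ⟩
      sum (λ i → ⌜ W ⌝ j i * ((A⁻¹ · basis L₂ i) l - (A⁻¹ · basis L′ i) l))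
        ≈⟨ sum-cong-≋ {n} (λ i → *-congˡ (sym (⟨,-⟩ (A⁻¹ l) (basis L₂ i) (basis L′ i)))) ⟩
      sum (λ i → ⌜ W ⌝ j i * sum (λ k → A⁻¹ l k * (basis L₂ i k - basis L′ i k))) ∎
      where
      basis≋ : basis L₁ j l ≈ combination (⌜ W ⌝ j) (λ i → A⁻¹ · basis L′ i) l
      basis≋ = trans (sym (A⁻¹·A (basis L₁ j) l)) (trans (·-cong A⁻¹ (A·basis≋ j) l)
        (·-combination A⁻¹ (⌜ W ⌝ j) (basis L′) l))

  transport : ∀ {n} (L₁ L′ : Lattice n) → Similar L₁ L′ → ∀ {t} → 0# < t → ∃[ η ] 0# < η ×
    (∀ L₂ → (∀ i k → basis L₂ i k - basis L′ i k ≼ η) →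
      Σ (Lattice n) λ M → (∀ j l → basis M j l - basis L₁ j l ≼ t) × Similar M L₂)
  transport {n} L₁ L′ L₁∼L′ {t} 0<t = η , 0<η , λ L₂ close → M L₂ ,
    (λ j l → ≼-resp (≼-weaken
      (≼-sum {n} (λ i → ≼-* (w-bound j i) (≼-sum {n} (λ k → ≼-* (β-bound l k) (close i k)))))
      (O.trans (O.reflexive (begin
        sum {n} (λ i → w * sum {n} (λ k → β * η))   ≈⟨ trans (sum-const n _) (*-congˡ (*-congˡ (sum-const n _))) ⟩
        fromℕ n * (w * (fromℕ n * (β * η)))         ≈⟨ solve 4 (λ n w b e → n :* (w :* (n :* (b :* e))) := n :* w :* n :* b :* e) refl (fromℕ n) w β η ⟩
        K * η                                       ∎)) Kη≤t)) (m-difference L₂ j l) refl) ,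
    M∼L₂ L₂
    where
    open Similarity L₁ L′ L₁∼L′ using (W; A⁻¹)
    M : Lattice n → Lattice n
    M L₂ = Transport.M L₁ L′ L₂ L₁∼L′
    M∼L₂ : ∀ L₂ → Similar (M L₂) L₂
    M∼L₂ L₂ = Transport.M∼L₂ L₁ L′ L₂ L₁∼L′
    m-difference : ∀ L₂ j l → basis (M L₂) j l - basis L₁ j l ≈
      sum (λ i → ⌜ W ⌝ j i * sum (λ k → A⁻¹ l k * (basis L₂ i k - basis L′ i k)))
    m-difference L₂ = Transport.m-difference L₁ L′ L₂ L₁∼L′
    W-bounded = bounded-matrix ⌜ W ⌝
    A⁻¹-bounded = bounded-matrix A⁻¹
    w β K : ℝ
    w = proj₁ W-bounded
    β = proj₁ A⁻¹-bounded
    -- One factor n w for the sum against W, one factor n β for the sum against `A⁻¹`.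
    K = fromℕ n * w * fromℕ n * β
    w-bound : ∀ i j → ⌜ W ⌝ i j ≼ w
    w-bound = proj₂ (proj₂ W-bounded)
    β-bound : ∀ i j → A⁻¹ i j ≼ β
    β-bound = proj₂ (proj₂ A⁻¹-bounded)
    small : ∃[ η ] 0# < η × K * η ≤ t
    small = scaleBelow (*-nonNeg (*-nonNeg (*-nonNeg (0≤fromℕ n) (proj₁ (proj₂ W-bounded))) (0≤fromℕ n))
      (proj₁ (proj₂ A⁻¹-bounded))) 0<t
    η = proj₁ small
    0<η : 0# < η
    0<η = proj₁ (proj₂ small)
    Kη≤t : K * η ≤ t
    Kη≤t = proj₂ (proj₂ small)

  -- The similarity classes of the lattices at distance less than ε from L; the
  -- slack s makes the defining condition visibly open.
  Neighbourhood : ∀ {n} → Lattice n → ℝ → Lattice n → Set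
  Neighbourhood {n} L ε L′ = Σ (Lattice n) λ L₁ → ∃[ s ] 0# < s ×
    (∀ i j → basis L₁ i j - basis L i j ≼ ε - s) × Similar L₁ L′

  half : ℝ → ℝ
  half x = 2# ⁻¹ * x

  half+half : ∀ x → half x + half x ≈ x
  half+half x = begin
    half x + half x    ≈⟨ solve 2 (λ h x → h :* x :+ h :* x := (con (+ 1) :+ con (+ 1)) :* h :* x) refl (2# ⁻¹) x ⟩
    2# * 2# ⁻¹ * x     ≈⟨ *-congʳ (*-inverseʳ 2# (0<⇒≉0 (<-≤-trans 0<1 (≤-by 1# 0≤1 refl)))) ⟩
    1# * x             ≈⟨ *-identityˡ x ⟩
    x                  ∎

  0<half : ∀ {x} → 0# < x → 0# < half x
  0<half 0<x = 0<* (0<⁻¹ (<-≤-trans 0<1 (≤-by 1# 0≤1 refl))) 0<x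

  neighbourhood-isOpen : ∀ {n} (L : Lattice n) ε → IsOpen (Neighbourhood L ε)
  neighbourhood-isOpen {n} L ε = record
    { invariant = λ { L′ L″ L′∼L″ (L₁ , s , 0<s , close , L₁∼L′) →
        L₁ , s , 0<s , close , similar-trans L₁ L′ L″ L₁∼L′ L′∼L″ }
    ; isOpen = ball
    }
    where
    ball : ∀ L′ → Neighbourhood L ε L′ → ∃[ η ] 0# < η ×
      (∀ L₂ → (∀ i j → Close η (basis L′ i j) (basis L₂ i j)) → Neighbourhood L ε L₂)
    ball L′ (L₁ , s , 0<s , close , L₁∼L′) = proj₁ moved , proj₁ (proj₂ moved) ,
      λ L₂ near → conclude L₂ (proj₂ (proj₂ moved) L₂ (λ i k → close⇒≼ (near i k)))
      where
      -- Half of the slack pays for the move from L₁ to M; the other half is the slack left for M.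
      moved : ∃[ η ] 0# < η × (∀ L₂ → (∀ i k → basis L₂ i k - basis L′ i k ≼ η) →
        Σ (Lattice n) λ M → (∀ j l → basis M j l - basis L₁ j l ≼ half s) × Similar M L₂)
      moved = transport L₁ L′ L₁∼L′ (0<half 0<s)
      conclude : ∀ L₂ → (Σ (Lattice n) λ M → (∀ j l → basis M j l - basis L₁ j l ≼ half s) × Similar M L₂) →
                 Neighbourhood L ε L₂
      conclude L₂ (M , M-close , M∼L₂) = M , half s , 0<half 0<s , (λ i j → ≼-resp
        (≼-+ (M-close i j) (close i j))
        (solve 3 (λ m l k → m :- k := (m :- l) :+ (l :- k)) refl (basis M i j) (basis L₁ i j) (basis L i j))
        (trans (solve 2 (λ e h → e :- h := h :+ (e :- (h :+ h))) refl ε (half s))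
          (+-congˡ (+-congˡ (-‿cong (half+half s)))))) , M∼L₂

  neighbourhood-centre : ∀ {n} (L : Lattice n) {ε} → 0# < ε → Neighbourhood L ε L
  neighbourhood-centre L {ε} 0<ε = L , ε , 0<ε ,
    (λ i j → ≼-resp (≼-refl O.refl) (-‿inverseʳ _) (-‿inverseʳ ε)) , similar-refl L

  -- Every lattice of the neighbourhood is similar to some L₁ in the ball of bases, and its density
  -- is at most that of L₁.
  extreme : ∀ {n} (L : Lattice (suc n)) {ε} → 0# < ε →
    (∀ L₁ → (∀ i j → basis L₁ i j - basis L i j ≼ ε) → δ L₁ ≤ δ L) → Extreme L
  extreme L {ε} 0<ε local = Neighbourhood L ε , neighbourhood-isOpen L ε , neighbourhood-centre L 0<ε ,
    λ { L′ (L₁ , s , 0<s , close , L₁∼L′) → O.trans (δ-similar L₁ L′ L₁∼L′)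
      (local L₁ (λ i j → ≼-weaken (close i j) (≤-by s (proj₁ 0<s)
        (solve 2 (λ e s → e := e :- s :+ s) refl ε s)))) }

  -- Polynomial functions on the sphere

  -- The bound makes this class of functions closed under multiplication.
  record Regular {n} (g : ℝ^ n → ℝ) : Set where
    field
      bound lipschitz : ℝ
      0≤lipschitz     : 0# ≤ lipschitz
      isBounded       : ∀ (x : Sphere n) → g (point x) ≼ bound
      isLipschitz     : ∀ (x y : Sphere n) {η} → (∀ i → point y i - point x i ≼ η) →
                        g (point y) - g (point x) ≼ lipschitz * η

  open Regular

  regular-+ : ∀ {n} {f g : ℝ^ n → ℝ} → Regular f → Regular g → Regular (λ x → f x + g x)
  regular-+ {f = f} {g} rf rg = record
    { bound       = bound rf + bound rg
    ; lipschitz   = lipschitz rf + lipschitz rg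
    ; 0≤lipschitz = 0≤+ (0≤lipschitz rf) (0≤lipschitz rg)
    ; isBounded   = λ x → ≼-+ (isBounded rf x) (isBounded rg x)
    ; isLipschitz = λ x y {η} close → ≼-resp (≼-+ (isLipschitz rf x y close) (isLipschitz rg x y close))
        (solve 4 (λ a b c d → a :+ b :- (c :+ d) := a :- c :+ (b :- d)) refl (f (point y)) (g (point y)) (f (point x)) (g (point x)))
        (distribʳ η (lipschitz rf) (lipschitz rg))
    }

  -- The point e is what makes both bounds nonnegative; over an empty sphere they would be
  -- arbitrary.
  regular-* : ∀ {n} {f g : ℝ^ n → ℝ} → Sphere n → Regular f → Regular g → Regular (λ x → f x * g x)
  regular-* {f = f} {g} e rf rg = record
    { bound       = bound rf * bound rg
    ; lipschitz   = bound rf * lipschitz rg + bound rg * lipschitz rf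
    ; 0≤lipschitz = 0≤+ (*-nonNeg (≼⇒0≤ (isBounded rf e)) (0≤lipschitz rg)) (*-nonNeg (≼⇒0≤ (isBounded rg e)) (0≤lipschitz rf))
    ; isBounded   = λ x → ≼-* (isBounded rf x) (isBounded rg x)
    ; isLipschitz = λ x y {η} close → ≼-resp
        (≼-+ (≼-* (isBounded rf y) (isLipschitz rg x y close)) (≼-* (isBounded rg x) (isLipschitz rf x y close)))
        (solve 4 (λ a b c d → a :* b :- c :* d := a :* (b :- d) :+ d :* (a :- c)) refl (f (point y)) (g (point y)) (f (point x)) (g (point x)))
        (solve 5 (λ b k d l e → (b :* k :+ d :* l) :* e := b :* (k :* e) :+ d :* (l :* e)) refl
          (bound rf) (lipschitz rg) (bound rg) (lipschitz rf) η)
    }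

  regular-const : ∀ {n} c → Regular {n} (λ _ → c)
  regular-const c = record
    { bound       = proj₁ ≼-∣ c ∣
    ; lipschitz   = 0#
    ; 0≤lipschitz = O.refl
    ; isBounded   = λ _ → proj₁ (proj₂ ≼-∣ c ∣)
    ; isLipschitz = λ _ _ _ → ≼-resp (≼-refl O.refl) (-‿inverseʳ c) (zeroˡ _)
    }

  regular-coordinate : ∀ {n} (i : Fin n) → Regular (λ x → x i)
  regular-coordinate i = record
    { bound       = 1#
    ; lipschitz   = 1#
    ; 0≤lipschitz = 0≤1
    ; isBounded   = λ x → unit-≼1 {x = point x} (O.reflexive (isUnit x)) i
    ; isLipschitz = λ _ _ close → ≼-resp (close i) refl (*-identityˡ _)
    }

  regular-resp : ∀ {n} {f g : ℝ^ n → ℝ} → (∀ x → g x ≈ f x) → Regular f → Regular g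
  regular-resp g≈f rf = record
    { bound       = bound rf
    ; lipschitz   = lipschitz rf
    ; 0≤lipschitz = 0≤lipschitz rf
    ; isBounded   = λ x → ≼-resp (isBounded rf x) (g≈f (point x)) refl
    ; isLipschitz = λ x y close → ≼-resp (isLipschitz rf x y close)
        (+-cong (g≈f (point y)) (-‿cong (g≈f (point x)))) refl
    }

  -- Passes from the weak estimates of `_≼_` to the strict ones of `Close`, at the cost of half of
  -- ε.
  x≤y+half⇒x<y+ : ∀ {x y ε} → 0# < ε → x ≤ y + half ε → x < y + ε
  x≤y+half⇒x<y+ {x} {y} {ε} 0<ε x≤ = ≤-<-trans x≤
    (≤-by (half ε) (proj₁ (0<half 0<ε)) eq ,
     λ same → proj₂ (0<half 0<ε) (begin
      0#                                        ≈⟨ -‿inverseʳ (y + half ε) ⟨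
      y + half ε - (y + half ε)                 ≈⟨ +-congʳ (trans same eq) ⟩
      y + half ε + half ε - (y + half ε)        ≈⟨ solve 2 (λ y h → y :+ h :+ h :- (y :+ h) := h) refl y (half ε) ⟩
      half ε                                    ∎))
    where
    eq : y + ε ≈ y + half ε + half ε
    eq = trans (+-congˡ (sym (half+half ε))) (sym (+-assoc _ _ _))

  regular⇒continuous : ∀ {n} {g : ℝ^ n → ℝ} → Regular g → ContinuousFunction n
  regular⇒continuous {n} {g} rg = record
    { fun        = λ x → g (point x)
    ; continuous = λ x ε 0<ε → proj₁ (small 0<ε) , proj₁ (proj₂ (small 0<ε)) , λ y close →
        close-from 0<ε (≼-weaken (isLipschitz rg x y (λ i → close⇒≼ (close i))) (proj₂ (proj₂ (small 0<ε))))
    }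
    where
    small : ∀ {ε} → 0# < ε → ∃[ η ] 0# < η × lipschitz rg * η ≤ half ε
    small 0<ε = scaleBelow (0≤lipschitz rg) (0<half 0<ε)
    close-from : ∀ {ε x y} → 0# < ε → y - x ≼ half ε → Close ε x y
    close-from {ε} {x} {y} 0<ε (p , q) =
      x≤y+half⇒x<y+ 0<ε (≤-by _ q (solve 3 (λ x y h → y :+ h := x :+ (h :+ (y :- x))) refl x y (half ε))) ,
      x≤y+half⇒x<y+ 0<ε (≤-by _ p (solve 3 (λ x y h → x :+ h := y :+ (h :- (y :- x))) refl x y (half ε)))

  -- Monomials as homogeneous polynomials

  monomial : ∀ {n} → List (Fin n) → ℝ^ n → ℝ
  monomial []       x = 1#
  monomial (i ∷ˡ is) x = x i * monomial is x

  regular-monomial : ∀ {n} → Sphere n → (is : List (Fin n)) → Regular (monomial is)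
  regular-monomial e []       = regular-const 1#
  regular-monomial e (i ∷ˡ is) = regular-* e (regular-coordinate i) (regular-monomial e is)

  single : ∀ {n} → Fin n → Vector ℕ n
  single zero    zero    = 1
  single zero    (suc j) = 0
  single (suc i) zero    = 0
  single (suc i) (suc j) = single i j

  -- Lists of coordinates suit moments with arbitrary, possibly repeated indices; the multiplicities
  -- in the list are the exponent vector that `HomogeneousPolynomial` asks for.
  exponents : ∀ {n} → List (Fin n) → Vector ℕ n
  exponents []       m = 0
  exponents (i ∷ˡ is) m = single i m ℕ.+ exponents is m

  degree : ∀ {n} → Vector ℕ n → ℕ
  degree = foldr ℕ._+_ 0

  degree-0 : ∀ n → degree {n} (λ _ → 0) ≡ 0
  degree-0 zero    = ≡.refl
  degree-0 (suc n) = degree-0 n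

  degree-single : ∀ {n} (i : Fin n) → degree (single i) ≡ 1
  degree-single {suc n} zero    = ≡.cong suc (degree-0 n)
  degree-single {suc n} (suc i) = degree-single i

  degree-+ : ∀ {n} (α β : Vector ℕ n) → degree (λ m → α m ℕ.+ β m) ≡ degree α ℕ.+ degree β
  degree-+ {zero}  α β = ≡.refl
  degree-+ {suc n} α β = ≡.trans (≡.cong (α zero ℕ.+ β zero ℕ.+_) (degree-+ (λ m → α (suc m)) (λ m → β (suc m))))
    (+-interchange (α zero) (β zero) (degree (λ m → α (suc m))) (degree (λ m → β (suc m))))

  degree-exponents : ∀ {n} (is : List (Fin n)) → degree (exponents is) ≡ length is
  degree-exponents {n} []   = degree-0 n
  degree-exponents (i ∷ˡ is) = ≡.trans (degree-+ (single i) (exponents is))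
    (≡.cong₂ ℕ._+_ (degree-single i) (degree-exponents is))

  product-1 : ∀ n → product {n} (λ _ → 1#) ≈ 1#
  product-1 zero    = refl
  product-1 (suc n) = trans (*-identityˡ _) (product-1 n)

  product-single : ∀ {n} (x : ℝ^ n) i → product (λ m → x m ^ single i m) ≈ x i
  product-single {suc n} x zero    = trans (*-cong (*-identityʳ _) (product-1 n)) (*-identityʳ _)
  product-single {suc n} x (suc i) = trans (*-identityˡ _) (product-single (λ m → x (suc m)) i)

  product-exponents : ∀ {n} (x : ℝ^ n) is → product (λ m → x m ^ exponents is m) ≈ monomial is x
  product-exponents {n} x []       = product-1 n
  product-exponents {n} x (i ∷ˡ is) = begin
    product (λ m → x m ^ (single i m ℕ.+ exponents is m))
      ≈⟨ Product.sum-cong-≋ {n} (λ m → ^-homo-* (x m) (single i m) (exponents is m)) ⟩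
    product (λ m → x m ^ single i m * x m ^ exponents is m)
      ≈⟨ Product.∑-distrib-+ {n} (λ m → x m ^ single i m) (λ m → x m ^ exponents is m) ⟩
    product (λ m → x m ^ single i m) * product (λ m → x m ^ exponents is m)
      ≈⟨ *-cong (product-single x i) (product-exponents x is) ⟩
    x i * monomial is x ∎

  monomialPolynomial : ∀ {n} (is : List (Fin n)) → HomogeneousPolynomial n (length is)
  monomialPolynomial is = (1# , exponents is , degree-exponents is) ∷ˡ []

  eval-monomial : ∀ {n} (is : List (Fin n)) x → eval (monomialPolynomial is) x ≈ monomial is x
  eval-monomial is x = trans (+-identityʳ _) (trans (*-identityˡ _) (product-exponents x is))

  -- Reflections

  ⟨,•⟩ : ∀ {n} a (x v : ℝ^ n) → ⟨ x , a • v ⟩ ≈ a * ⟨ x , v ⟩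
  ⟨,•⟩ {n} a x v = trans
    (sum-cong-≋ {n} (λ i → solve 3 (λ a x v → x :* (a :* v) := a :* (x :* v)) refl a (x i) (v i)))
    (sym (*-distribˡ-sum {n} a (λ i → x i * v i)))

  -- The reflection in the hyperplane orthogonal to v when k is 2 / ⟨ v , v ⟩; keeping k as a
  -- parameter postpones the division.
  reflection : ∀ {n} → ℝ → ℝ^ n → Matrix n
  reflection k v i j = I i j - k * v i * v j

  reflection-· : ∀ {n} k (v x : ℝ^ n) → reflection k v · x ≋ (λ i → x i - k * ⟨ v , x ⟩ * v i)
  reflection-· {n} k v x i = begin
    ⟨ (λ j → I i j - k * v i * v j) , x ⟩        ≈⟨ ⟨⟩-comm (reflection k v i) x ⟩
    ⟨ x , (λ j → I i j - k * v i * v j) ⟩        ≈⟨ ⟨,-⟩ x (I i) ((k * v i) • v) ⟩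
    ⟨ x , I i ⟩ - ⟨ x , (k * v i) • v ⟩          ≈⟨ +-cong (trans (⟨⟩-comm x (I i)) (sum-Iˡ i x)) (-‿cong (trans (⟨,•⟩ (k * v i) x v) (*-congˡ (⟨⟩-comm x v)))) ⟩
    x i - k * v i * ⟨ v , x ⟩                    ≈⟨ +-congˡ (-‿cong (solve 3 (λ k a b → k :* a :* b := k :* b :* a) refl k (v i) ⟨ v , x ⟩)) ⟩
    x i - k * ⟨ v , x ⟩ * v i                    ∎

  reflection-orthogonal : ∀ {n} k (v : ℝ^ n) → k * ⟨ v , v ⟩ ≈ 2# → Orthogonal (reflection k v)
  reflection-orthogonal {n} k v kvv≈2 x y = begin
    ⟨ reflection k v · x , reflection k v · y ⟩      ≈⟨ ⟨⟩-cong (reflection-· k v x) (reflection-· k v y) ⟩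
    ⟨ x′ , (λ i → y i - b * v i) ⟩                   ≈⟨ ⟨,-⟩ x′ y (b • v) ⟩
    ⟨ x′ , y ⟩ - ⟨ x′ , b • v ⟩                      ≈⟨ +-cong (expand y) (-‿cong (trans (⟨,•⟩ b x′ v) (*-congˡ (expand v)))) ⟩
    (⟨ x , y ⟩ - a * ⟨ v , y ⟩) - b * (⟨ x , v ⟩ - a * ⟨ v , v ⟩)
      ≈⟨ +-congˡ (-‿cong (*-congˡ (+-congʳ (⟨⟩-comm x v)))) ⟩
    (⟨ x , y ⟩ - k * p * q) - k * q * (p - k * p * ⟨ v , v ⟩)
      ≈⟨ solve 5 (λ s k p q w → (s :- k :* p :* q) :- k :* q :* (p :- k :* p :* w)
           := s :+ k :* p :* q :* (k :* w :- (con (+ 1) :+ con (+ 1)))) refl ⟨ x , y ⟩ k p q ⟨ v , v ⟩ ⟩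
    ⟨ x , y ⟩ + k * p * q * (k * ⟨ v , v ⟩ - 2#)     ≈⟨ +-congˡ (trans (*-congˡ (x≈y⇒x-y≈0 kvv≈2)) (zeroʳ _)) ⟩
    ⟨ x , y ⟩ + 0#                                   ≈⟨ +-identityʳ _ ⟩
    ⟨ x , y ⟩                                        ∎
    where
    p q a b : ℝ
    p = ⟨ v , x ⟩
    q = ⟨ v , y ⟩
    a = k * p
    b = k * q
    x′ : ℝ^ n
    x′ i = x i - a * v i
    expand : ∀ z → ⟨ x′ , z ⟩ ≈ ⟨ x , z ⟩ - a * ⟨ v , z ⟩
    expand z = trans (⟨⟩-comm x′ z) (trans (⟨,-⟩ z x (a • v))
      (+-cong (⟨⟩-comm z x) (-‿cong (trans (⟨,•⟩ a z v) (*-congˡ (⟨⟩-comm z v))))))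

  I-same : ∀ {n} (i : Fin n) → I i i ≈ 1#
  I-same zero    = refl
  I-same (suc i) = I-same i

  I-other : ∀ {n} {i j : Fin n} → ¬ (i ≡ j) → I i j ≈ 0#
  I-other {i = zero}  {zero}  i≢j = ⊥-elim (i≢j ≡.refl)
  I-other {i = zero}  {suc j} i≢j = refl
  I-other {i = suc i} {zero}  i≢j = refl
  I-other {i = suc i} {suc j} i≢j = I-other (λ i≡j → i≢j (≡.cong suc i≡j))

  ∑∑ : ∀ {n} → (Fin n → Fin n → ℝ) → ℝ
  ∑∑ f = sum λ i → sum λ j → f i j

  ∑∑-cong : ∀ {n} {f g : Fin n → Fin n → ℝ} → (∀ i j → f i j ≈ g i j) → ∑∑ f ≈ ∑∑ g
  ∑∑-cong {n} f≈g = sum-cong-≋ {n} (λ i → sum-cong-≋ {n} (f≈g i))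

  ∑∑-+ : ∀ {n} (f g : Fin n → Fin n → ℝ) → ∑∑ (λ i j → f i j + g i j) ≈ ∑∑ f + ∑∑ g
  ∑∑-+ {n} f g = trans (sum-cong-≋ {n} (λ i → ∑-distrib-+ {n} (f i) (g i)))
    (∑-distrib-+ {n} (λ i → sum (f i)) (λ i → sum (g i)))

  *-∑∑ : ∀ {n} c (f : Fin n → Fin n → ℝ) → c * ∑∑ f ≈ ∑∑ (λ i j → c * f i j)
  *-∑∑ {n} c f = trans (*-distribˡ-sum {n} c (λ i → sum (f i))) (sum-cong-≋ {n} (λ i → *-distribˡ-sum {n} c (f i)))

  ∑∑-* : ∀ {n} c (f : Fin n → Fin n → ℝ) → ∑∑ f * c ≈ ∑∑ (λ i j → f i j * c)
  ∑∑-* {n} c f = trans (*-distribʳ-sum {n} c (λ i → sum (f i))) (sum-cong-≋ {n} (λ i → *-distribʳ-sum {n} c (f i)))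

  ∑∑-I : ∀ {n} (H : Matrix n) → ∑∑ (λ i j → H i j * I i j) ≈ tr H
  ∑∑-I {n} H = sum-cong-≋ {n} (λ i → trans (⟨⟩-comm (H i) (I i)) (sum-Iˡ i (H i)))

  ∑∑-II : ∀ {n} (H : Matrix n) i j → ∑∑ (λ k l → H k l * (I i k * I j l)) ≈ H i j
  ∑∑-II {n} H i j = trans (sum-cong-≋ {n} (λ k → trans
      (sum-cong-≋ {n} (λ l → solve 3 (λ h a b → h :* (a :* b) := a :* (b :* h)) refl (H k l) (I i k) (I j l)))
      (trans (sym (*-distribˡ-sum {n} (I i k) (λ l → I j l * H k l))) (*-congˡ (sum-Iˡ j (H k))))))
    (sum-Iˡ i (λ k → H k j))

  -- Moments of spherical designs

  quadratic : ∀ {n} → Matrix n → ℝ^ n → ℝ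
  quadratic H x = sum λ i → sum λ j → H i j * (x i * x j)

  3# 4# 5# 6# : ℝ
  3# = 1# + 2#
  4# = 1# + 3#
  5# = 1# + 4#
  6# = 1# + 5#

  0<1+ : ∀ {x} → 0# ≤ x → 0# < 1# + x
  0<1+ {x} 0≤x = <-≤-trans 0<1 (≤-by x 0≤x refl)

  0<2 : 0# < 2#
  0<2 = 0<1+ 0≤1
  0<3 : 0# < 3#
  0<3 = 0<1+ 0≤2
  0<4 : 0# < 4#
  0<4 = 0<1+ (proj₁ 0<3)
  0<5 : 0# < 5#
  0<5 = 0<1+ (proj₁ 0<4)

  module Design {n} (μ : InvariantMeasure n) (X : FiniteSubset n) (D : IsSphericalDesign μ 4 X) where

    open IsSphericalDesign D

    P : Fin (size X) → ℝ^ n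
    P k = point (element X k)

    P-unit : ∀ k → ⟨ P k , P k ⟩ ≈ 1#
    P-unit k = isUnit (element X k)

    N⁻¹ : ℝ
    N⁻¹ = fromℕ (size X) ⁻¹

    mean : (ℝ^ n → ℝ) → ℝ
    mean g = N⁻¹ * sum (λ k → g (P k))

    0<N : 0# < fromℕ (size X)
    0<N = nonZero⇒pos (size X) nonempty
      where
      nonZero⇒pos : ∀ m → NonZero m → 0# < fromℕ m
      nonZero⇒pos (suc m) _ = 0<fromℕ m

    someIndex : Fin (size X)
    someIndex = first (size X) nonempty
      where
      first : ∀ m → NonZero m → Fin m
      first (suc m) _ = zero

    somePoint : Sphere n
    somePoint = element X someIndex

    mean-cong : ∀ f g → (∀ k → f (P k) ≈ g (P k)) → mean f ≈ mean g
    mean-cong f g f≈g = *-congˡ (sum-cong-≋ {size X} f≈g)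

    mean-+ : ∀ f g → mean (λ x → f x + g x) ≈ mean f + mean g
    mean-+ f g = trans (*-congˡ (∑-distrib-+ {size X} (λ k → f (P k)) (λ k → g (P k)))) (distribˡ _ _ _)

    mean-* : ∀ c f → mean (λ x → c * f x) ≈ c * mean f
    mean-* c f = trans (*-congˡ (sym (*-distribˡ-sum {size X} c (λ k → f (P k)))))
      (solve 3 (λ a c s → a :* (c :* s) := c :* (a :* s)) refl N⁻¹ c (sum (λ k → f (P k))))

    mean-sum : ∀ {m} (f : Fin m → ℝ^ n → ℝ) → mean (λ x → sum (λ i → f i x)) ≈ sum (λ i → mean (f i))
    mean-sum {m} f = trans (*-congˡ (∑-comm {size X} {m} (λ k i → f i (P k)))) (*-distribˡ-sum {m} N⁻¹ (λ i → sum (λ k → f i (P k))))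

    mean-const : ∀ c → mean (λ _ → c) ≈ c
    mean-const c = begin
      N⁻¹ * sum {size X} (λ _ → c)     ≈⟨ *-congˡ (sum-const (size X) c) ⟩
      N⁻¹ * (fromℕ (size X) * c)       ≈⟨ *-assoc _ _ _ ⟨
      N⁻¹ * fromℕ (size X) * c         ≈⟨ *-congʳ (*-inverseˡ _ (0<⇒≉0 0<N)) ⟩
      1# * c                           ≈⟨ *-identityˡ c ⟩
      c                                ∎

    mean-nonNeg : ∀ f → (∀ k → 0# ≤ f (P k)) → 0# ≤ mean f
    mean-nonNeg f 0≤f = *-nonNeg (0≤⁻¹ 0<N) (sum-nonNeg 0≤f)

    -- The design property speaks of single homogeneous polynomials. This class is closed under sums
    -- and multiples, and `regular` supplies the continuous representatives to which linearity and
    -- invariance of `∫ μ` apply.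
    record Averaged (g : ℝ^ n → ℝ) : Set where
      field
        regular   : Regular g
        integral  : ∀ F → (∀ x → fun F x ≈ g (point x)) → mean g ≈ ∫ μ F

    open Averaged

    averaged-resp : ∀ {f g} → (∀ x → g x ≈ f x) → Averaged f → Averaged g
    averaged-resp {f} {g} g≈f af = record
      { regular  = regular-resp g≈f (regular af)
      ; integral = λ F F≈g → trans (mean-cong g f (λ k → g≈f (P k)))
          (integral af F (λ x → trans (F≈g x) (g≈f (point x))))
      }

    averaged-+ : ∀ {f g} → Averaged f → Averaged g → Averaged (λ x → f x + g x)
    averaged-+ {f} {g} af ag = record
      { regular  = regular-+ (regular af) (regular ag)
      ; integral = λ H H≈ → trans (mean-+ f g) (trans
          (+-cong (integral af F (λ _ → refl)) (integral ag G (λ _ → refl)))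
          (sym (additive μ F G H H≈)))
      }
      where
      F G : ContinuousFunction n
      F = regular⇒continuous (regular af)
      G = regular⇒continuous (regular ag)

    averaged-* : ∀ {f} c → Averaged f → Averaged (λ x → c * f x)
    averaged-* {f} c af = record
      { regular  = regular-* somePoint (regular-const c) (regular af)
      ; integral = λ G G≈ → trans (mean-* c f) (trans (*-congˡ (integral af F (λ _ → refl)))
          (sym (scalar μ c F G G≈)))
      }
      where
      F : ContinuousFunction n
      F = regular⇒continuous (regular af)

    averaged-monomial : ∀ (is : List (Fin n)) → length is ℕ.≤ 4 → Averaged (monomial is)
    averaged-monomial is ≤4 = record
      { regular  = regular-monomial somePoint is
      ; integral = λ F F≈ → trans (mean-cong (monomial is) (eval (monomialPolynomial is)) (λ k → sym (eval-monomial is (P k))))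
          (average (length is) ≤4 (monomialPolynomial is) F (λ x → trans (F≈ x) (sym (eval-monomial is (point x)))))
      }

    -- The points of X need not be permuted by the reflection. Invariance holds for the integrals
    -- and reaches the means because both functions are averaged correctly.
    mean-reflection : ∀ {f g} → Averaged f → Averaged g → (∀ {x y} → x ≋ y → f x ≈ f y) →
      ∀ k v → k * ⟨ v , v ⟩ ≈ 2# → (∀ x → g x ≈ f (λ i → x i - k * ⟨ v , x ⟩ * v i)) → mean g ≈ mean f
    mean-reflection af ag f-cong k v kvv≈2 g≈ = trans (integral ag G (λ _ → refl)) (trans
      (invariant μ (reflection k v) (reflection-orthogonal k v kvv≈2) F G
        (λ x y y≋ → trans (g≈ (point x)) (f-cong (≋-sym (≋-trans y≋ (reflection-· k v (point x)))))))
      (sym (integral af F (λ _ → refl))))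
      where
      F G : ContinuousFunction n
      F = regular⇒continuous (regular af)
      G = regular⇒continuous (regular ag)

    x₂ : Fin n → Fin n → ℝ^ n → ℝ
    x₂ i j x = x i * x j

    x₄ : Fin n → Fin n → Fin n → Fin n → ℝ^ n → ℝ
    x₄ i j k l x = x i * x j * (x k * x l)

    averaged-x₂ : ∀ i j → Averaged (x₂ i j)
    averaged-x₂ i j = averaged-resp (λ x → *-congˡ (sym (*-identityʳ _)))
      (averaged-monomial (i ∷ˡ j ∷ˡ []) (ℕ.s≤s (ℕ.s≤s ℕ.z≤n)))

    averaged-x₄ : ∀ i j k l → Averaged (x₄ i j k l)
    averaged-x₄ i j k l = averaged-resp
      (λ x → solve 4 (λ a b c d → a :* b :* (c :* d) := a :* (b :* (c :* (d :* con (+ 1))))) refl (x i) (x j) (x k) (x l))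
      (averaged-monomial (i ∷ˡ j ∷ˡ k ∷ˡ l ∷ˡ []) (ℕ.s≤s (ℕ.s≤s (ℕ.s≤s (ℕ.s≤s ℕ.z≤n)))))

    x₂-cong : ∀ i j {x y} → x ≋ y → x₂ i j x ≈ x₂ i j y
    x₂-cong i j x≋y = *-cong (x≋y i) (x≋y j)

    x₄-cong : ∀ i j k l {x y} → x ≋ y → x₄ i j k l x ≈ x₄ i j k l y
    x₄-cong i j k l x≋y = *-cong (x₂-cong i j x≋y) (x₂-cong k l x≋y)

    M₂ : Fin n → Fin n → ℝ
    M₂ i j = mean (x₂ i j)

    M₄ : Fin n → Fin n → Fin n → Fin n → ℝ
    M₄ i j k l = mean (x₄ i j k l)

    -- The sign by which the reflection in the p-th coordinate hyperplane
    -- multiplies the m-th coordinate.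
    σ : Fin n → Fin n → ℝ
    σ p m = 1# - 2# * I p m

    σ-same : ∀ p → σ p p ≈ - 1#
    σ-same p = trans (+-congˡ (-‿cong (*-congˡ (I-same p))))
      (solve 0 (con (+ 1) :- (con (+ 1) :+ con (+ 1)) :* con (+ 1) := :- con (+ 1)) refl)

    σ-other : ∀ {p m} → ¬ (p ≡ m) → σ p m ≈ 1#
    σ-other p≢m = trans (+-congˡ (-‿cong (*-congˡ (I-other p≢m))))
      (solve 0 (con (+ 1) :- (con (+ 1) :+ con (+ 1)) :* con (+ 0) := con (+ 1)) refl)

    flip-norm : ∀ p → 2# * ⟨ I p , I p ⟩ ≈ 2#
    flip-norm p = trans (*-congˡ (trans (sum-Iˡ {n} p (I p)) (I-same p))) (*-identityʳ 2#)

    flip-coordinate : ∀ p (x : ℝ^ n) m → x m - 2# * ⟨ I p , x ⟩ * I p m ≈ σ p m * x m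
    flip-coordinate p x m = begin
      x m - 2# * ⟨ I p , x ⟩ * I p m    ≈⟨ +-congˡ (-‿cong (*-congʳ (*-congˡ (sum-Iˡ p x)))) ⟩
      x m - 2# * x p * I p m            ≈⟨ +-congˡ (-‿cong (trans (*-assoc _ _ _) (*-congˡ x-I))) ⟩
      x m - 2# * (x m * I p m)          ≈⟨ solve 3 (λ t x i → x :- t :* (x :* i) := (con (+ 1) :- t :* i) :* x) refl 2# (x m) (I p m) ⟩
      σ p m * x m                       ∎
      where
      x-I : x p * I p m ≈ x m * I p m
      x-I with p ≟ m
      ... | yes ≡.refl = refl
      ... | no  p≢m    = trans (trans (*-congˡ (I-other p≢m)) (zeroʳ _)) (sym (trans (*-congˡ (I-other p≢m)) (zeroʳ _)))

    M₂-flip : ∀ p i j → σ p i * σ p j * M₂ i j ≈ M₂ i j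
    M₂-flip p i j = trans (sym (mean-* (σ p i * σ p j) (x₂ i j)))
      (mean-reflection (averaged-x₂ i j) (averaged-* (σ p i * σ p j) (averaged-x₂ i j)) (x₂-cong i j) 2# (I p) (flip-norm p)
        (λ x → trans (solve 4 (λ s t a b → s :* t :* (a :* b) := s :* a :* (t :* b)) refl (σ p i) (σ p j) (x i) (x j))
          (*-cong (sym (flip-coordinate p x i)) (sym (flip-coordinate p x j)))))

    M₄-flip : ∀ p i j k l → σ p i * σ p j * (σ p k * σ p l) * M₄ i j k l ≈ M₄ i j k l
    M₄-flip p i j k l = trans (sym (mean-* s (x₄ i j k l)))
      (mean-reflection (averaged-x₄ i j k l) (averaged-* s (averaged-x₄ i j k l)) (x₄-cong i j k l) 2# (I p) (flip-norm p)
        (λ x → trans (solve 8 (λ s t u v a b c d → s :* t :* (u :* v) :* (a :* b :* (c :* d)) := s :* a :* (t :* b) :* (u :* c :* (v :* d)))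
            refl (σ p i) (σ p j) (σ p k) (σ p l) (x i) (x j) (x k) (x l))
          (*-cong (*-cong (sym (flip-coordinate p x i)) (sym (flip-coordinate p x j)))
                  (*-cong (sym (flip-coordinate p x k)) (sym (flip-coordinate p x l))))))
      where
      s = σ p i * σ p j * (σ p k * σ p l)

    odd⇒0 : ∀ {s x} → s ≈ - 1# → s * x ≈ x → x ≈ 0#
    odd⇒0 {s} {x} s≈-1 sx≈x = *-cancelˡ-≈ 2# (0<⇒≉0 0<2) (begin
      2# * x   ≈⟨ solve 1 (λ x → (con (+ 1) :+ con (+ 1)) :* x := x :- (:- con (+ 1)) :* x) refl x ⟩
      x - - 1# * x ≈⟨ +-congˡ (-‿cong (trans (*-congʳ (sym s≈-1)) sx≈x)) ⟩
      x - x    ≈⟨ -‿inverseʳ x ⟩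
      0#       ≈⟨ zeroʳ 2# ⟨
      2# * 0#  ∎)

    M₂-other : ∀ {i j} → ¬ (i ≡ j) → M₂ i j ≈ 0#
    M₂-other {i} {j} i≢j = odd⇒0 (trans (*-cong (σ-same i) (σ-other i≢j)) (*-identityʳ _)) (M₂-flip i i j)

    private
      M₄-odd : ∀ p i j k l {s t u v} → σ p i ≈ s → σ p j ≈ t → σ p k ≈ u → σ p l ≈ v →
               s * t * (u * v) ≈ - 1# → M₄ i j k l ≈ 0#
      M₄-odd p i j k l a b c d stuv≈-1 = odd⇒0 (trans (*-cong (*-cong a b) (*-cong c d)) stuv≈-1) (M₄-flip p i j k l)

    -- The index i occurs just once, so changing the sign of that coordinate negates the monomial.
    -- The three lemmas that follow do the same for the other slots.
    M₄-odd₁ : ∀ {i j k l} → ¬ (i ≡ j) → ¬ (i ≡ k) → ¬ (i ≡ l) → M₄ i j k l ≈ 0#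
    M₄-odd₁ {i} {j} {k} {l} p q r = M₄-odd i i j k l (σ-same i) (σ-other p) (σ-other q) (σ-other r)
      (solve 0 ((:- con (+ 1)) :* con (+ 1) :* (con (+ 1) :* con (+ 1)) := :- con (+ 1)) refl)

    M₄-odd₂ : ∀ {i j k l} → ¬ (j ≡ i) → ¬ (j ≡ k) → ¬ (j ≡ l) → M₄ i j k l ≈ 0#
    M₄-odd₂ {i} {j} {k} {l} p q r = M₄-odd j i j k l (σ-other p) (σ-same j) (σ-other q) (σ-other r)
      (solve 0 (con (+ 1) :* (:- con (+ 1)) :* (con (+ 1) :* con (+ 1)) := :- con (+ 1)) refl)

    M₄-odd₃ : ∀ {i j k l} → ¬ (k ≡ i) → ¬ (k ≡ j) → ¬ (k ≡ l) → M₄ i j k l ≈ 0#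
    M₄-odd₃ {i} {j} {k} {l} p q r = M₄-odd k i j k l (σ-other p) (σ-other q) (σ-same k) (σ-other r)
      (solve 0 (con (+ 1) :* con (+ 1) :* ((:- con (+ 1)) :* con (+ 1)) := :- con (+ 1)) refl)

    M₄-odd₄ : ∀ {i j k l} → ¬ (l ≡ i) → ¬ (l ≡ j) → ¬ (l ≡ k) → M₄ i j k l ≈ 0#
    M₄-odd₄ {i} {j} {k} {l} p q r = M₄-odd l i j k l (σ-other p) (σ-other q) (σ-other r) (σ-same l)
      (solve 0 (con (+ 1) :* con (+ 1) :* (con (+ 1) :* (:- con (+ 1))) := :- con (+ 1)) refl)

    fourthPower : ℝ → ℝ
    fourthPower y = y * y * (y * y)

    -- The reflection in v = eᵢ - 2eⱼ sends (xᵢ , xⱼ) to (3xᵢ + 4xⱼ , 4xᵢ - 3xⱼ) / 5.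
    module Rotation {i j : Fin n} (i≢j : ¬ (i ≡ j)) where

      v : ℝ^ n
      v m = I i m - 2# * I j m

      -- The vector v has ⟨ v , v ⟩ = 1 + 4 = 5, so this is the factor 2 / ⟨ v , v ⟩ of the
      -- reflection.
      k : ℝ
      k = 2# * 5# ⁻¹

      5k≈2 : 5# * k ≈ 2#
      5k≈2 = trans (solve 3 (λ f t g → f :* (t :* g) := t :* (f :* g)) refl 5# 2# (5# ⁻¹))
        (trans (*-congˡ (*-inverseʳ 5# (0<⇒≉0 0<5))) (*-identityʳ 2#))

      ⟨v,x⟩ : ∀ x → ⟨ v , x ⟩ ≈ x i - 2# * x j
      ⟨v,x⟩ x = trans (⟨⟩-comm v x) (trans (⟨,-⟩ x (I i) (2# • I j))
        (+-cong (trans (⟨⟩-comm x (I i)) (sum-Iˡ i x))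
          (-‿cong (trans (⟨,•⟩ 2# x (I j)) (*-congˡ (trans (⟨⟩-comm x (I j)) (sum-Iˡ j x)))))))

      v-i : v i ≈ 1#
      v-i = trans (+-cong (I-same i) (-‿cong (*-congˡ (I-other (λ j≡i → i≢j (≡.sym j≡i))))))
        (solve 0 (con (+ 1) :- con (+ 2) :* con (+ 0) := con (+ 1)) refl)

      v-j : v j ≈ - 2#
      v-j = trans (+-cong (I-other i≢j) (-‿cong (*-congˡ (I-same j))))
        (solve 0 (con (+ 0) :- con (+ 2) :* con (+ 1) := :- con (+ 2)) refl)

      norm : k * ⟨ v , v ⟩ ≈ 2#
      norm = trans (*-congˡ (trans (⟨v,x⟩ v) (trans (+-cong v-i (-‿cong (*-congˡ v-j)))
        (solve 0 (con (+ 1) :- con (+ 2) :* (:- con (+ 2)) := con (+ 5)) refl))))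
        (trans (*-comm k 5#) 5k≈2)

      -- Scaling by 5 clears the denominator, so that all later identities have integer
      -- coefficients.
      rotated-i : ∀ x → 5# * (x i - k * ⟨ v , x ⟩ * v i) ≈ 3# * x i + 4# * x j
      rotated-i x = begin
        5# * (x i - k * ⟨ v , x ⟩ * v i)        ≈⟨ *-congˡ (+-congˡ (-‿cong (*-cong (*-congˡ (⟨v,x⟩ x)) v-i))) ⟩
        5# * (x i - k * (x i - 2# * x j) * 1#)  ≈⟨ solve 3 (λ k x y → con (+ 5) :* (x :- k :* (x :- con (+ 2) :* y) :* con (+ 1))
                                                     := con (+ 5) :* x :- con (+ 5) :* k :* (x :- con (+ 2) :* y)) refl k (x i) (x j) ⟩
        5# * x i - 5# * k * (x i - 2# * x j)    ≈⟨ +-congˡ (-‿cong (*-congʳ 5k≈2)) ⟩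
        5# * x i - 2# * (x i - 2# * x j)        ≈⟨ solve 2 (λ x y → con (+ 5) :* x :- con (+ 2) :* (x :- con (+ 2) :* y)
                                                     := con (+ 3) :* x :+ con (+ 4) :* y) refl (x i) (x j) ⟩
        3# * x i + 4# * x j                     ∎

      rotated-j : ∀ x → 5# * (x j - k * ⟨ v , x ⟩ * v j) ≈ 4# * x i + - 3# * x j
      rotated-j x = begin
        5# * (x j - k * ⟨ v , x ⟩ * v j)          ≈⟨ *-congˡ (+-congˡ (-‿cong (*-cong (*-congˡ (⟨v,x⟩ x)) v-j))) ⟩
        5# * (x j - k * (x i - 2# * x j) * - 2#)  ≈⟨ solve 3 (λ k x y → con (+ 5) :* (y :- k :* (x :- con (+ 2) :* y) :* (:- con (+ 2)))
                                                     := con (+ 5) :* y :+ con (+ 5) :* k :* (con (+ 2) :* (x :- con (+ 2) :* y))) refl k (x i) (x j) ⟩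
        5# * x j + 5# * k * (2# * (x i - 2# * x j)) ≈⟨ +-congˡ (*-congʳ 5k≈2) ⟩
        5# * x j + 2# * (2# * (x i - 2# * x j))   ≈⟨ solve 2 (λ x y → con (+ 5) :* y :+ con (+ 2) :* (con (+ 2) :* (x :- con (+ 2) :* y))
                                                     := con (+ 4) :* x :+ (:- con (+ 3)) :* y) refl (x i) (x j) ⟩
        4# * x i + - 3# * x j                     ∎

      a a′ b : ℝ
      a  = M₄ i i i i
      a′ = M₄ j j j j
      b  = M₄ i i j j

      -- Binomial expansion of (p xᵢ + q xⱼ)⁴; the terms with coefficient 4 contain odd powers and
      -- have mean zero.
      fourth-moment : ∀ p q m → (∀ x → 5# * (x m - k * ⟨ v , x ⟩ * v m) ≈ p * x i + q * x j) →
        fourthPower 5# * M₄ m m m m ≈ fourthPower p * a + (6# * (p * p * (q * q)) * b + fourthPower q * a′)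
      fourth-moment p q m rotated = begin
        fourthPower 5# * M₄ m m m m            ≈⟨ mean-* (fourthPower 5#) (x₄ m m m m) ⟨
        mean f                                 ≈⟨ mean-reflection {f} {g} (averaged-* (fourthPower 5#) (averaged-x₄ m m m m)) g-averaged
                                                    (λ x≋y → *-congˡ (x₄-cong m m m m x≋y)) k v norm g≈ ⟨
        mean g                                 ≈⟨ mean-g ⟩
        c₀ * a + (c₁ * M₄ i i i j + (c₂ * b + (c₃ * M₄ i j j j + c₄ * a′)))
          ≈⟨ +-congˡ (+-cong (trans (*-congˡ (M₄-odd₄ j≢i j≢i j≢i)) (zeroʳ c₁))
               (+-congˡ (+-congʳ (trans (*-congˡ (M₄-odd₁ i≢j i≢j i≢j)) (zeroʳ c₃))))) ⟩
        c₀ * a + (0# + (c₂ * b + (0# + c₄ * a′))) ≈⟨ +-congˡ (trans (+-identityˡ _) (+-congˡ (+-identityˡ _))) ⟩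
        c₀ * a + (c₂ * b + c₄ * a′)            ∎
        where
        j≢i : ¬ (j ≡ i)
        j≢i j≡i = i≢j (≡.sym j≡i)
        c₀ c₁ c₂ c₃ c₄ : ℝ
        c₀ = fourthPower p
        c₁ = 4# * (p * p * (p * q))
        c₂ = 6# * (p * p * (q * q))
        c₃ = 4# * (p * q * (q * q))
        c₄ = fourthPower q
        f g g₁ g₂ g₃ : ℝ^ n → ℝ
        f x  = fourthPower 5# * x₄ m m m m x
        g₃ x = c₃ * x₄ i j j j x + c₄ * x₄ j j j j x
        g₂ x = c₂ * x₄ i i j j x + g₃ x
        g₁ x = c₁ * x₄ i i i j x + g₂ x
        g x  = c₀ * x₄ i i i i x + g₁ x
        g-averaged : Averaged g
        g-averaged = averaged-+ (averaged-* c₀ (averaged-x₄ i i i i)) (averaged-+ (averaged-* c₁ (averaged-x₄ i i i j))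
          (averaged-+ (averaged-* c₂ (averaged-x₄ i i j j)) (averaged-+ (averaged-* c₃ (averaged-x₄ i j j j)) (averaged-* c₄ (averaged-x₄ j j j j)))))
        mean-g : mean g ≈ c₀ * a + (c₁ * M₄ i i i j + (c₂ * b + (c₃ * M₄ i j j j + c₄ * a′)))
        mean-g = trans (mean-+ (λ x → c₀ * x₄ i i i i x) g₁) (+-cong (mean-* c₀ (x₄ i i i i))
          (trans (mean-+ (λ x → c₁ * x₄ i i i j x) g₂) (+-cong (mean-* c₁ (x₄ i i i j))
          (trans (mean-+ (λ x → c₂ * x₄ i i j j x) g₃) (+-cong (mean-* c₂ (x₄ i i j j))
          (trans (mean-+ (λ x → c₃ * x₄ i j j j x) (λ x → c₄ * x₄ j j j j x)) (+-cong (mean-* c₃ (x₄ i j j j)) (mean-* c₄ (x₄ j j j j)))))))))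
        g≈ : ∀ x → g x ≈ f (λ l → x l - k * ⟨ v , x ⟩ * v l)
        g≈ x = begin
          g x                                  ≈⟨ solve 4 (λ p q x y →
              p :* p :* (p :* p) :* (x :* x :* (x :* x)) :+
              (con (+ 4) :* (p :* p :* (p :* q)) :* (x :* x :* (x :* y)) :+
              (con (+ 6) :* (p :* p :* (q :* q)) :* (x :* x :* (y :* y)) :+
              (con (+ 4) :* (p :* q :* (q :* q)) :* (x :* y :* (y :* y)) :+
              q :* q :* (q :* q) :* (y :* y :* (y :* y)))))
              := (p :* x :+ q :* y) :* (p :* x :+ q :* y) :* ((p :* x :+ q :* y) :* (p :* x :+ q :* y))) refl p q (x i) (x j) ⟩
          fourthPower (p * x i + q * x j)      ≈⟨ *-cong (*-cong (sym (rotated x)) (sym (rotated x))) (*-cong (sym (rotated x)) (sym (rotated x))) ⟩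
          fourthPower (5# * y)                 ≈⟨ solve 1 (λ y → con (+ 5) :* y :* (con (+ 5) :* y) :* (con (+ 5) :* y :* (con (+ 5) :* y))
                                                    := con (+ 5) :* con (+ 5) :* (con (+ 5) :* con (+ 5)) :* (y :* y :* (y :* y))) refl y ⟩
          fourthPower 5# * fourthPower y       ∎
          where
          y = x m - k * ⟨ v , x ⟩ * v m

      -- In the difference of the relations for the two rotated coordinates b cancels, and 800 (a -
      -- a′) remains.
      a≈a′ : a ≈ a′
      a≈a′ = *-cancelˡ-≈ z (0<⇒≉0 0<z) (x-y≈0⇒x≈y (begin
        z * a - z * a′     ≈⟨ solve 3 (λ a b c →
            con (+ 2) :* (con (+ 4) :* con (+ 4) :* (con (+ 5) :* con (+ 5))) :* a :-
            con (+ 2) :* (con (+ 4) :* con (+ 4) :* (con (+ 5) :* con (+ 5))) :* c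
            := (con (+ 5) :* con (+ 5) :* (con (+ 5) :* con (+ 5)) :* a :-
                 (con (+ 3) :* con (+ 3) :* (con (+ 3) :* con (+ 3)) :* a :+ (con (+ 6) :* (con (+ 3) :* con (+ 3) :* (con (+ 4) :* con (+ 4))) :* b :+ con (+ 4) :* con (+ 4) :* (con (+ 4) :* con (+ 4)) :* c))) :-
               (con (+ 5) :* con (+ 5) :* (con (+ 5) :* con (+ 5)) :* c :-
                 (con (+ 4) :* con (+ 4) :* (con (+ 4) :* con (+ 4)) :* a :+ (con (+ 6) :* (con (+ 4) :* con (+ 4) :* ((:- con (+ 3)) :* (:- con (+ 3)))) :* b :+ (:- con (+ 3)) :* (:- con (+ 3)) :* ((:- con (+ 3)) :* (:- con (+ 3))) :* c))))
            refl a b a′ ⟩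
        (L₁ - R₁) - (L₂ - R₂) ≈⟨ +-cong (x≈y⇒x-y≈0 (fourth-moment 3# 4# i rotated-i)) (-‿cong (x≈y⇒x-y≈0 (fourth-moment 4# (- 3#) j rotated-j))) ⟩
        0# - 0#            ≈⟨ -‿inverseʳ 0# ⟩
        0#                 ∎))
        where
        z L₁ R₁ L₂ R₂ : ℝ
        z  = 2# * (4# * 4# * (5# * 5#))
        L₁ = fourthPower 5# * a
        R₁ = fourthPower 3# * a + (6# * (3# * 3# * (4# * 4#)) * b + fourthPower 4# * a′)
        L₂ = fourthPower 5# * a′
        R₂ = fourthPower 4# * a + (6# * (4# * 4# * (- 3# * - 3#)) * b + fourthPower (- 3#) * a′)
        0<z : 0# < z
        0<z = 0<* 0<2 (0<* (0<* 0<4 0<4) (0<* 0<5 0<5))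

      -- With a′ = a the relation 625 a = 81 a + 864 b + 256 a′ becomes 288 a = 864 b.
      a≈3b : a ≈ 3# * b
      a≈3b = *-cancelˡ-≈ z (0<⇒≉0 0<z) (x-y≈0⇒x≈y (begin
        z * a - z * (3# * b)   ≈⟨ solve 3 (λ a b c →
            con (+ 2) :* (con (+ 4) :* con (+ 4) :* (con (+ 3) :* con (+ 3))) :* a :-
            con (+ 2) :* (con (+ 4) :* con (+ 4) :* (con (+ 3) :* con (+ 3))) :* (con (+ 3) :* b)
            := (con (+ 5) :* con (+ 5) :* (con (+ 5) :* con (+ 5)) :* a :-
                 (con (+ 3) :* con (+ 3) :* (con (+ 3) :* con (+ 3)) :* a :+ (con (+ 6) :* (con (+ 3) :* con (+ 3) :* (con (+ 4) :* con (+ 4))) :* b :+ con (+ 4) :* con (+ 4) :* (con (+ 4) :* con (+ 4)) :* c))) :-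
               con (+ 4) :* con (+ 4) :* (con (+ 4) :* con (+ 4)) :* (a :- c))
            refl a b a′ ⟩
        (L₁ - R₁) - fourthPower 4# * (a - a′)  ≈⟨ +-cong (x≈y⇒x-y≈0 (fourth-moment 3# 4# i rotated-i))
                                                   (-‿cong (trans (*-congˡ (x≈y⇒x-y≈0 a≈a′)) (zeroʳ _))) ⟩
        0# - 0#            ≈⟨ -‿inverseʳ 0# ⟩
        0#                 ∎))
        where
        z L₁ R₁ : ℝ
        z  = 2# * (4# * 4# * (3# * 3#))
        L₁ = fourthPower 5# * a
        R₁ = fourthPower 3# * a + (6# * (3# * 3# * (4# * 4#)) * b + fourthPower 4# * a′)
        0<z : 0# < z
        0<z = 0<* 0<2 (0<* (0<* 0<4 0<4) (0<* 0<3 0<3))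

      -- Comparing the means of 25 xᵢ² and (3 xᵢ + 4 xⱼ)², whose mixed term (24, written as 6 times
      -- 4) has mean zero, leaves the same multiple 16 of both moments.
      M₂-equal : M₂ i i ≈ M₂ j j
      M₂-equal = *-cancelˡ-≈ (4# * 4#) (0<⇒≉0 (0<* 0<4 0<4)) (x-y≈0⇒x≈y (begin
        4# * 4# * M₂ i i - 4# * 4# * M₂ j j
          ≈⟨ solve 2 (λ a c → con (+ 4) :* con (+ 4) :* a :- con (+ 4) :* con (+ 4) :* c
               := con (+ 5) :* con (+ 5) :* a :- (con (+ 3) :* con (+ 3) :* a :+ (con (+ 6) :* con (+ 4) :* con (+ 0) :+ con (+ 4) :* con (+ 4) :* c))) refl (M₂ i i) (M₂ j j) ⟩
        5# * 5# * M₂ i i - (3# * 3# * M₂ i i + (6# * 4# * 0# + 4# * 4# * M₂ j j))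
          ≈⟨ x≈y⇒x-y≈0 (trans second (+-congˡ (+-congʳ (*-congˡ (M₂-other i≢j))))) ⟩
        0# ∎))
        where
        f g g₁ : ℝ^ n → ℝ
        f x  = 5# * 5# * x₂ i i x
        g₁ x = 6# * 4# * x₂ i j x + 4# * 4# * x₂ j j x
        g x  = 3# * 3# * x₂ i i x + g₁ x
        g≈ : ∀ x → g x ≈ f (λ l → x l - k * ⟨ v , x ⟩ * v l)
        g≈ x = begin
          g x                                  ≈⟨ solve 2 (λ x y → con (+ 3) :* con (+ 3) :* (x :* x) :+ (con (+ 6) :* con (+ 4) :* (x :* y) :+ con (+ 4) :* con (+ 4) :* (y :* y))
                                                    := (con (+ 3) :* x :+ con (+ 4) :* y) :* (con (+ 3) :* x :+ con (+ 4) :* y)) refl (x i) (x j) ⟩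
          (3# * x i + 4# * x j) * (3# * x i + 4# * x j) ≈⟨ *-cong (sym (rotated-i x)) (sym (rotated-i x)) ⟩
          5# * y * (5# * y)                    ≈⟨ solve 1 (λ y → con (+ 5) :* y :* (con (+ 5) :* y) := con (+ 5) :* con (+ 5) :* (y :* y)) refl y ⟩
          5# * 5# * (y * y)                    ∎
          where
          y = x i - k * ⟨ v , x ⟩ * v i
        second : 5# * 5# * M₂ i i ≈ 3# * 3# * M₂ i i + (6# * 4# * M₂ i j + 4# * 4# * M₂ j j)
        second = begin
          5# * 5# * M₂ i i        ≈⟨ mean-* (5# * 5#) (x₂ i i) ⟨
          mean f                  ≈⟨ mean-reflection {f} {g} (averaged-* (5# * 5#) (averaged-x₂ i i))
                                       (averaged-+ (averaged-* (3# * 3#) (averaged-x₂ i i)) (averaged-+ (averaged-* (6# * 4#) (averaged-x₂ i j)) (averaged-* (4# * 4#) (averaged-x₂ j j))))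
                                       (λ x≋y → *-congˡ (x₂-cong i i x≋y)) k v norm g≈ ⟨
          mean g                  ≈⟨ trans (mean-+ (λ x → 3# * 3# * x₂ i i x) g₁) (+-cong (mean-* (3# * 3#) (x₂ i i))
                                       (trans (mean-+ (λ x → 6# * 4# * x₂ i j x) (λ x → 4# * 4# * x₂ j j x)) (+-cong (mean-* (6# * 4#) (x₂ i j)) (mean-* (4# * 4#) (x₂ j j))))) ⟩
          3# * 3# * M₂ i i + (6# * 4# * M₂ i j + 4# * 4# * M₂ j j) ∎

    mean-∑∑ : ∀ (f : Fin n → Fin n → ℝ^ n → ℝ) → mean (λ x → ∑∑ (λ i j → f i j x)) ≈ ∑∑ (λ i j → mean (f i j))
    mean-∑∑ f = trans (mean-sum (λ i x → sum (λ j → f i j x))) (sum-cong-≋ {n} (λ i → mean-sum (f i)))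

    module Formulas (o : Fin n) where

      -- The two scalars on which the moments depend, read off at a reference coordinate o. Their
      -- values 1/n and 1/n(n+2) stay implicit; `0<β` records what the estimate needs.
      s β : ℝ
      s = M₂ o o
      β = 3# ⁻¹ * M₄ o o o o

      3β≈ : 3# * β ≈ M₄ o o o o
      3β≈ = trans (sym (*-assoc _ _ _)) (trans (*-congʳ (*-inverseʳ 3# (0<⇒≉0 0<3))) (*-identityˡ _))

      M₂-diagonal : ∀ i → M₂ i i ≈ s
      M₂-diagonal i with i ≟ o
      ... | yes ≡.refl = refl
      ... | no  i≢o    = Rotation.M₂-equal i≢o

      M₄-diagonal : ∀ i → M₄ i i i i ≈ 3# * β
      M₄-diagonal i with i ≟ o
      ... | yes ≡.refl = sym 3β≈
      ... | no  i≢o    = trans (Rotation.a≈a′ i≢o) (sym 3β≈)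

      M₄-pairs : ∀ {i j} → ¬ (i ≡ j) → M₄ i i j j ≈ β
      M₄-pairs {i} i≢j = *-cancelˡ-≈ 3# (0<⇒≉0 0<3) (trans (sym (Rotation.a≈3b i≢j)) (M₄-diagonal i))

      -- The isotropic tensor of rank four: one summand for each of the three pairings of the
      -- indices.
      M₄-value : (i j k l : Fin n) → ℝ
      M₄-value i j k l = β * (I i j * I k l + (I i k * I j l + I i l * I j k))

      private
        value : ∀ {i j k l a b c d e f} → I i j ≈ a → I k l ≈ b → I i k ≈ c → I j l ≈ d → I i l ≈ e → I j k ≈ f →
                M₄-value i j k l ≈ β * (a * b + (c * d + e * f))
        value p q r s t u = *-congˡ (+-cong (*-cong p q) (+-cong (*-cong r s) (*-cong t u)))

        -- Either the indices coincide in pairs, and one or all three pairings contribute, or some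
        -- index occurs just once and both sides vanish. The decisions are arguments so that
        -- matching on them can identify indices.
        formula : ∀ i j k l → Dec (i ≡ j) → Dec (i ≡ k) → Dec (i ≡ l) → Dec (j ≡ k) → Dec (j ≡ l) → Dec (k ≡ l) →
                  M₄ i j k l ≈ M₄-value i j k l
        formula i .i .i .i (yes ≡.refl) (yes ≡.refl) _ _ _ (yes ≡.refl) = trans (M₄-diagonal i) (sym (trans
          (value {i} {i} {i} {i} (I-same i) (I-same i) (I-same i) (I-same i) (I-same i) (I-same i))
          (solve 1 (λ b → b :* (con (+ 1) :* con (+ 1) :+ (con (+ 1) :* con (+ 1) :+ con (+ 1) :* con (+ 1))) := con (+ 3) :* b) refl β)))
        formula i .i k .k (yes ≡.refl) (no p) _ _ _ (yes ≡.refl) = trans (M₄-pairs p) (sym (trans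
          (value {i} {i} {k} {k} (I-same i) (I-same k) (I-other p) (I-other p) (I-other p) (I-other p))
          (solve 1 (λ b → b :* (con (+ 1) :* con (+ 1) :+ (con (+ 0) :* con (+ 0) :+ con (+ 0) :* con (+ 0))) := b) refl β)))
        formula i .i .i l (yes ≡.refl) (yes ≡.refl) _ _ _ (no q) = trans (M₄-odd₄ q′ q′ q′) (sym (trans
          (value {i} {i} {i} {l} refl (I-other q) refl (I-other q) (I-other q) refl)
          (solve 2 (λ b x → b :* (x :* con (+ 0) :+ (x :* con (+ 0) :+ con (+ 0) :* x)) := con (+ 0)) refl β (I i i))))
          where
          q′ : ¬ (l ≡ i)
          q′ eq = q (≡.sym eq)
        formula i .i k l (yes ≡.refl) (no p) _ _ _ (no q) = trans (M₄-odd₃ p′ p′ q) (sym (trans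
          (value {i} {i} {k} {l} refl (I-other q) (I-other p) refl refl (I-other p))
          (solve 3 (λ b x y → b :* (x :* con (+ 0) :+ (con (+ 0) :* y :+ y :* con (+ 0))) := con (+ 0)) refl β (I i i) (I i l))))
          where
          p′ : ¬ (k ≡ i)
          p′ eq = p (≡.sym eq)
        formula i j .i .j (no p) (yes ≡.refl) _ _ (yes ≡.refl) _ = trans (trans
          (mean-cong (x₄ i j i j) (x₄ i i j j) (λ m → solve 2 (λ x y → x :* y :* (x :* y) := x :* x :* (y :* y)) refl (P m i) (P m j)))
          (M₄-pairs p)) (sym (trans
          (value {i} {j} {i} {j} (I-other p) (I-other p) (I-same i) (I-same j) (I-other p) (I-other p′))
          (solve 1 (λ b → b :* (con (+ 0) :* con (+ 0) :+ (con (+ 1) :* con (+ 1) :+ con (+ 0) :* con (+ 0))) := b) refl β)))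
          where
          p′ : ¬ (j ≡ i)
          p′ eq = p (≡.sym eq)
        formula i j .i l (no p) (yes ≡.refl) _ _ (no q) _ = trans (M₄-odd₂ p′ p′ q) (sym (trans
          (value {i} {j} {i} {l} (I-other p) refl refl (I-other q) refl (I-other p′))
          (solve 3 (λ b x y → b :* (con (+ 0) :* x :+ (y :* con (+ 0) :+ x :* con (+ 0))) := con (+ 0)) refl β (I i l) (I i i))))
          where
          p′ : ¬ (j ≡ i)
          p′ eq = p (≡.sym eq)
        formula i j .j .i (no p) (no _) (yes ≡.refl) (yes ≡.refl) _ _ = trans (trans
          (mean-cong (x₄ i j j i) (x₄ i i j j) (λ m → solve 2 (λ x y → x :* y :* (y :* x) := x :* x :* (y :* y)) refl (P m i) (P m j)))
          (M₄-pairs p)) (sym (trans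
          (value {i} {j} {j} {i} (I-other p) (I-other p′) (I-other p) (I-other p′) (I-same i) (I-same j))
          (solve 1 (λ b → b :* (con (+ 0) :* con (+ 0) :+ (con (+ 0) :* con (+ 0) :+ con (+ 1) :* con (+ 1))) := b) refl β)))
          where
          p′ : ¬ (j ≡ i)
          p′ eq = p (≡.sym eq)
        formula i j k .i (no p) (no q) (yes ≡.refl) (no r) _ _ = trans (M₄-odd₂ p′ r p′) (sym (trans
          (value {i} {j} {k} {i} (I-other p) refl (I-other q) refl refl (I-other r))
          (solve 4 (λ b x y z → b :* (con (+ 0) :* x :+ (con (+ 0) :* y :+ z :* con (+ 0))) := con (+ 0)) refl β (I k i) (I j i) (I i i))))
          where
          p′ : ¬ (j ≡ i)
          p′ eq = p (≡.sym eq)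
        formula i j k l (no p) (no q) (no r) _ _ _ = trans (M₄-odd₁ p q r) (sym (trans
          (value {i} {j} {k} {l} (I-other p) refl (I-other q) refl (I-other r) refl)
          (solve 4 (λ b x y z → b :* (con (+ 0) :* x :+ (con (+ 0) :* y :+ con (+ 0) :* z)) := con (+ 0)) refl β (I k l) (I j l) (I j k))))

      M₄-formula : ∀ i j k l → M₄ i j k l ≈ M₄-value i j k l
      M₄-formula i j k l = formula i j k l (i ≟ j) (i ≟ k) (i ≟ l) (j ≟ k) (j ≟ l) (k ≟ l)

      M₂-formula : ∀ i j → M₂ i j ≈ s * I i j
      M₂-formula i j with i ≟ j
      ... | yes ≡.refl = trans (M₂-diagonal i) (sym (trans (*-congˡ (I-same i)) (*-identityʳ s)))
      ... | no  i≢j    = trans (M₂-other i≢j) (sym (trans (*-congˡ (I-other i≢j)) (zeroʳ s)))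

      mean-quadratic : ∀ H → mean (quadratic H) ≈ s * tr H
      mean-quadratic H = begin
        mean (quadratic H)                          ≈⟨ mean-∑∑ (λ i j x → H i j * (x i * x j)) ⟩
        ∑∑ (λ i j → mean (λ x → H i j * x₂ i j x))  ≈⟨ ∑∑-cong (λ i j → trans (mean-* (H i j) (x₂ i j)) (*-congˡ (M₂-formula i j))) ⟩
        ∑∑ (λ i j → H i j * (s * I i j))            ≈⟨ ∑∑-cong (λ i j → solve 3 (λ h s t → h :* (s :* t) := s :* (h :* t)) refl (H i j) s (I i j)) ⟩
        ∑∑ (λ i j → s * (H i j * I i j))            ≈⟨ *-∑∑ s (λ i j → H i j * I i j) ⟨
        s * ∑∑ (λ i j → H i j * I i j)              ≈⟨ *-congˡ (∑∑-I H) ⟩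
        s * tr H                                    ∎

      -- The three pairings contract H ⊗ H to the squared trace, the sum of squared entries, and the
      -- trace of H².
      mean-quadratic² : ∀ H → mean (λ x → quadratic H x * quadratic H x) ≈
        β * (tr H * tr H + (∑∑ (λ i j → H i j * H i j) + ∑∑ (λ i j → H i j * H j i)))
      mean-quadratic² H = begin
        mean (λ x → quadratic H x * quadratic H x)
          ≈⟨ mean-cong (λ x → quadratic H x * quadratic H x) (λ x → ∑∑ (λ i j → ∑∑ (λ k l → h i j k l x))) (λ m → square (P m)) ⟩
        mean (λ x → ∑∑ (λ i j → ∑∑ (λ k l → h i j k l x)))
          ≈⟨ mean-∑∑ (λ i j x → ∑∑ (λ k l → h i j k l x)) ⟩
        ∑∑ (λ i j → mean (λ x → ∑∑ (λ k l → h i j k l x)))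
          ≈⟨ ∑∑-cong (λ i j → trans (mean-∑∑ (h i j)) (inner i j)) ⟩
        ∑∑ (λ i j → β * (tr H * (H i j * I i j) + (H i j * H i j + H i j * H j i)))
          ≈⟨ *-∑∑ β (λ i j → tr H * (H i j * I i j) + (H i j * H i j + H i j * H j i)) ⟨
        β * ∑∑ (λ i j → tr H * (H i j * I i j) + (H i j * H i j + H i j * H j i))
          ≈⟨ *-congˡ (trans (∑∑-+ (λ i j → tr H * (H i j * I i j)) (λ i j → H i j * H i j + H i j * H j i))
               (+-cong (trans (sym (*-∑∑ (tr H) (λ i j → H i j * I i j))) (*-congˡ (∑∑-I H)))
                 (∑∑-+ (λ i j → H i j * H i j) (λ i j → H i j * H j i)))) ⟩
        β * (tr H * tr H + (∑∑ (λ i j → H i j * H i j) + ∑∑ (λ i j → H i j * H j i))) ∎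
        where
        h : Fin n → Fin n → Fin n → Fin n → ℝ^ n → ℝ
        h i j k l x = H i j * H k l * x₄ i j k l x
        square : ∀ x → quadratic H x * quadratic H x ≈ ∑∑ (λ i j → ∑∑ (λ k l → h i j k l x))
        square x = trans (∑∑-* (quadratic H x) (λ i j → H i j * (x i * x j))) (∑∑-cong (λ i j → trans
          (*-∑∑ (H i j * (x i * x j)) (λ k l → H k l * (x k * x l)))
          (∑∑-cong (λ k l → solve 4 (λ a p b q → a :* p :* (b :* q) := a :* b :* (p :* q)) refl (H i j) (x i * x j) (H k l) (x k * x l)))))
        inner : ∀ i j → ∑∑ (λ k l → mean (h i j k l)) ≈ β * (tr H * (H i j * I i j) + (H i j * H i j + H i j * H j i))
        inner i j = begin
          ∑∑ (λ k l → mean (h i j k l))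
            ≈⟨ ∑∑-cong (λ k l → trans (mean-* (H i j * H k l) (x₄ i j k l)) (trans (*-congˡ (M₄-formula i j k l))
                 (solve 9 (λ a b c d e f g m o → a :* b :* (c :* (d :* e :+ (f :* g :+ m :* o)))
                      := c :* a :* (d :* (b :* e) :+ (b :* (f :* g) :+ b :* (m :* o)))) refl
                    (H i j) (H k l) β (I i j) (I k l) (I i k) (I j l) (I i l) (I j k)))) ⟩
          ∑∑ (λ k l → β * H i j * (I i j * (H k l * I k l) + (H k l * (I i k * I j l) + H k l * (I i l * I j k))))
            ≈⟨ *-∑∑ (β * H i j) (λ k l → I i j * (H k l * I k l) + (H k l * (I i k * I j l) + H k l * (I i l * I j k))) ⟨
          β * H i j * ∑∑ (λ k l → I i j * (H k l * I k l) + (H k l * (I i k * I j l) + H k l * (I i l * I j k)))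
            ≈⟨ *-congˡ (trans (∑∑-+ (λ k l → I i j * (H k l * I k l)) (λ k l → H k l * (I i k * I j l) + H k l * (I i l * I j k)))
                 (+-cong (trans (sym (*-∑∑ (I i j) (λ k l → H k l * I k l))) (*-congˡ (∑∑-I H)))
                   (trans (∑∑-+ (λ k l → H k l * (I i k * I j l)) (λ k l → H k l * (I i l * I j k)))
                     (+-cong (∑∑-II H i j) (trans (∑∑-cong (λ k l → *-congˡ (*-comm (I i l) (I j k)))) (∑∑-II H j i)))))) ⟩
          β * H i j * (I i j * tr H + (H i j + H j i))
            ≈⟨ solve 5 (λ b h t i g → b :* h :* (i :* t :+ (h :+ g)) := b :* (t :* (h :* i) :+ (h :* h :+ h :* g))) refl β (H i j) (tr H) (I i j) (H j i) ⟩
          β * (tr H * (H i j * I i j) + (H i j * H i j + H i j * H j i)) ∎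

      quadratic-I : ∀ k → quadratic I (P k) ≈ 1#
      quadratic-I k = trans (sum-cong-≋ {n} (λ i → sum-Iˡ i (λ j → P k i * P k j))) (P-unit k)

      -- A mean of fourth powers is nonnegative. The form of the identity matrix is 1 on all of X,
      -- so its mean square is 1; were β zero, the formula for the mean square would give 0.
      0<β : 0# < β
      0<β = *-nonNeg (0≤⁻¹ 0<3) (mean-nonNeg (x₄ o o o o) (λ k → 0≤² (P k o * P k o))) , λ 0≈β → 0≉1 (begin
        0#                                            ≈⟨ zeroˡ _ ⟨
        0# * (tr I′ * tr I′ + S)                      ≈⟨ *-congʳ 0≈β ⟩
        β * (tr I′ * tr I′ + S)                       ≈⟨ mean-quadratic² I′ ⟨
        mean (λ x → quadratic I′ x * quadratic I′ x)  ≈⟨ mean-cong (λ x → quadratic I′ x * quadratic I′ x) (λ _ → 1#)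
                                                         (λ k → trans (*-cong (quadratic-I k) (quadratic-I k)) (*-identityˡ 1#)) ⟩
        mean (λ _ → 1#)                               ≈⟨ mean-const 1# ⟩
        1#                                            ∎)
        where
        I′ : Matrix n
        I′ = I
        S : ℝ
        S = ∑∑ (λ i j → I′ i j * I′ i j) + ∑∑ (λ i j → I′ i j * I′ j i)

      -- Perfection and eutaxy in quantitative form.
      quadratic-dips : ∀ {H ε κ m} → (∀ i j → H i j ≈ H j i) → tr H ≈ 0# →
        ε * ε ≤ ∑∑ (λ i j → H i j * H i j) →
        (∀ k → quadratic H (P k) ≤ κ) → (∀ k → - m ≤ quadratic H (P k)) →
        2# * β * (ε * ε) ≤ m * κ
      quadratic-dips {H} {ε} {κ} {m} H-sym trH≈0 εε≤S q≤κ -m≤q = O.trans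
        (≤-by (2# * β * (S - ε * ε)) (*-nonNeg (*-nonNeg 0≤2 (proj₁ 0<β)) (0≤y-x εε≤S))
          (solve 3 (λ b e s → con (+ 2) :* b :* s := con (+ 2) :* b :* e :+ con (+ 2) :* b :* (s :- e)) refl β (ε * ε) S))
        (≤-by _ 0≤E (begin
          m * κ                                    ≈⟨ mean-const (m * κ) ⟨
          mean (λ _ → m * κ)                       ≈⟨ mean-cong (λ _ → m * κ) g (λ k → solve 3 (λ m c q →
              m :* c := q :* q :+ ((m :- c) :* q :+ (q :+ m) :* (c :- q))) refl m κ (quadratic H (P k))) ⟩
          mean g                                   ≈⟨ mean-+ (λ x → quadratic H x * quadratic H x) (λ x → (m - κ) * quadratic H x + E x) ⟩
          mean (λ x → quadratic H x * quadratic H x) + mean (λ x → (m - κ) * quadratic H x + E x)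
            ≈⟨ +-cong (trans (mean-quadratic² H) (*-congˡ (+-cong (*-cong trH≈0 trH≈0) (+-congˡ (∑∑-cong (λ i j → *-congˡ (sym (H-sym i j))))))))
                 (trans (mean-+ (λ x → (m - κ) * quadratic H x) E) (+-congʳ (trans (mean-* (m - κ) (quadratic H))
                   (*-congˡ (trans (mean-quadratic H) (trans (*-congˡ trH≈0) (zeroʳ s))))))) ⟩
          β * (0# * 0# + (S + S)) + ((m - κ) * 0# + mean E)
            ≈⟨ solve 4 (λ b t d e → b :* (con (+ 0) :* con (+ 0) :+ (t :+ t)) :+ (d :* con (+ 0) :+ e) := con (+ 2) :* b :* t :+ e) refl β S (m - κ) (mean E) ⟩
          2# * β * S + mean E ∎))
        where
        S : ℝ
        S = ∑∑ (λ i j → H i j * H i j)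
        E g : ℝ^ n → ℝ
        E x = (quadratic H x + m) * (κ - quadratic H x)
        g x = quadratic H x * quadratic H x + ((m - κ) * quadratic H x + E x)
        0≤E : 0# ≤ mean E
        0≤E = mean-nonNeg E (λ k → *-nonNeg
          (0≤-resp (0≤y-x (-m≤q k)) (+-congˡ (sym (-‿involutive m)))) (0≤y-x (q≤κ k)))

  -- Extremality

  minimum₂ : ∀ {x y} → 0# < x → 0# < y → ∃[ z ] 0# < z × z ≤ x × z ≤ y
  minimum₂ {x} {y} 0<x 0<y with O.total x y
  ... | inj₁ x≤y = x , 0<x , O.refl , x≤y
  ... | inj₂ y≤x = y , 0<y , y≤x , O.refl

  largest-square : ∀ {n} (x : Vector ℝ (suc n)) → ∃[ i ] (∀ j → x j * x j ≤ x i * x i)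
  largest-square {zero}  x = zero , λ { zero → O.refl }
  largest-square {suc n} x with largest-square (λ i → x (suc i))
  ... | i , largest with O.total (x zero * x zero) (x (suc i) * x (suc i))
  ...   | inj₁ le = suc i , λ { zero → le ; (suc j) → largest j }
  ...   | inj₂ ge = zero , λ { zero → O.refl ; (suc j) → O.trans (largest j) ge }

  largest-entry : ∀ {n} (H : Matrix (suc n)) → ∃[ i ] ∃[ j ] (∀ k l → H k l * H k l ≤ H i j * H i j)
  largest-entry {n} H = i , column i , λ k l → O.trans (proj₂ (largest-square (H k)) l) (proj₂ rows k)
    where
    column : Fin (suc n) → Fin (suc n)
    column k = proj₁ (largest-square (H k))
    rows : ∃[ i ] (∀ k → H k (column k) * H k (column k) ≤ H i (column i) * H i (column i))
    rows = largest-square (λ k → H k (column k))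
    i : Fin (suc n)
    i = proj₁ rows

  -- With ε the absolute value of an actual entry, its square is one summand of the sum of squares.
  -- So the same ε controls the determinant from above and feeds the lower bound in
  -- `quadratic-dips`.
  max-entry : ∀ {n} (H : Matrix (suc n)) {c} → (∀ i j → H i j ≼ c) →
    ∃[ ε ] ε ≤ c × (∀ i j → H i j ≼ ε) × ε * ε ≤ ∑∑ (λ i j → H i j * H i j)
  max-entry H {c} H≼c with largest-entry H
  ... | i , j , largest with ≼-∣ H i j ∣
  ...   | ε , Hij≼ε , εε≈ = ε , ²-cancel-≤ (≼⇒0≤ (H≼c i j)) (O.trans (O.reflexive εε≈) H²≤c²) ,
    (λ k l → ≼-² (≼⇒0≤ Hij≼ε) (O.trans (largest k l) (O.reflexive (sym εε≈)))) ,
    O.trans (O.reflexive εε≈) (O.trans (term≤sum (λ l → 0≤² (H i l)) j)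
      (term≤sum (λ k → sum-nonNeg (λ l → 0≤² (H k l))) i))
    where
    H²≤c² : H i j * H i j ≤ c * c
    H²≤c² = ≤-by ((c - H i j) * (c + H i j)) (*-nonNeg (proj₁ (H≼c i j)) (proj₂ (H≼c i j)))
      (solve 2 (λ c h → c :* c := h :* h :+ (c :- h) :* (c :+ h)) refl c (H i j))

  ^-≤1 : ∀ {u} n → 0# ≤ u → u ≤ 1# → u ^ n ≤ 1#
  ^-≤1 zero    0≤u u≤1 = O.refl
  ^-≤1 (suc n) 0≤u u≤1 = O.trans (*-mono-≤ 0≤u 0≤1 u≤1 (^-≤1 n 0≤u u≤1)) (O.reflexive (*-identityˡ 1#))

  ^-suc-≤ : ∀ {u} n → 0# ≤ u → u ≤ 1# → u ^ suc n ≤ u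
  ^-suc-≤ {u} n 0≤u u≤1 = O.trans (*-monoˡ-≤ u 0≤u (^-≤1 n 0≤u u≤1)) (O.reflexive (*-identityʳ u))

  quadratic-gram : ∀ {n} (f : Fin n → ℝ^ n) y → quadratic (gram f) y ≈ ⟨ combination y f , combination y f ⟩
  quadratic-gram {n} f y = sym (trans (⟨combination,⟩ y f (combination y f)) (sum-cong-≋ {n} (λ i → trans
    (*-congˡ (⟨,combination⟩ y f (f i))) (trans (*-distribˡ-sum {n} (y i) (λ j → y j * ⟨ f i , f j ⟩))
      (sum-cong-≋ {n} (λ j → solve 3 (λ a b g → a :* (b :* g) := g :* (a :* b)) refl (y i) (y j) ⟨ f i , f j ⟩))))))

  tr-I : ∀ n → tr (I {n}) ≈ fromℕ n
  tr-I n = trans (sum-cong-≋ {n} I-same) (trans (sum-const n 1#) (*-identityʳ _))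

  -- Comparison with a nearby lattice

  module Local {k} (μ : InvariantMeasure (suc k)) (L : Lattice (suc k)) (X : FiniteSubset (suc k))
               (rescaled : IsRescaledMin L X) (D : IsSphericalDesign μ 4 X) where

    n : ℕ
    n = suc k

    open Design μ X D
    open Formulas zero

    τ : ℝ
    τ = sqrt (min L) ⁻¹

    minimal : ∀ i → ∃[ x ] Min L x × P i ≋ τ • x
    minimal i = Equivalence.to (rescaled (P i)) (i , ≋-refl)

    -- Read off from a point of X, a unit vector of the form τ • x with ⟨ x , x ⟩ ≈ min L.
    ττmin≈1 : τ * τ * min L ≈ 1#
    ττmin≈1 = begin
      τ * τ * min L                ≈⟨ *-congˡ (sym (proj₂ (proj₁ (proj₂ (minimal someIndex))))) ⟩
      τ * τ * ⟨ x , x ⟩            ≈⟨ *-assoc _ _ _ ⟩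
      τ * (τ * ⟨ x , x ⟩)          ≈⟨ *-congˡ (trans (sym (⟨,•⟩ τ x x)) (⟨⟩-comm x (τ • x))) ⟩
      τ * ⟨ τ • x , x ⟩            ≈⟨ sym (⟨,•⟩ τ (τ • x) x) ⟩
      ⟨ τ • x , τ • x ⟩            ≈⟨ ⟨⟩-cong (≋-sym P≋) (≋-sym P≋) ⟩
      ⟨ P someIndex , P someIndex ⟩ ≈⟨ P-unit someIndex ⟩
      1#                           ∎
      where
      x : ℝ^ n
      x = proj₁ (minimal someIndex)
      P≋ : P someIndex ≋ τ • x
      P≋ = proj₂ (proj₂ (minimal someIndex))

    C : Matrix n
    C = coordinates (isBasis L)

    C-bounded : ∃[ w ] 0# ≤ w × (∀ i j → C i j ≼ w)
    C-bounded = bounded-matrix C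

    w c : ℝ
    w = proj₁ C-bounded
    c = detConstant n

    -- At H = 0 and ε = 1 the constant bounds an absolute value in `det-I+`.
    0≤c : 0# ≤ c
    0≤c = 0≤-resp (≼⇒0≤ (det-I+ {n} {1#} {λ _ _ → 0#} O.refl (λ _ _ → ≼-weaken (≼-refl O.refl) 0≤1)))
      (sym (trans (*-congˡ (*-identityˡ 1#)) (*-identityʳ c)))

    -- The image of the standard basis under the linear map basis L ↦ basis L₁.
    module _ (L₁ : Lattice n) where

      f : Fin n → ℝ^ n
      f = C ⊡ basis L₁

      Q : Matrix n
      Q = gram f

      detL-Q : detL L₁ ≈ detL L * det Q
      detL-Q = begin
        detL L₁                          ≈⟨ det-gram (basis L₁) ⟩
        b′ * b′                          ≈⟨ trans (sym (*-identityˡ _)) (*-congʳ (sym (*-identityˡ 1#))) ⟩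
        1# * 1# * (b′ * b′)              ≈⟨ *-congʳ (*-cong (sym (det-coordinates (isBasis L))) (sym (det-coordinates (isBasis L)))) ⟩
        d * b * (d * b) * (b′ * b′)      ≈⟨ solve 3 (λ d b e → d :* b :* (d :* b) :* (e :* e) := b :* b :* (d :* e :* (d :* e))) refl d b b′ ⟩
        b * b * (d * b′ * (d * b′))      ≈⟨ *-cong (sym (det-gram (basis L))) (*-cong (sym (det-⊡ C (basis L₁))) (sym (det-⊡ C (basis L₁)))) ⟩
        detL L * (det f * det f)         ≈⟨ *-congˡ (sym (det-gram f)) ⟩
        detL L * det Q                   ∎
        where
        d  = det C
        b  = det (basis L)
        b′ = det (basis L₁)

      -- The ratio of min L₁ to min L, since τ * τ is the inverse of min L.
      μ′ : ℝ
      μ′ = τ * τ * min L₁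

      0≤μ′ : 0# ≤ μ′
      0≤μ′ = *-nonNeg (0≤² τ) (0≤min L₁)

      -- The minimal vector x behind `P i` and the vector x′ of L₁ with the same integer coordinates
      -- correspond under the linear map given by f. Hence Q takes at `P i` the value τ² ⟨ x′ , x′
      -- ⟩, and x′ is nonzero because `P i` is.
      μ′≤quadratic : ∀ i → μ′ ≤ quadratic Q (P i)
      μ′≤quadratic i = O.trans (*-monoˡ-≤ (τ * τ) (0≤² τ) (min-lower L₁ (z , ≋-refl) x′≉𝟎)) (O.reflexive (begin
        τ * τ * ⟨ x′ , x′ ⟩              ≈⟨ *-assoc _ _ _ ⟩
        τ * (τ * ⟨ x′ , x′ ⟩)            ≈⟨ *-congˡ (trans (sym (⟨,•⟩ τ x′ x′)) (⟨⟩-comm x′ (τ • x′))) ⟩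
        τ * ⟨ τ • x′ , x′ ⟩              ≈⟨ sym (⟨,•⟩ τ (τ • x′) x′) ⟩
        ⟨ τ • x′ , τ • x′ ⟩              ≈⟨ ⟨⟩-cong (≋-sym Pf≋) (≋-sym Pf≋) ⟩
        ⟨ combination (P i) f , combination (P i) f ⟩ ≈⟨ sym (quadratic-gram f (P i)) ⟩
        quadratic Q (P i)                ∎))
        where
        x x′ : ℝ^ n
        x = proj₁ (minimal i)
        z : Vector ℤ n
        z = proj₁ (proj₁ (proj₁ (proj₂ (minimal i))))
        ζ : ℝ^ n
        ζ j = fromℤ (z j)
        x≋ : x ≋ combination ζ (basis L)
        x≋ = proj₂ (proj₁ (proj₁ (proj₂ (minimal i))))
        P≋ : P i ≋ τ • x
        P≋ = proj₂ (proj₂ (minimal i))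
        x′ = combination ζ (basis L₁)
        x′≉𝟎 : ¬ (x′ ≋ 𝟎)
        x′≉𝟎 x′≋𝟎 = 0≉1 (trans (sym (⟨𝟎,𝟎⟩ P≋𝟎)) (P-unit i))
          where
          P≋𝟎 : P i ≋ 𝟎
          P≋𝟎 j = trans (P≋ j) (trans (*-congˡ (trans (x≋ j) (sum-0 {n} (λ l → trans
            (*-congʳ (IsBasis.independent (isBasis L₁) ζ x′≋𝟎 l)) (zeroˡ (basis L l j)))))) (zeroʳ τ))
        combination-• : ∀ (b : Fin n → ℝ^ n) → combination (τ • ζ) b ≋ τ • combination ζ b
        combination-• b j = trans (sum-cong-≋ {n} (λ l → *-assoc τ (ζ l) (b l j))) (sym (*-distribˡ-sum {n} τ (λ l → ζ l * b l j)))
        PC≋ : combination (P i) C ≋ τ • ζ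
        PC≋ = combination-injective (isBasis L) _ (τ • ζ)
          (≋-trans (≋-sym (combination-combination (P i) C (basis L)))
          (≋-trans (combination-congʳ (P i) (coordinates-⊡ (isBasis L)))
          (≋-trans (λ j → sum-Iʳ j (P i)) (≋-trans P≋
          (≋-trans (λ j → *-congˡ (x≋ j)) (≋-sym (combination-• (basis L))))))))
        Pf≋ : combination (P i) f ≋ τ • x′
        Pf≋ = ≋-trans (combination-combination (P i) C (basis L₁))
          (≋-trans (combination-congˡ (basis L₁) PC≋) (combination-• (basis L₁)))

      f-I≼ : ∀ {η} → (∀ i j → basis L₁ i j - basis L i j ≼ η) → ∀ i j → f i j - I i j ≼ fromℕ n * (w * η)
      f-I≼ {η} close i j = ≼-resp (≼-sum {n} (λ l → ≼-* (proj₂ (proj₂ C-bounded) i l) (close l j)))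
        (sym (trans (⟨,-⟩ (C i) (λ l → basis L₁ l j) (λ l → basis L l j)) (+-congˡ (-‿cong (coordinates-⊡ (isBasis L) i j)))))
        (sym (sum-const n (w * η)))

      -- Split ⟨ fᵢ , fⱼ ⟩ - Iᵢⱼ into ⟨ fᵢ , fⱼ - eⱼ ⟩ and the entry of f - I; the entries of f are
      -- at most 1 + ρ, hence at most 2.
      Q-I≼ : ∀ {ρ} → ρ ≤ 1# → (∀ i j → f i j - I i j ≼ ρ) → ∀ i j → Q i j - I i j ≼ (fromℕ n * 2# + 1#) * ρ
      Q-I≼ {ρ} ρ≤1 f-I≼ρ i j = ≼-resp
        (≼-+ (≼-sum {n} (λ l → ≼-* (f≼2 l) (f-I≼ρ j l))) (f-I≼ρ i j))
        (begin
          Q i j - I i j                                  ≈⟨ solve 3 (λ q x i → q :- i := (q :- x) :+ (x :- i)) refl (Q i j) (f i j) (I i j) ⟩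
          (Q i j - f i j) + (f i j - I i j)              ≈⟨ +-congʳ (+-congˡ (-‿cong (sym (trans (⟨⟩-comm (f i) (I j)) (sum-Iˡ j (f i)))))) ⟩
          (⟨ f i , f j ⟩ - ⟨ f i , I j ⟩) + (f i j - I i j) ≈⟨ +-congʳ (sym (⟨,-⟩ (f i) (f j) (I j))) ⟩
          sum (λ l → f i l * (f j l - I j l)) + (f i j - I i j) ∎)
        (begin
          (fromℕ n * 2# + 1#) * ρ                        ≈⟨ solve 2 (λ m r → (m :* con (+ 2) :+ con (+ 1)) :* r := m :* (con (+ 2) :* r) :+ r) refl (fromℕ n) ρ ⟩
          fromℕ n * (2# * ρ) + ρ                         ≈⟨ +-congʳ (sym (sum-const n (2# * ρ))) ⟩
          sum {n} (λ _ → 2# * ρ) + ρ                     ∎)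
        where
        f≼2 : ∀ l → f i l ≼ 2#
        f≼2 l = ≼-resp (≼-+ (I≼1 i l) (≼-weaken (f-I≼ρ i l) ρ≤1))
          (solve 2 (λ f i → f := i :+ (f :- i)) refl (f i l) (I i l)) refl

      -- The condition 4 r ≤ 1 keeps the entries of H at most 1, as `det-I+` asks, and the scale
      -- away from zero; `small` is the requirement c κ ≤ 2 β.
      module _ {r} (0<r : 0# < r) (4r≤1 : 4# * r ≤ 1#) (small : c * (fromℕ n * (fromℕ n * (4# * r))) ≤ 2# * β)
               (Q-I≼r : ∀ i j → Q i j - I i j ≼ r) where

        -- The scale is the λ of the overview: dividing by the mean diagonal entry of Q is what
        -- makes H traceless. The 4 in `H-bound` is 2 for the inverse scale times 2 for the
        -- deviations of Q and of the scale, r each. In κ the n² entries of H are multiplied by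
        -- coordinates of size at most 1.
        ν scale H-bound κ : ℝ
        ν       = fromℕ n ⁻¹
        scale   = ν * tr Q
        H-bound = 4# * r
        κ       = fromℕ n * (fromℕ n * H-bound)

        0<n : 0# < fromℕ n
        0<n = 0<fromℕ k

        νn≈1 : ν * fromℕ n ≈ 1#
        νn≈1 = *-inverseˡ (fromℕ n) (0<⇒≉0 0<n)

        scale-1≼r : scale - 1# ≼ r
        scale-1≼r = ≼-resp (≼-* (≼-refl (0≤⁻¹ 0<n)) (≼-sum {n} (λ i → Q-I≼r i i)))
          (begin
            ν * tr Q - 1#                          ≈⟨ +-congˡ (-‿cong (trans (sym νn≈1) (*-congˡ (sym (tr-I n))))) ⟩
            ν * tr Q - ν * tr I′                   ≈⟨ solve 3 (λ v q i → v :* q :- v :* i := v :* (q :+ (:- con (+ 1)) :* i)) refl ν (tr Q) (tr I′) ⟩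
            ν * (tr Q + - 1# * tr I′)              ≈⟨ *-congˡ (+-congˡ (*-distribˡ-sum {n} (- 1#) (λ i → I′ i i))) ⟩
            ν * (tr Q + sum (λ i → - 1# * I′ i i)) ≈⟨ *-congˡ (sym (∑-distrib-+ {n} (λ i → Q i i) (λ i → - 1# * I′ i i))) ⟩
            ν * sum (λ i → Q i i + - 1# * I′ i i)  ≈⟨ *-congˡ (sum-cong-≋ {n} (λ i → solve 2 (λ q i → q :+ (:- con (+ 1)) :* i := q :- i) refl (Q i i) (I′ i i))) ⟩
            ν * sum (λ i → Q i i - I′ i i)         ∎)
          (begin
            r                                      ≈⟨ trans (sym (*-identityˡ r)) (*-congʳ (sym νn≈1)) ⟩
            ν * fromℕ n * r                        ≈⟨ trans (*-assoc _ _ _) (*-congˡ (sym (sum-const n r))) ⟩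
            ν * sum {n} (λ _ → r)                  ∎)
          where
          I′ : Matrix n
          I′ = I

        1≤2scale : 1# ≤ 2# * scale
        1≤2scale = ≤-by (2# * (r + (scale - 1#)) + ((1# - 4# * r) + 2# * r))
          (0≤+ (*-nonNeg 0≤2 (proj₂ scale-1≼r)) (0≤+ (0≤y-x 4r≤1) (*-nonNeg 0≤2 (proj₁ 0<r))))
          (solve 2 (λ s r → con (+ 2) :* s := con (+ 1) :+ (con (+ 2) :* (r :+ (s :- con (+ 1))) :+
            ((con (+ 1) :- con (+ 4) :* r) :+ con (+ 2) :* r))) refl scale r)

        0<scale : 0# < scale
        0<scale = <-≤-trans (0<half 0<1) (*-cancelˡ-≤ 2# 0<2 (O.trans (O.reflexive
          (trans (solve 1 (λ h → con (+ 2) :* h := h :+ h) refl (half 1#)) (half+half 1#))) 1≤2scale))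

        scale⁻¹ : ℝ
        scale⁻¹ = scale ⁻¹

        scale⁻¹*scale : scale⁻¹ * scale ≈ 1#
        scale⁻¹*scale = *-inverseˡ scale (0<⇒≉0 0<scale)

        scale⁻¹≼2 : scale⁻¹ ≼ 2#
        scale⁻¹≼2 = ≼-weaken (≼-refl (0≤⁻¹ 0<scale)) (O.trans (O.reflexive (sym (*-identityʳ _)))
          (O.trans (*-monoˡ-≤ scale⁻¹ (0≤⁻¹ 0<scale) 1≤2scale) (O.reflexive (trans
            (solve 2 (λ i s → i :* (con (+ 2) :* s) := con (+ 2) :* (i :* s)) refl scale⁻¹ scale)
            (trans (*-congˡ scale⁻¹*scale) (*-identityʳ 2#))))))

        H : Matrix n
        H i j = scale⁻¹ * Q i j - I i j

        H≼ : ∀ i j → H i j ≼ H-bound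
        H≼ i j = ≼-resp (≼-* scale⁻¹≼2 (≼-+ (Q-I≼r i j) (≼-neg (≼-* scale-1≼r (I≼1 i j)))))
          (begin
            scale⁻¹ * Q i j - I i j                             ≈⟨ +-congˡ (-‿cong (trans (sym (*-identityˡ _)) (*-congʳ (sym scale⁻¹*scale)))) ⟩
            scale⁻¹ * Q i j - scale⁻¹ * scale * I i j           ≈⟨ solve 4 (λ a q s i → a :* q :- a :* s :* i := a :* ((q :- i) :+ (:- ((s :- con (+ 1)) :* i)))) refl scale⁻¹ (Q i j) scale (I i j) ⟩
            scale⁻¹ * ((Q i j - I i j) + - ((scale - 1#) * I i j)) ∎)
          (solve 1 (λ r → con (+ 4) :* r := con (+ 2) :* (r :+ r :* con (+ 1))) refl r)

        H-sym : ∀ i j → H i j ≈ H j i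
        H-sym i j = +-cong (*-congˡ (⟨⟩-comm (f i) (f j))) (-‿cong (reflexive (I-sym i j)))

        scale-I+H : ∀ i j → Q i j ≈ scale * (I+ H) i j
        scale-I+H i j = sym (trans (solve 4 (λ s a q i → s :* (i :+ (a :* q :- i)) := a :* s :* q) refl scale scale⁻¹ (Q i j) (I i j))
          (trans (*-congʳ scale⁻¹*scale) (*-identityˡ _)))

        tr-H : tr H ≈ 0#
        tr-H = begin
          tr H                                      ≈⟨ sum-cong-≋ {n} (λ i → +-congˡ {x = scale⁻¹ * Q i i} (-‿cong (I-same i))) ⟩
          sum (λ i → scale⁻¹ * Q i i + - 1#)        ≈⟨ ∑-distrib-+ {n} (λ i → scale⁻¹ * Q i i) (λ _ → - 1#) ⟩
          sum (λ i → scale⁻¹ * Q i i) + sum {n} (λ _ → - 1#) ≈⟨ +-cong (sym (*-distribˡ-sum {n} scale⁻¹ (λ i → Q i i))) (sum-const n (- 1#)) ⟩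
          scale⁻¹ * tr Q + fromℕ n * - 1#           ≈⟨ +-cong (*-congˡ (trans (sym (*-identityˡ _)) (*-congʳ (trans (sym νn≈1) (*-comm _ _))))) (*-congˡ (-‿cong (sym scale⁻¹*scale))) ⟩
          scale⁻¹ * (fromℕ n * ν * tr Q) + fromℕ n * - (scale⁻¹ * scale)
            ≈⟨ solve 4 (λ a m v t → a :* (m :* v :* t) :+ m :* (:- (a :* (v :* t))) := con (+ 0)) refl scale⁻¹ (fromℕ n) ν (tr Q) ⟩
          0#                                        ∎

        det-Q : det Q ≈ scale ^ n * det (I+ H)
        det-Q = trans (det-cong scale-I+H) (det-scale scale (I+ H))

        quadratic-Q : ∀ i → scale⁻¹ * quadratic Q (P i) ≈ 1# + quadratic H (P i)
        quadratic-Q i = begin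
          scale⁻¹ * quadratic Q (P i)               ≈⟨ *-∑∑ scale⁻¹ (λ a b → Q a b * (P i a * P i b)) ⟩
          ∑∑ (λ a b → scale⁻¹ * (Q a b * (P i a * P i b)))
            ≈⟨ ∑∑-cong (λ a b → solve 4 (λ s q i y → s :* (q :* y) := i :* y :+ (s :* q :- i) :* y) refl scale⁻¹ (Q a b) (I a b) (P i a * P i b)) ⟩
          ∑∑ (λ a b → I a b * (P i a * P i b) + H a b * (P i a * P i b)) ≈⟨ ∑∑-+ (λ a b → I a b * (P i a * P i b)) (λ a b → H a b * (P i a * P i b)) ⟩
          quadratic I (P i) + quadratic H (P i)     ≈⟨ +-congʳ (quadratic-I i) ⟩
          1# + quadratic H (P i)                    ∎

        u : ℝ
        u = scale⁻¹ * μ′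

        0≤u : 0# ≤ u
        0≤u = *-nonNeg (0≤⁻¹ 0<scale) 0≤μ′

        -- This makes 1 - u an admissible m in `quadratic-dips`.
        u-1≤quadratic : ∀ i → - (1# - u) ≤ quadratic H (P i)
        u-1≤quadratic i = ≤-by _ (0≤y-x (O.trans (*-monoˡ-≤ scale⁻¹ (0≤⁻¹ 0<scale) (μ′≤quadratic i)) (O.reflexive (quadratic-Q i))))
          (solve 2 (λ u q → q := (:- (con (+ 1) :- u)) :+ (con (+ 1) :+ q :- u)) refl u (quadratic H (P i)))

        quadratic≤κ : ∀ i → quadratic H (P i) ≤ κ
        quadratic≤κ i = ≼⇒≤ (≼-resp
          (≼-sum {n} (λ a → ≼-sum {n} (λ b → ≼-* (H≼ a b) (≼-* (P≼1 a) (P≼1 b))))) refl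
          (sym (trans (sum-const n _) (*-congˡ (trans (sum-const n _) (*-congˡ (trans (*-congˡ (*-identityˡ 1#)) (*-identityʳ _))))))))
          where
          P≼1 : ∀ a → P i a ≼ 1#
          P≼1 = unit-≼1 {x = P i} (O.reflexive (P-unit i))

        0<κ : 0# < κ
        0<κ = 0<* 0<n (0<* 0<n (0<* 0<4 0<r))

        -- u ≤ 1 - cε² ≤ det (I + H), where ε is the largest entry of H.
        u^n≤det : u ^ n ≤ det (I+ H)
        -- As n ≥ 1 and 0 ≤ u ≤ 1, the power is at most u. The difference of det (I + H) and u is
        -- split into the slack in c ε² ≤ 1 - u and the slack in the lower bound for the
        -- determinant.
        u^n≤det = O.trans (^-suc-≤ k 0≤u u≤1) (≤-by
            ((1# - u - c * (ε * ε)) + (c * (ε * ε) + (det (I+ H) - (1# + tr H))))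
            (0≤+ (0≤y-x cεε≤1-u) (proj₂ det≼))
            (trans (solve 3 (λ u e d → d := u :+ ((con (+ 1) :- u :- e) :+ (e :+ (d :- (con (+ 1) :+ con (+ 0)))))) refl u (c * (ε * ε)) (det (I+ H)))
              (+-congˡ (+-congˡ (+-congˡ (+-congˡ (-‿cong (+-congˡ (sym tr-H)))))))))
          where
          maximum : ∃[ ε ] ε ≤ H-bound × (∀ i j → H i j ≼ ε) × ε * ε ≤ ∑∑ (λ i j → H i j * H i j)
          maximum = max-entry H H≼
          ε : ℝ
          ε = proj₁ maximum
          ε≤ : ε ≤ H-bound
          ε≤ = proj₁ (proj₂ maximum)
          H≼ε : ∀ i j → H i j ≼ ε
          H≼ε = proj₁ (proj₂ (proj₂ maximum))
          εε≤ : ε * ε ≤ ∑∑ (λ i j → H i j * H i j)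
          εε≤ = proj₂ (proj₂ (proj₂ maximum))
          det≼ : det (I+ H) - (1# + tr H) ≼ c * (ε * ε)
          det≼ = det-I+ (O.trans ε≤ 4r≤1) H≼ε
          -- Chain κ c ε² ≤ 2 β ε² ≤ (1 - u) κ, then cancel the positive κ.
          cεε≤1-u : c * (ε * ε) ≤ 1# - u
          cεε≤1-u = *-cancelˡ-≤ κ 0<κ (O.trans (O.reflexive (solve 3 (λ k c e → k :* (c :* e) := e :* (c :* k)) refl κ c (ε * ε)))
            (O.trans (*-monoˡ-≤ (ε * ε) (0≤² ε) small) (O.trans (O.reflexive (*-comm _ _))
            (O.trans (quadratic-dips H-sym tr-H εε≤ quadratic≤κ u-1≤quadratic) (O.reflexive (*-comm _ _))))))
          u≤1 : u ≤ 1#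
          u≤1 = ≤-by (1# - u) (O.trans (≼⇒0≤ det≼) cεε≤1-u) (solve 1 (λ u → con (+ 1) := u :+ (con (+ 1) :- u)) refl u)

        -- Here min L₁ = min L · λ · u and det L₁ = det L · λⁿ · det (I + H) with λ the scale, so λⁿ
        -- is common to both sides and `u^n≤det` remains.
        δ-local : δ L₁ ≤ δ L
        δ-local = δ-mono L L₁ (O.trans (O.reflexive (*-comm _ _)) (O.trans (*-monoˡ-≤ (detL L) (proj₁ (0<detL L)) (O.trans (O.reflexive (begin
            min L₁ ^ n                              ≈⟨ ^-cong n min-L₁ ⟩
            (min L * scale * u) ^ n                 ≈⟨ trans (^-distrib-* (min L * scale) u n) (*-congʳ (^-distrib-* (min L) scale n)) ⟩
            min L ^ n * scale ^ n * u ^ n           ∎))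
            (*-monoˡ-≤ (min L ^ n * scale ^ n) (*-nonNeg (^-nonNeg n (0≤min L)) (^-nonNeg n (proj₁ 0<scale))) u^n≤det)))
          (O.reflexive (begin
            detL L * (min L ^ n * scale ^ n * det (I+ H)) ≈⟨ solve 4 (λ d m s e → d :* (m :* s :* e) := m :* (d :* (s :* e))) refl (detL L) (min L ^ n) (scale ^ n) (det (I+ H)) ⟩
            min L ^ n * (detL L * (scale ^ n * det (I+ H))) ≈⟨ *-congˡ (trans (*-congˡ (sym det-Q)) (sym detL-Q)) ⟩
            min L ^ n * detL L₁                     ∎))))
          where
          min-L₁ : min L₁ ≈ min L * scale * u
          min-L₁ = sym (trans
            (solve 5 (λ m s a t l → m :* s :* (a :* (t :* t :* l)) := a :* s :* (t :* t :* m) :* l) refl (min L) scale scale⁻¹ τ (min L₁))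
            (trans (*-congʳ (trans (*-cong scale⁻¹*scale ττmin≈1) (*-identityˡ 1#))) (*-identityˡ _)))

    -- The tolerance r for Q is chosen first, below the thresholds for 4 r ≤ 1 and for c κ ≤ 2 β.
    -- The radius η for bases follows from it: the inverse basis costs a factor n w, and passing to
    -- Gram matrices a factor 2 n + 1.
    isExtreme : Extreme L
    isExtreme = extreme L 0<η λ L₁ close → δ-local L₁ 0<r 4r≤1 small
      (λ i j → ≼-weaken (Q-I≼ L₁ ρ≤1 (f-I≼ L₁ close) i j) Kη≤)
      where
      chooseR₁ : ∃[ r ] 0# < r × 4# * r ≤ 1#
      chooseR₁ = scaleBelow (proj₁ 0<4) 0<1
      K′ : ℝ
      K′ = c * (fromℕ n * (fromℕ n * 4#))
      0≤K′ : 0# ≤ K′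
      0≤K′ = *-nonNeg 0≤c (*-nonNeg (0≤fromℕ n) (*-nonNeg (0≤fromℕ n) (proj₁ 0<4)))
      chooseR₂ : ∃[ r ] 0# < r × K′ * r ≤ 2# * β
      chooseR₂ = scaleBelow 0≤K′ (0<* 0<2 0<β)
      chooseR : ∃[ r ] 0# < r × r ≤ proj₁ chooseR₁ × r ≤ proj₁ chooseR₂
      chooseR = minimum₂ (proj₁ (proj₂ chooseR₁)) (proj₁ (proj₂ chooseR₂))
      r : ℝ
      r = proj₁ chooseR
      0<r : 0# < r
      0<r = proj₁ (proj₂ chooseR)
      4r≤1 : 4# * r ≤ 1#
      4r≤1 = O.trans (*-monoˡ-≤ 4# (proj₁ 0<4) (proj₁ (proj₂ (proj₂ chooseR)))) (proj₂ (proj₂ chooseR₁))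
      small : c * (fromℕ n * (fromℕ n * (4# * r))) ≤ 2# * β
      small = O.trans (O.reflexive (solve 3 (λ c m r → c :* (m :* (m :* (con (+ 4) :* r))) := c :* (m :* (m :* con (+ 4))) :* r) refl c (fromℕ n) r))
        (O.trans (*-monoˡ-≤ K′ 0≤K′ (proj₂ (proj₂ (proj₂ chooseR)))) (proj₂ (proj₂ chooseR₂)))
      K : ℝ
      K = (fromℕ n * 2# + 1#) * (fromℕ n * w)
      0≤w : 0# ≤ w
      0≤w = proj₁ (proj₂ C-bounded)
      0≤n2 : 0# ≤ fromℕ n * 2#
      0≤n2 = *-nonNeg (0≤fromℕ n) 0≤2
      chooseη : ∃[ η ] 0# < η × K * η ≤ r
      chooseη = scaleBelow (*-nonNeg (0≤+ 0≤n2 0≤1) (*-nonNeg (0≤fromℕ n) 0≤w)) 0<r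
      η ρ : ℝ
      η = proj₁ chooseη
      ρ = fromℕ n * (w * η)
      0<η : 0# < η
      0<η = proj₁ (proj₂ chooseη)
      0≤ρ : 0# ≤ ρ
      0≤ρ = *-nonNeg (0≤fromℕ n) (*-nonNeg 0≤w (proj₁ 0<η))
      Kη≤ : (fromℕ n * 2# + 1#) * ρ ≤ r
      Kη≤ = O.trans (O.reflexive (solve 3 (λ m w e → (m :* con (+ 2) :+ con (+ 1)) :* (m :* (w :* e)) := (m :* con (+ 2) :+ con (+ 1)) :* (m :* w) :* e) refl (fromℕ n) w η))
        (proj₂ (proj₂ chooseη))
      ρ≤1 : ρ ≤ 1#
      ρ≤1 = O.trans (≤-by (fromℕ n * 2# * ρ) (*-nonNeg 0≤n2 0≤ρ)
          (solve 2 (λ m r → (m :+ con (+ 1)) :* r := r :+ m :* r) refl (fromℕ n * 2#) ρ))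
        (O.trans Kη≤ (O.trans (≤-by (3# * r) (*-nonNeg (proj₁ 0<3) (proj₁ 0<r))
          (solve 1 (λ r → con (+ 4) :* r := r :+ con (+ 3) :* r) refl r)) 4r≤1))

  stronglyPerfect⇒extreme : ∀ n (μ : InvariantMeasure n) (L : Lattice n) → StronglyPerfect μ L → Extreme L
  -- A design has a point, but in dimension 0 its norm would be the empty sum, which is not 1.
  stronglyPerfect⇒extreme zero    μ L (X , _ , D)        = ⊥-elim (0≉1 (isUnit (Design.somePoint μ X D)))
  stronglyPerfect⇒extreme (suc k) μ L (X , rescaled , D) = Local.isExtreme μ L X rescaled D

mainTheorem1 : ExcludedMiddle 0ℓ → (𝓡 : RealField) → let open Lattices 𝓡 in
    (n : ℕ) (μ : InvariantMeasure n) (L : Lattice n) →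
    StronglyPerfect μ L → Extreme L
mainTheorem1 = StronglyPerfectLattices.stronglyPerfect⇒extreme
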